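{- Let $d\ge 3$ be odd, $V=(\mathbb{C}^2)^{\otimes d}$, and let $\pmb{\lambda}=(\lambda^{(1)},\ldots,\lambda^{(d)})$ be a $d$-tuple of partitions of the same integer $m\le 2^{d-1}$, each with at most two columns (all parts at most $2$), such that $(\lambda^{(1)})'=(m)$. For $n=0,\ldots,2^{d-1}-m$ let $$U_{m+2n}:=\mathrm{HWV}_{\pmb{\lambda}'+(2\times n)^d}\bigwedge^{m+2n}V .$$ Let $X(v)=\omega\wedge v$ for $v\in\bigwedge V$, where $\omega=\omega_{d,2}$. Then the map $$X^\ell:\ U_{2^{d-1}-\ell}\longrightarrow U_{2^{d-1}+\ell}$$ is an isomorphism for $\ell=0,\ldots,m/2$ if $m$ is even, and for $\ell=1,\ldots,\lfloor m/2\rfloor$ if $m$ is odd.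
   Context: $\lambda'$ denotes the conjugate partition (componentwise on tuples). $(2\times n)^d$ is the $d$-tuple all of whose entries are $(n,n)$, and addition of tuples is componentwise (partitions of length at most $2$ being padded with zeros to vectors in $\mathbb{Z}^2$). For an index $r$ not of the form $m+2n$ with $0\le n\le 2^{d-1}-m$, $U_r$ is read as the zero space. The group $\mathrm{GL}(2)^{\times d}$ acts on $V$ multilinearly and hence on $\bigwedge V$. A vector $v$ is a weight vector of weight $\pmb{\mu}=(\mu^{(1)},\ldots,\mu^{(d)})$, $\mu^{(j)}\in\mathbb{Z}^2$, if every tuple of diagonal matrices $(\mathrm{diag}(a^{(1)}_1,a^{(1)}_2),\ldots,\mathrm{diag}(a^{(d)}_1,a^{(d)}_2))$ acts on $v$ as the scalar $\prod_j\prod_i (a^{(j)}_i)^{\mu^{(j)}_i}$. $\mathrm{HWV}_{\pmb{\mu}}\bigwedge^r V$ is the space consisting of $0$ and the nonzero weight vectors of weight $\pmb{\mu}$ in $\bigwedge^r V$ invariant under $U(2)^{\times d}$, with $U(2)$ the group of upper unitriangular matrices. The Cayley form is $$\omega_{d,2}=\sum_{\pi_1,\ldots,\pi_d\in S_2}\mathrm{sgn}(\pi_1\cdots\pi_d)\,\left(e_{\pi_1(1)}\otimes\cdots\otimes e_{\pi_d(1)}\right)\wedge\left(e_{\pi_1(2)}\otimes\cdots\otimes e_{\pi_d(2)}\right)\in\bigwedge^2V,$$ where $e_1,e_2$ is the standard basis of $\mathbb{C}^2$. -}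

module Defs where

open import Level using (0ℓ; _⊔_)
open import Algebra.Bundles using (CommutativeRing; Semiring)
open import Algebra.Structures using (IsCommutativeRing)
open import Data.Bool.Base using (if_then_else_)
open import Data.Fin.Base using (Fin; zero; suc)
open import Data.Fin.Permutation using (Permutation′; transpose; _⟨$⟩ʳ_; _∘ₚ_)
  renaming (id to idₚ)
import Data.Fin.Properties as Fin
open import Data.Integer.Base as ℤ using (ℤ; +_; -[1+_])
open import Data.List.Base as List using (List; []; _∷_)
open import Data.List.Relation.Unary.All using (All)
open import Data.List.Relation.Unary.Linked using (Linked)
open import Data.Nat.Base as ℕ using (ℕ; zero; suc)
open import Data.Nat.ListAction using (sum)
import Data.Nat.Properties as ℕ
open import Data.Product.Base using (∃-syntax; _×_; _,_)
open import Data.Rational.Base as ℚ using (ℚ; 0ℚ; 1ℚ; ½)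
import Data.Rational.Properties as ℚ
open import Data.Rational.Solver using (module +-*-Solver)
open import Data.Vec.Base as Vec using (Vec; []; _∷_)
open import Function.Base using (_∘_; _$_)
open import Relation.Binary.PropositionalEquality using (_≡_)
open import Relation.Binary.Structures using (IsEquivalence)
open import Relation.Nullary using (¬_; does)

------------------------------------------------------------------------
-- Real numbers: Cauchy sequences of rationals, identified when their
-- difference tends to zero

record ℝ : Set where
  constructor mkℝ
  field
    seq    : ℕ → ℚ
    cauchy : ∀ ε → 0ℚ ℚ.< ε →
             ∃[ N ] (∀ m n → N ℕ.≤ m → N ℕ.≤ n → ℚ.∣ seq m ℚ.- seq n ∣ ℚ.< ε)

open ℝ public

module Real where

  open import Relation.Binary.PropositionalEquality
    using (refl; sym; trans; cong; cong₂; subst)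

  infix  4 _≈_
  infixl 6 _+_
  infixl 7 _*_

  _≈_ : ℝ → ℝ → Set
  x ≈ y = ∀ ε → 0ℚ ℚ.< ε →
          ∃[ N ] (∀ n → N ℕ.≤ n → ℚ.∣ seq x n ℚ.- seq y n ∣ ℚ.< ε)

  private
    half : ∀ ε → 0ℚ ℚ.< ε → ∃[ δ ] (0ℚ ℚ.< δ × δ ℚ.+ δ ≡ ε)
    half ε ε>0 = ½ ℚ.* ε
      , subst (ℚ._< ½ ℚ.* ε) (ℚ.*-zeroʳ ½) (ℚ.*-monoʳ-<-pos ½ ε>0)
      , trans (sym (ℚ.*-distribʳ-+ ε ½ ½)) (ℚ.*-identityˡ ε)

    shrink : ∀ B ε → 0ℚ ℚ.< B → 0ℚ ℚ.< ε → ∃[ δ ] (0ℚ ℚ.< δ × B ℚ.* δ ≡ ε)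
    shrink B ε B>0 ε>0 = 1/B ℚ.* ε
      , subst (ℚ._< 1/B ℚ.* ε) (ℚ.*-zeroʳ 1/B)
          (ℚ.*-monoʳ-<-pos 1/B ε>0)
      , trans (sym (ℚ.*-assoc B 1/B ε))
          (trans (cong (ℚ._* ε) (ℚ.*-inverseʳ B)) (ℚ.*-identityˡ ε))
      where
      instance
        posB : ℚ.Positive B
        posB = ℚ.positive B>0
        nzB : ℚ.NonZero B
        nzB = ℚ.pos⇒nonZero B
      1/B : ℚ
      1/B = ℚ.1/ B
      instance
        pos1/B : ℚ.Positive 1/B
        pos1/B = ℚ.1/pos⇒pos B

    dist-refl : ∀ a → ℚ.∣ a ℚ.- a ∣ ≡ 0ℚ
    dist-refl a = cong ℚ.∣_∣ (ℚ.+-inverseʳ a)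

    dist-sym : ∀ a b → ℚ.∣ a ℚ.- b ∣ ≡ ℚ.∣ b ℚ.- a ∣
    dist-sym a b = trans
      (cong ℚ.∣_∣ (solve 2 (λ a b → a :- b := :- (b :- a)) refl a b))
      (ℚ.∣-p∣≡∣p∣ (b ℚ.- a))
      where open +-*-Solver

    dist-triangle : ∀ a b c {δ} → ℚ.∣ a ℚ.- b ∣ ℚ.< δ → ℚ.∣ b ℚ.- c ∣ ℚ.< δ →
                    ℚ.∣ a ℚ.- c ∣ ℚ.< δ ℚ.+ δ
    dist-triangle a b c p q = ℚ.≤-<-trans
      (subst (λ z → ℚ.∣ z ∣ ℚ.≤ ℚ.∣ a ℚ.- b ∣ ℚ.+ ℚ.∣ b ℚ.- c ∣)
        (solve 3 (λ a b c → (a :- b) :+ (b :- c) := a :- c) refl a b c)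
        (ℚ.∣p+q∣≤∣p∣+∣q∣ (a ℚ.- b) (b ℚ.- c)))
      (ℚ.+-mono-< p q)
      where open +-*-Solver

    dist-+ : ∀ a b c d {δ} → ℚ.∣ a ℚ.- c ∣ ℚ.< δ → ℚ.∣ b ℚ.- d ∣ ℚ.< δ →
             ℚ.∣ (a ℚ.+ b) ℚ.- (c ℚ.+ d) ∣ ℚ.< δ ℚ.+ δ
    dist-+ a b c d p q = ℚ.≤-<-trans
      (subst (λ z → ℚ.∣ z ∣ ℚ.≤ ℚ.∣ a ℚ.- c ∣ ℚ.+ ℚ.∣ b ℚ.- d ∣)
        (solve 4 (λ a b c d → (a :- c) :+ (b :- d) := (a :+ b) :- (c :+ d))
          refl a b c d)
        (ℚ.∣p+q∣≤∣p∣+∣q∣ (a ℚ.- c) (b ℚ.- d)))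
      (ℚ.+-mono-< p q)
      where open +-*-Solver

    dist-neg : ∀ a b → ℚ.∣ (ℚ.- a) ℚ.- (ℚ.- b) ∣ ≡ ℚ.∣ a ℚ.- b ∣
    dist-neg a b = trans
      (cong ℚ.∣_∣ (solve 2 (λ a b → (:- a) :- (:- b) := :- (a :- b)) refl a b))
      (ℚ.∣-p∣≡∣p∣ (a ℚ.- b))
      where open +-*-Solver

    bounded-* : ∀ {B δ} p q → 0ℚ ℚ.< B → ℚ.∣ p ∣ ℚ.≤ B → ℚ.∣ q ∣ ℚ.< δ →
                ℚ.∣ p ℚ.* q ∣ ℚ.< B ℚ.* δ
    bounded-* {B} {δ} p q B>0 p≤B q<δ = ℚ.≤-<-trans
      (subst (ℚ._≤ B ℚ.* ℚ.∣ q ∣) (sym (ℚ.∣p*q∣≡∣p∣*∣q∣ p q))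
        (ℚ.*-monoʳ-≤-nonNeg ℚ.∣ q ∣ {{ℚ.∣-∣-nonNeg q}} p≤B))
      (ℚ.*-monoʳ-<-pos B {{ℚ.positive B>0}} q<δ)

    dist-* : ∀ {B δ} a b c d → 0ℚ ℚ.< B → ℚ.∣ a ∣ ℚ.≤ B → ℚ.∣ d ∣ ℚ.≤ B →
             ℚ.∣ a ℚ.- c ∣ ℚ.< δ → ℚ.∣ b ℚ.- d ∣ ℚ.< δ →
             ℚ.∣ (a ℚ.* b) ℚ.- (c ℚ.* d) ∣ ℚ.< B ℚ.* δ ℚ.+ B ℚ.* δ
    dist-* a b c d B>0 a≤B d≤B p q = ℚ.≤-<-trans
      (subst
        (λ z → ℚ.∣ z ∣ ℚ.≤ ℚ.∣ a ℚ.* (b ℚ.- d) ∣ ℚ.+ ℚ.∣ d ℚ.* (a ℚ.- c) ∣)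
        (solve 4 (λ a b c d →
            a :* (b :- d) :+ d :* (a :- c) := (a :* b) :- (c :* d))
          refl a b c d)
        (ℚ.∣p+q∣≤∣p∣+∣q∣ (a ℚ.* (b ℚ.- d)) (d ℚ.* (a ℚ.- c))))
      (ℚ.+-mono-< (bounded-* a (b ℚ.- d) B>0 a≤B q)
                  (bounded-* d (a ℚ.- c) B>0 d≤B p))
      where open +-*-Solver

    Bound : ℝ → ℚ → ℕ → Set
    Bound x B N = ∀ n → N ℕ.≤ n → ℚ.∣ seq x n ∣ ℚ.≤ B

    bound : ∀ x → ∃[ B ] (0ℚ ℚ.< B × ∃[ N ] Bound x B N)
    bound x with cauchy x 1ℚ (ℚ.positive⁻¹ 1ℚ)
    ... | N , close = 1ℚ ℚ.+ ℚ.∣ seq x N ∣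
      , ℚ.positive⁻¹ (1ℚ ℚ.+ ℚ.∣ seq x N ∣)
          {{ℚ.pos+nonNeg⇒pos 1ℚ ℚ.∣ seq x N ∣ {{ℚ.∣-∣-nonNeg (seq x N)}}}}
      , N
      , λ n N≤n → ℚ.≤-trans
          (subst (λ z → ℚ.∣ z ∣ ℚ.≤ ℚ.∣ seq x n ℚ.- seq x N ∣ ℚ.+ ℚ.∣ seq x N ∣)
            (solve 2 (λ a b → (a :- b) :+ b := a) refl (seq x n) (seq x N))
            (ℚ.∣p+q∣≤∣p∣+∣q∣ (seq x n ℚ.- seq x N) (seq x N)))
          (ℚ.+-monoˡ-≤ ℚ.∣ seq x N ∣ (ℚ.<⇒≤ (close n N N≤n ℕ.≤-refl)))
      where open +-*-Solver

    commonBound : ∀ x y → ∃[ B ] (0ℚ ℚ.< B × ∃[ N ] (Bound x B N × Bound y B N))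
    commonBound x y =
      let A , A>0 , M , x≤A = bound x
          B , B>0 , N , y≤B = bound y
      in
        A ℚ.⊔ B
      , ℚ.<-≤-trans A>0 (ℚ.p≤p⊔q A B)
      , M ℕ.⊔ N
      , (λ n h → ℚ.≤-trans (x≤A n (ℕ.m⊔n≤o⇒m≤o M N h)) (ℚ.p≤p⊔q A B))
      , (λ n h → ℚ.≤-trans (y≤B n (ℕ.m⊔n≤o⇒n≤o M N h)) (ℚ.p≤q⊔p A B))

  fromℚ : ℚ → ℝ
  fromℚ q = mkℝ (λ _ → q) λ ε ε>0 →
    0 , λ _ _ _ _ → subst (ℚ._< ε) (sym (dist-refl q)) ε>0

  0# 1# : ℝ
  0# = fromℚ 0ℚ
  1# = fromℚ 1ℚ

  _+_ : ℝ → ℝ → ℝ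
  x + y = mkℝ (λ n → seq x n ℚ.+ seq y n) λ ε ε>0 →
    let δ , δ>0 , eq = half ε ε>0
        M , xM = cauchy x δ δ>0
        N , yN = cauchy y δ δ>0
    in M ℕ.⊔ N , λ m n hm hn → subst (_ ℚ.<_) eq
         (dist-+ (seq x m) (seq y m) (seq x n) (seq y n)
           (xM m n (ℕ.m⊔n≤o⇒m≤o M N hm) (ℕ.m⊔n≤o⇒m≤o M N hn))
           (yN m n (ℕ.m⊔n≤o⇒n≤o M N hm) (ℕ.m⊔n≤o⇒n≤o M N hn)))

  -_ : ℝ → ℝ
  - x = mkℝ (λ n → ℚ.- seq x n) λ ε ε>0 →
    let N , xN = cauchy x ε ε>0
    in N , λ m n hm hn →
         subst (ℚ._< ε) (sym (dist-neg (seq x m) (seq x n))) (xN m n hm hn)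

  _*_ : ℝ → ℝ → ℝ
  x * y = mkℝ (λ n → seq x n ℚ.* seq y n) λ ε ε>0 →
    let η , η>0 , ηη≡ε = half ε ε>0
        B , B>0 , K , xB , yB = commonBound x y
        δ , δ>0 , Bδ≡η = shrink B η B>0 η>0
        M , xM = cauchy x δ δ>0
        N , yN = cauchy y δ δ>0
        L = M ℕ.⊔ N
    in K ℕ.⊔ L , λ m n hm hn →
         let Lm = ℕ.m⊔n≤o⇒n≤o K L hm
             Ln = ℕ.m⊔n≤o⇒n≤o K L hn
         in subst (_ ℚ.<_) (trans (cong₂ ℚ._+_ Bδ≡η Bδ≡η) ηη≡ε)
              (dist-* (seq x m) (seq y m) (seq x n) (seq y n) B>0
                (xB m (ℕ.m⊔n≤o⇒m≤o K L hm)) (yB n (ℕ.m⊔n≤o⇒m≤o K L hn))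
                (xM m n (ℕ.m⊔n≤o⇒m≤o M N Lm) (ℕ.m⊔n≤o⇒m≤o M N Ln))
                (yN m n (ℕ.m⊔n≤o⇒n≤o M N Lm) (ℕ.m⊔n≤o⇒n≤o M N Ln)))

  pointwise : ∀ {x y} → (∀ n → seq x n ≡ seq y n) → x ≈ y
  pointwise {x} {y} eq ε ε>0 = 0 , λ n _ → subst (ℚ._< ε)
    (sym (trans (cong (λ z → ℚ.∣ z ℚ.- seq y n ∣) (eq n)) (dist-refl (seq y n))))
    ε>0

  isEquivalence : IsEquivalence _≈_
  isEquivalence = record
    { refl  = λ {x} → pointwise {x} {x} λ _ → refl
    ; sym   = λ {x} {y} p ε ε>0 →
        let N , pN = p ε ε>0
        in N , λ n h → subst (ℚ._< ε) (dist-sym (seq x n) (seq y n)) (pN n h)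
    ; trans = λ {x} {y} {z} p q ε ε>0 →
        let δ , δ>0 , eq = half ε ε>0
            M , pM = p δ δ>0
            N , qN = q δ δ>0
        in M ℕ.⊔ N , λ n h → subst (_ ℚ.<_) eq
             (dist-triangle (seq x n) (seq y n) (seq z n)
               (pM n (ℕ.m⊔n≤o⇒m≤o M N h)) (qN n (ℕ.m⊔n≤o⇒n≤o M N h)))
    }

  +-cong : ∀ {x x′ y y′} → x ≈ x′ → y ≈ y′ → (x + y) ≈ (x′ + y′)
  +-cong {x} {x′} {y} {y′} p q ε ε>0 =
    let δ , δ>0 , eq = half ε ε>0
        M , pM = p δ δ>0
        N , qN = q δ δ>0
    in M ℕ.⊔ N , λ n h → subst (_ ℚ.<_) eq
         (dist-+ (seq x n) (seq y n) (seq x′ n) (seq y′ n)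
           (pM n (ℕ.m⊔n≤o⇒m≤o M N h)) (qN n (ℕ.m⊔n≤o⇒n≤o M N h)))

  -‿cong : ∀ {x y} → x ≈ y → (- x) ≈ (- y)
  -‿cong {x} {y} p ε ε>0 =
    let N , pN = p ε ε>0
    in N , λ n h → subst (ℚ._< ε) (sym (dist-neg (seq x n) (seq y n))) (pN n h)

  *-cong : ∀ {x x′ y y′} → x ≈ x′ → y ≈ y′ → (x * y) ≈ (x′ * y′)
  *-cong {x} {x′} {y} {y′} p q ε ε>0 =
    let η , η>0 , ηη≡ε = half ε ε>0
        B , B>0 , K , xB , yB = commonBound x y′
        δ , δ>0 , Bδ≡η = shrink B η B>0 η>0
        M , pM = p δ δ>0
        N , qN = q δ δ>0
        L = M ℕ.⊔ N
    in K ℕ.⊔ L , λ n h →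
         let Kn = ℕ.m⊔n≤o⇒m≤o K L h
             Ln = ℕ.m⊔n≤o⇒n≤o K L h
         in subst (_ ℚ.<_) (trans (cong₂ ℚ._+_ Bδ≡η Bδ≡η) ηη≡ε)
              (dist-* (seq x n) (seq y n) (seq x′ n) (seq y′ n) B>0
                (xB n Kn) (yB n Kn)
                (pM n (ℕ.m⊔n≤o⇒m≤o M N Ln)) (qN n (ℕ.m⊔n≤o⇒n≤o M N Ln)))

  isCommutativeRing : IsCommutativeRing _≈_ _+_ _*_ -_ 0# 1#
  isCommutativeRing = record
    { isRing = record
      { +-isAbelianGroup = record
        { isGroup = record
          { isMonoid = record
            { isSemigroup = record
              { isMagma = record
                { isEquivalence = isEquivalence
                ; ∙-cong = λ {x} {x′} {y} {y′} → +-cong {x} {x′} {y} {y′}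
                }
              ; assoc = λ x y z → pointwise {(x + y) + z} {x + (y + z)} λ n →
                  ℚ.+-assoc (seq x n) (seq y n) (seq z n)
              }
            ; identity =
                (λ x → pointwise {0# + x} {x} λ n → ℚ.+-identityˡ (seq x n))
              , (λ x → pointwise {x + 0#} {x} λ n → ℚ.+-identityʳ (seq x n))
            }
          ; inverse =
              (λ x → pointwise {(- x) + x} {0#} λ n → ℚ.+-inverseˡ (seq x n))
            , (λ x → pointwise {x + (- x)} {0#} λ n → ℚ.+-inverseʳ (seq x n))
          ; ⁻¹-cong = λ {x} {y} → -‿cong {x} {y}
          }
        ; comm = λ x y → pointwise {x + y} {y + x} λ n →
            ℚ.+-comm (seq x n) (seq y n)
        }
      ; *-cong = λ {x} {x′} {y} {y′} → *-cong {x} {x′} {y} {y′}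
      ; *-assoc = λ x y z → pointwise {(x * y) * z} {x * (y * z)} λ n →
          ℚ.*-assoc (seq x n) (seq y n) (seq z n)
      ; *-identity =
          (λ x → pointwise {1# * x} {x} λ n → ℚ.*-identityˡ (seq x n))
        , (λ x → pointwise {x * 1#} {x} λ n → ℚ.*-identityʳ (seq x n))
      ; distrib =
          (λ x y z → pointwise {x * (y + z)} {(x * y) + (x * z)} λ n →
            ℚ.*-distribˡ-+ (seq x n) (seq y n) (seq z n))
        , (λ x y z → pointwise {(y + z) * x} {(y * x) + (z * x)} λ n →
            ℚ.*-distribʳ-+ (seq x n) (seq y n) (seq z n))
      }
    ; *-comm = λ x y → pointwise {x * y} {y * x} λ n →
        ℚ.*-comm (seq x n) (seq y n)
    }

ℝ-commutativeRing : CommutativeRing 0ℓ 0ℓ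
ℝ-commutativeRing = record { isCommutativeRing = Real.isCommutativeRing }

------------------------------------------------------------------------
-- R[i] = R[x]/(x² + 1), the pair (a , b) standing for a + bi

module AdjoinI {c ℓ} (R : CommutativeRing c ℓ) where

  open import Algebra.Bundles using (AbelianGroup)
  open import Algebra.Construct.DirectProduct using (abelianGroup)
  open CommutativeRing R
  open import Algebra.Properties.Ring ring using (-1*x≈-x; -0#≈0#)
  open import Algebra.Solver.Ring.NaturalCoefficients.Default commutativeSemiring
    using (solve; _:+_; _:*_; _:=_)
  open import Relation.Binary.Reasoning.Setoid setoid

  private
    A : AbelianGroup c ℓ
    A = abelianGroup +-abelianGroup +-abelianGroup

    open AbelianGroup A using () renaming (Carrier to C; _≈_ to _≃_; _∙_ to _⊹_)

  infixl 7 _·_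

  _·_ : C → C → C
  (a , b) · (a′ , b′) = a * a′ - b * b′ , a * b′ + b * a′

  private
    -- The solver knows no subtraction; every law below holds in R[x]/(x² - n).
    n : Carrier
    n = - 1#

    minus : ∀ x y → x - y ≈ x + n * y
    minus x y = +-congˡ (sym (-1*x≈-x y))

    ·-cong : ∀ {x x′ y y′} → x ≃ x′ → y ≃ y′ → (x · y) ≃ (x′ · y′)
    ·-cong (p , q) (r , s) =
        +-cong (*-cong p r) (-‿cong (*-cong q s))
      , +-cong (*-cong p s) (*-cong q r)

    ·-assoc : ∀ x y z → ((x · y) · z) ≃ (x · (y · z))
    ·-assoc (a , b) (c , d) (e , f) =
        (begin
          (a * c - b * d) * e - (a * d + b * c) * f
            ≈⟨ minus _ _ ⟩
          (a * c - b * d) * e + n * ((a * d + b * c) * f)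
            ≈⟨ +-congʳ (*-congʳ (minus _ _)) ⟩
          (a * c + n * (b * d)) * e + n * ((a * d + b * c) * f)
            ≈⟨ solve 7 (λ n a b c d e f →
                 (a :* c :+ n :* (b :* d)) :* e :+ n :* ((a :* d :+ b :* c) :* f) :=
                 a :* (c :* e :+ n :* (d :* f)) :+ n :* (b :* (c :* f :+ d :* e)))
                 refl n a b c d e f ⟩
          a * (c * e + n * (d * f)) + n * (b * (c * f + d * e))
            ≈⟨ +-congʳ (*-congˡ (sym (minus _ _))) ⟩
          a * (c * e - d * f) + n * (b * (c * f + d * e))
            ≈⟨ sym (minus _ _) ⟩
          a * (c * e - d * f) - b * (c * f + d * e) ∎)
      , (begin
          (a * c - b * d) * f + (a * d + b * c) * e
            ≈⟨ +-congʳ (*-congʳ (minus _ _)) ⟩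
          (a * c + n * (b * d)) * f + (a * d + b * c) * e
            ≈⟨ solve 7 (λ n a b c d e f →
                 (a :* c :+ n :* (b :* d)) :* f :+ (a :* d :+ b :* c) :* e :=
                 a :* (c :* f :+ d :* e) :+ b :* (c :* e :+ n :* (d :* f)))
                 refl n a b c d e f ⟩
          a * (c * f + d * e) + b * (c * e + n * (d * f))
            ≈⟨ +-congˡ (*-congˡ (sym (minus _ _))) ⟩
          a * (c * f + d * e) + b * (c * e - d * f) ∎)

    ·-comm : ∀ x y → (x · y) ≃ (y · x)
    ·-comm (a , b) (c , d) =
        +-cong (*-comm a c) (-‿cong (*-comm b d))
      , trans (+-comm _ _) (+-cong (*-comm b c) (*-comm a d))

    ·-identityˡ : ∀ x → ((1# , 0#) · x) ≃ x
    ·-identityˡ (a , b) =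
        (begin
          1# * a - 0# * b ≈⟨ +-cong (*-identityˡ a) (-‿cong (zeroˡ b)) ⟩
          a - 0#          ≈⟨ +-congˡ -0#≈0# ⟩
          a + 0#          ≈⟨ +-identityʳ a ⟩
          a               ∎)
      , (begin
          1# * b + 0# * a ≈⟨ +-cong (*-identityˡ b) (zeroˡ a) ⟩
          b + 0#          ≈⟨ +-identityʳ b ⟩
          b               ∎)

    ·-distribˡ : ∀ x y z → (x · (y ⊹ z)) ≃ ((x · y) ⊹ (x · z))
    ·-distribˡ (a , b) (c , d) (e , f) =
        (begin
          a * (c + e) - b * (d + f)
            ≈⟨ minus _ _ ⟩
          a * (c + e) + n * (b * (d + f))
            ≈⟨ solve 7 (λ n a b c d e f →
                 a :* (c :+ e) :+ n :* (b :* (d :+ f)) :=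
                 (a :* c :+ n :* (b :* d)) :+ (a :* e :+ n :* (b :* f)))
                 refl n a b c d e f ⟩
          (a * c + n * (b * d)) + (a * e + n * (b * f))
            ≈⟨ sym (+-cong (minus _ _) (minus _ _)) ⟩
          (a * c - b * d) + (a * e - b * f) ∎)
      , solve 6 (λ a b c d e f →
          a :* (d :+ f) :+ b :* (c :+ e) :=
          (a :* d :+ b :* c) :+ (a :* f :+ b :* e))
          refl a b c d e f

    open AbelianGroup A using () renaming (trans to ≃-trans; ∙-cong to ⊹-cong)

  commutativeRing : CommutativeRing c ℓ
  commutativeRing = record
    { _*_ = _·_
    ; 1#  = 1# , 0#
    ; isCommutativeRing = record
      { isRing = record
        { +-isAbelianGroup = AbelianGroup.isAbelianGroup A
        ; *-cong     = ·-cong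
        ; *-assoc    = ·-assoc
        ; *-identity = ·-identityˡ
                     , λ x → ≃-trans (·-comm x _) (·-identityˡ x)
        ; distrib    = ·-distribˡ
                     , λ x y z → ≃-trans (·-comm (y ⊹ z) x)
                         (≃-trans (·-distribˡ x y z)
                           (⊹-cong (·-comm x y) (·-comm x z)))
        }
      ; *-comm = ·-comm
      }
    }

ℂ : CommutativeRing 0ℓ 0ℓ
ℂ = AdjoinI.commutativeRing ℝ-commutativeRing

------------------------------------------------------------------------
-- Partitions

record Partition (m : ℕ) : Set where
  field
    parts      : List ℕ
    decreasing : Linked ℕ._≥_ parts
    positive   : All (1 ℕ.≤_) parts
    size       : sum parts ≡ m

open Partition public

-- The i-th part of the conjugate counts the parts that are at least i,
-- for i from 1 to the largest part.
conjugate : List ℕ → List ℕ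
conjugate ps =
  List.map (λ i → List.length (List.filter (suc i ℕ.≤?_) ps))
    (List.upTo (List.foldr ℕ._⊔_ 0 ps))

AtMostTwoColumns : ∀ {m} → Partition m → Set
AtMostTwoColumns p = All (ℕ._≤ 2) (parts p)

-- The partition (m); it has no parts when m = 0.
oneRow : ℕ → List ℕ
oneRow zero    = []
oneRow (suc m) = suc m ∷ []

-- Padding with zeros; only meant for lists of length at most 2.
toℤ² : List ℕ → Fin 2 → ℤ
toℤ² (a ∷ _)     zero       = + a
toℤ² (_ ∷ b ∷ _) (suc zero) = + b
toℤ² _           _          = + 0

Weight : ℕ → Set
Weight d = Vec (Fin 2 → ℤ) d

-- λ′ + (2 × n)^d
shiftedConjugate : ∀ {m d} → Vec (Partition m) d → ℕ → Weight d
shiftedConjugate λs n =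
  Vec.map (λ p i → toℤ² (conjugate (parts p)) i ℤ.+ toℤ² (n ∷ n ∷ []) i) λs

------------------------------------------------------------------------
-- Tensors and the exterior algebra over a commutative ring

words : ∀ {a} {A : Set a} → List A → (d : ℕ) → List (Vec A d)
words xs zero    = [] ∷ []
words xs (suc d) = List.cartesianProductWith _∷_ xs (words xs d)

module MultilinearAlgebra {c ℓ} (K : CommutativeRing c ℓ) where

  open CommutativeRing K hiding (zero) renaming (Carrier to 𝕂)
  open import Algebra.Definitions.RawSemiring (Semiring.rawSemiring semiring) using (_^_)

  𝕂² : Set c
  𝕂² = Fin 2 → 𝕂

  e : Fin 2 → 𝕂²
  e i j = if does (i Fin.≟ j) then 1# else 0#

  -- (𝕂²)^⊗d, a tensor being given by its coordinates in the basis
  -- e_{i₁} ⊗ ⋯ ⊗ e_{i_d}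
  V : ℕ → Set c
  V d = Vec (Fin 2) d → 𝕂

  -- v₁ ⊗ ⋯ ⊗ v_d
  ⨂ : ∀ {d} → Vec 𝕂² d → V d
  ⨂ []       []      = 1#
  ⨂ (v ∷ vs) (i ∷ I) = v i * ⨂ vs I

  Matrix : Set c
  Matrix = Fin 2 → Fin 2 → 𝕂

  -- The linear map with v₁ ⊗ ⋯ ⊗ v_d ↦ g₁v₁ ⊗ ⋯ ⊗ g_dv_d; its (I , J) entry is
  -- the product of the entries (g_k)_{i_k j_k}.
  _▹_ : ∀ {d} → Vec Matrix d → V d → V d
  (gs ▹ t) I = List.foldr _+_ 0# $
    List.map (λ J → ⨂ (Vec.zipWith _$_ gs I) J * t J) (words (List.allFin 2) _)

  infixr 7 _∧_
  infixl 6 _⊕_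
  infix  4 _≋_

  -- ⋀ V, presented as the free associative unital 𝕂-algebra on V modulo
  -- linearity of ι and v ∧ v = 0. Scalars are embedded by η, so that the scalar
  -- multiple k·x is η k ∧ x.
  data ⋀ (d : ℕ) : Set c where
    η   : 𝕂 → ⋀ d
    ι   : V d → ⋀ d
    _⊕_ : ⋀ d → ⋀ d → ⋀ d
    _∧_ : ⋀ d → ⋀ d → ⋀ d

  data _≋_ {d : ℕ} : ⋀ d → ⋀ d → Set (c ⊔ ℓ) where
    ≋-refl  : ∀ {x} → x ≋ x
    ≋-sym   : ∀ {x y} → x ≋ y → y ≋ x
    ≋-trans : ∀ {x y z} → x ≋ y → y ≋ z → x ≋ z

    η-cong : ∀ {k l} → k ≈ l → η k ≋ η l
    ι-cong : ∀ {u v} → (∀ I → u I ≈ v I) → ι u ≋ ι v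
    ⊕-cong : ∀ {x x′ y y′} → x ≋ x′ → y ≋ y′ → x ⊕ y ≋ x′ ⊕ y′
    ∧-cong : ∀ {x x′ y y′} → x ≋ x′ → y ≋ y′ → x ∧ y ≋ x′ ∧ y′

    ⊕-assoc     : ∀ x y z → (x ⊕ y) ⊕ z ≋ x ⊕ (y ⊕ z)
    ⊕-comm      : ∀ x y → x ⊕ y ≋ y ⊕ x
    ⊕-identityˡ : ∀ x → η 0# ⊕ x ≋ x
    ∧-assoc     : ∀ x y z → (x ∧ y) ∧ z ≋ x ∧ (y ∧ z)
    ∧-identityˡ : ∀ x → η 1# ∧ x ≋ x
    ∧-zeroˡ     : ∀ x → η 0# ∧ x ≋ η 0#
    ∧-distribˡ  : ∀ x y z → x ∧ (y ⊕ z) ≋ (x ∧ y) ⊕ (x ∧ z)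
    ∧-distribʳ  : ∀ x y z → (y ⊕ z) ∧ x ≋ (y ∧ x) ⊕ (z ∧ x)

    η-+       : ∀ k l → η (k + l) ≋ η k ⊕ η l
    η-*       : ∀ k l → η (k * l) ≋ η k ∧ η l
    η-central : ∀ k x → η k ∧ x ≋ x ∧ η k

    ι-+ : ∀ u v → ι (λ I → u I + v I) ≋ ι u ⊕ ι v
    ι-* : ∀ k v → ι (λ I → k * v I) ≋ η k ∧ ι v

    alternating : ∀ v → ι v ∧ ι v ≋ η 0#

  -- v₁ ∧ ⋯ ∧ v_r
  ⋀-product : ∀ {d r} → Vec (V d) r → ⋀ d
  ⋀-product = Vec.foldr _ (λ v x → ι v ∧ x) (η 1#)

  -- x ∈⋀^ r when x lies in the span of the products of r vectors.
  data _∈⋀^_ {d : ℕ} : ⋀ d → ℕ → Set (c ⊔ ℓ) where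
    ∈-resp    : ∀ {r x y} → x ≋ y → x ∈⋀^ r → y ∈⋀^ r
    ∈-product : ∀ {r} (vs : Vec (V d) r) → ⋀-product vs ∈⋀^ r
    ∈-zero    : ∀ {r} → η 0# ∈⋀^ r
    ∈-sum     : ∀ {r x y} → x ∈⋀^ r → y ∈⋀^ r → (x ⊕ y) ∈⋀^ r
    ∈-scale   : ∀ {r x} k → x ∈⋀^ r → (η k ∧ x) ∈⋀^ r

  -- The algebra endomorphism of ⋀ V induced by gs
  act : ∀ {d} → Vec Matrix d → ⋀ d → ⋀ d
  act gs (η k)   = η k
  act gs (ι v)   = ι (gs ▹ v)
  act gs (x ⊕ y) = act gs x ⊕ act gs y
  act gs (x ∧ y) = act gs x ∧ act gs y

  ----------------------------------------------------------------------
  -- Highest weight vectors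

  record Unit : Set (c ⊔ ℓ) where
    field
      val inv : 𝕂
      inverse : val * inv ≈ 1#

  open Unit public

  _^ℤ_ : Unit → ℤ → 𝕂
  u ^ℤ (+ n)    = val u ^ n
  u ^ℤ -[1+ n ] = inv u ^ suc n

  diag : (Fin 2 → Unit) → Matrix
  diag a i j = if does (i Fin.≟ j) then val (a i) else 0#

  unitriangular : 𝕂 → Matrix
  unitriangular t zero       zero       = 1#
  unitriangular t zero       (suc zero) = t
  unitriangular t (suc zero) zero       = 0#
  unitriangular t (suc zero) (suc zero) = 1#

  -- ∏_j ∏_i (a^(j)_i)^(μ^(j)_i)
  character : ∀ {d} → Weight d → Vec (Fin 2 → Unit) d → 𝕂
  character μ a = Vec.foldr _ _*_ 1# $
    Vec.zipWith (λ μⱼ aⱼ → (aⱼ zero ^ℤ μⱼ zero) * (aⱼ (suc zero) ^ℤ μⱼ (suc zero)))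
      μ a

  -- Zero satisfies all three conditions, so this is a linear subspace.
  record HWV {d : ℕ} (r : ℕ) (μ : Weight d) (x : ⋀ d) : Set (c ⊔ ℓ) where
    field
      degree    : x ∈⋀^ r
      weight    : ∀ (a : Vec (Fin 2 → Unit) d) →
                  act (Vec.map diag a) x ≋ η (character μ a) ∧ x
      invariant : ∀ (t : Vec 𝕂 d) → act (Vec.map unitriangular t) x ≋ x

  data U {m d : ℕ} (λs : Vec (Partition m) d) (r : ℕ) (x : ⋀ d) :
         Set (c ⊔ ℓ) where
    inRange    : ∀ n → n ℕ.≤ 2 ℕ.^ (d ℕ.∸ 1) ℕ.∸ m → r ≡ m ℕ.+ 2 ℕ.* n →
                 HWV r (shiftedConjugate λs n) x → U λs r x
    outOfRange : ¬ (∃[ n ] (n ℕ.≤ 2 ℕ.^ (d ℕ.∸ 1) ℕ.∸ m × r ≡ m ℕ.+ 2 ℕ.* n)) →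
                 x ≋ η 0# → U λs r x

  ----------------------------------------------------------------------
  -- The Cayley form

  S₂ : List (Permutation′ 2)
  S₂ = idₚ ∷ transpose zero (suc zero) ∷ []

  sgn : Permutation′ 2 → 𝕂
  sgn π = if does (π ⟨$⟩ʳ zero Fin.≟ zero) then 1# else - 1#

  ω : ∀ d → ⋀ d
  ω d = List.foldr _⊕_ (η 0#) (List.map term (words S₂ d))
    where
    factor : Vec (Permutation′ 2) d → Fin 2 → ⋀ d
    factor πs i = ι (⨂ (Vec.map (λ π → e (π ⟨$⟩ʳ i)) πs))

    term : Vec (Permutation′ 2) d → ⋀ d
    term πs = η (sgn (Vec.foldr _ _∘ₚ_ idₚ πs)) ∧ factor πs zero ∧ factor πs (suc zero)

  X : ∀ {d} → ⋀ d → ⋀ d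
  X {d} x = ω d ∧ x

  X^ : ∀ {d} → ℕ → ⋀ d → ⋀ d
  X^ zero    = λ x → x
  X^ (suc n) = X ∘ X^ n

  -- f restricts to an isomorphism from the subspace P onto the subspace Q.
  record IsIsomorphism {d p q} (P : ⋀ d → Set p) (Q : ⋀ d → Set q)
                       (f : ⋀ d → ⋀ d) : Set (c ⊔ ℓ ⊔ p ⊔ q) where
    field
      maps        : ∀ {x} → P x → Q (f x)
      congruent   : ∀ {x y} → P x → P y → x ≋ y → f x ≋ f y
      additive    : ∀ {x y} → P x → P y → f (x ⊕ y) ≋ f x ⊕ f y
      homogeneous : ∀ k {x} → P x → f (η k ∧ x) ≋ η k ∧ f x
      injective   : ∀ {x y} → P x → P y → f x ≋ f y → x ≋ y
      surjective  : ∀ {y} → Q y → ∃[ x ] (P x × f x ≋ y)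

open MultilinearAlgebra ℂ public

{-# OPTIONS --safe #-}

-- For odd d the tensor product of the d determinant forms is a symplectic form
-- on V, and ω is the corresponding bivector. Contracting with the dual form
-- gives an operator Y with [Y , X] = N - r on ⋀^r V, where N = 2^(d-1), so X and
-- Y generate an action of sl₂ on ⋀ V, and X^ℓ : ⋀^(N-ℓ) V → ⋀^(N+ℓ) V is
-- bijective. Since g ∈ GL(2)^d multiplies ω by det g, X^ℓ maps highest weight
-- vectors to highest weight vectors with the weight shifted by (2 × ℓ)^d, and by
-- injectivity a preimage of a highest weight vector is one as well.

module Submission where

open import Level as Level using (_⊔_)
open import Algebra.Bundles using (AbelianGroup; CommutativeMonoid; CommutativeRing; Ring; Semiring)
import Algebra.Construct.Pointwise as Pointwise
open import Algebra.Module.Bundles using (LeftModule)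
import Algebra.Module.Construct.TensorUnit as TensorUnit
open import Data.Fin.Base using (Fin; zero; suc; opposite; inject≤)
open import Data.Fin.Permutation using (Permutation′; transpose; _⟨$⟩ʳ_; _∘ₚ_) renaming (id to idₚ)
open import Data.Integer.Base as ℤ using (ℤ)
open import Data.List.Base as List using (List; []; _∷_; _++_)
import Data.List.Properties as List
open import Data.Nat.Base as ℕ using (ℕ; zero; suc; _≤_; z≤n; s≤s; _∸_)
open import Data.Nat.Divisibility using (_∣_; divides; ∣-refl; ∣m∣n⇒∣m+n)
open import Data.Nat.DivMod using (_%_; _/_; m≡m%n+[m/n]*n; m%n<n)
import Data.Nat.Properties as ℕ
import Data.Nat.Solver as ℕ-Solver
open import Data.Product.Base using (∃-syntax; _×_; _,_; proj₁; proj₂)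
open import Data.Rational.Base as ℚ using (ℚ; 0ℚ; 1ℚ)
import Data.Rational.Properties as ℚ
open import Data.Sum.Base using (_⊎_; inj₁; inj₂)
open import Data.Vec.Base as Vec using (Vec; []; _∷_; lookup)
import Data.Vec.Properties as Vec
open import Function.Base using (_∘_; _$_)
open import Relation.Binary.PropositionalEquality as ≡ using (_≡_)
open import Relation.Nullary using (¬_; contradiction)
open import Defs
  using (module MultilinearAlgebra; words; Partition; parts; conjugate; toℤ²; shiftedConjugate; seq; module Real)

-- The usual proof that X^ℓ is bijective decomposes a finite-dimensional sl₂-module into
-- irreducibles. Here ⋀ V is given by generators and relations, and equality of scalars need not be
-- decidable, so the argument avoids choosing bases or highest weight vectors. It runs in an abelian
-- group whose weight spaces are predicates, and rests on the commutator, the vanishing of X and Y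
-- beyond the two ends, and division by positive integers. Where h = k + q + 1, the identity Y
-- X^(k+1) = X^k (XY + (k+1)(q+1)) reduces everything to inverting XY + c for positive c, which is
-- done by descending to the bottom of the ladder. Since X raises degrees by two, even and odd
-- degrees form separate ladders. Both ω and its dual contraction run over each pair of
-- complementary words twice, so the contraction has to be divided by 4. Oddness of d gives
-- complementary words opposite signs, which keeps their terms in ω from cancelling.

iterate : ∀ {a} {A : Set a} → (A → A) → ℕ → A → A
iterate f zero    x = x
iterate f (suc k) x = f (iterate f k x)

iterate-shift : ∀ {a} {A : Set a} (f : A → A) k x →
                iterate f k (f x) ≡ f (iterate f k x)
iterate-shift f zero    x = ≡.refl
iterate-shift f (suc k) x = ≡.cong f (iterate-shift f k x)

-- Representations of sl₂

module Sl₂ {a ℓ} (M : AbelianGroup a ℓ) where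

  open AbelianGroup M
    renaming (Carrier to A; _∙_ to infixl 6 _+_; ε to 0#; _⁻¹ to infix 8 -_;
              ∙-cong to +-cong; ∙-congˡ to +-congˡ; ∙-congʳ to +-congʳ; assoc to +-assoc; comm to +-comm;
              identityˡ to +-identityˡ; identityʳ to +-identityʳ;
              inverseʳ to -‿inverseʳ)
  open import Algebra.Properties.Group group
    using (∙-cancelʳ; x∙y⁻¹≈ε⇒x≈y; x≈y⇒x∙y⁻¹≈ε; inverseʳ-unique)
  open import Algebra.Properties.CommutativeMonoid.Mult commutativeMonoid
    using (×-homo-+; ×-congʳ; ×-congˡ; ×-distrib-+) renaming (_×_ to infixr 7 _·_)
  open import Algebra.Solver.CommutativeMonoid commutativeMonoid using (solve; _⊜_; _⊕_)
  open import Relation.Binary.Reasoning.Setoid setoid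

  -- Additivity suffices because natural multiples are the only scalars in the sl₂ argument.
  record Additive (f : A → A) : Set (a ⊔ ℓ) where
    field
      cong : ∀ {x y} → x ≈ y → f x ≈ f y
      homo : ∀ x y → f (x + y) ≈ f x + f y

    zero-homo : f 0# ≈ 0#
    zero-homo = ∙-cancelʳ (f 0#) _ _ (begin
      f 0# + f 0# ≈⟨ homo 0# 0# ⟨
      f (0# + 0#) ≈⟨ cong (+-identityˡ 0#) ⟩
      f 0#        ≈⟨ +-identityˡ (f 0#) ⟨
      0# + f 0#   ∎)

    neg-homo : ∀ x → f (- x) ≈ - f x
    neg-homo x = inverseʳ-unique (f x) (f (- x)) (begin
      f x + f (- x) ≈⟨ homo x (- x) ⟨
      f (x + - x)   ≈⟨ cong (-‿inverseʳ x) ⟩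
      f 0#          ≈⟨ zero-homo ⟩
      0#            ∎)

    ·-homo : ∀ n x → f (n · x) ≈ n · f x
    ·-homo zero    x = zero-homo
    ·-homo (suc n) x = trans (homo x (n · x)) (+-congˡ (·-homo n x))

  open Additive public

  ∘-additive : ∀ {f g} → Additive f → Additive g → Additive (f ∘ g)
  ∘-additive F G = record
    { cong = cong F ∘ cong G
    ; homo = λ x y → trans (cong F (homo G x y)) (homo F _ _)
    }

  +-additive : ∀ {f g} → Additive f → Additive g → Additive (λ x → f x + g x)
  +-additive {f} {g} F G = record
    { cong = λ p → +-cong (cong F p) (cong G p)
    ; homo = λ x y → trans (+-cong (homo F x y) (homo G x y))
        (solve 4 (λ a b c d → (a ⊕ b) ⊕ (c ⊕ d) ⊜ (a ⊕ c) ⊕ (b ⊕ d)) refl (f x) (f y) (g x) (g y))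
    }

  ·-additive : ∀ n → Additive (n ·_)
  ·-additive n = record { cong = ×-congʳ n ; homo = λ x y → ×-distrib-+ x y n }

  iterate-additive : ∀ {f} → Additive f → ∀ k → Additive (iterate f k)
  iterate-additive F zero    = record { cong = λ p → p ; homo = λ _ _ → refl }
  iterate-additive F (suc k) = ∘-additive F (iterate-additive F k)

  -- P i j is a weight space lying i steps above the bottom and j steps below
  -- the top of its ladder; h = j - i acts there. Interchanging the roles of X
  -- and Y reverses the ladder.
  record Ladder {p} (P : ℕ → ℕ → A → Set p) (X Y : A → A) : Set (a ⊔ ℓ ⊔ p) where
    field
      P-resp      : ∀ {i j x y} → x ≈ y → P i j x → P i j y
      P-0         : ∀ {i j x} → P i j x → P i j 0#
      P-+         : ∀ {i j x y} → P i j x → P i j y → P i j (x + y)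
      P-neg       : ∀ {i j x} → P i j x → P i j (- x)
      -- Together with `torsionFree` this makes each weight space uniquely divisible, which is how
      -- characteristic zero enters.
      divide      : ∀ n {i j x} → P i j x → ∃[ y ] (P i j y × suc n · y ≈ x)
      torsionFree : ∀ n {x} → suc n · x ≈ 0# → x ≈ 0#
      X-additive  : Additive X
      Y-additive  : Additive Y
      X-maps      : ∀ {i j x} → P i (suc j) x → P (suc i) j (X x)
      Y-maps      : ∀ {i j x} → P (suc i) j x → P i (suc j) (Y x)
      X-top       : ∀ {i x} → P i 0 x → X x ≈ 0#
      Y-bottom    : ∀ {j x} → P 0 j x → Y x ≈ 0#
      -- The relation YX - XY = j - i, with the subtractions moved across so that only natural
      -- multiples occur.
      commutator  : ∀ {i j x} → P i j x → Y (X x) + i · x ≈ X (Y x) + j · x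

  flip : ∀ {p} {P : ℕ → ℕ → A → Set p} {X Y} → Ladder P X Y → Ladder (λ i j → P j i) Y X
  flip L = record
    { P-resp = P-resp ; P-0 = P-0 ; P-+ = P-+ ; P-neg = P-neg
    ; divide = λ n Px → divide n Px ; torsionFree = torsionFree
    ; X-additive = Y-additive ; Y-additive = X-additive
    ; X-maps = Y-maps ; Y-maps = X-maps
    ; X-top = Y-bottom ; Y-bottom = X-top
    ; commutator = λ Px → sym (commutator Px)
    }
    where open Ladder L

  record Bijective {p} (P Q : A → Set p) (f : A → A) : Set (a ⊔ ℓ ⊔ p) where
    field
      maps       : ∀ {x} → P x → Q (f x)
      kernel     : ∀ {x} → P x → f x ≈ 0# → x ≈ 0#
      surjective : ∀ {y} → Q y → ∃[ x ] (P x × f x ≈ y)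

  module Lefschetz {p} {P : ℕ → ℕ → A → Set p} {X Y : A → A} (L : Ladder P X Y) where

    open Ladder L
    open Bijective

    P-· : ∀ n {i j x} → P i j x → P i j (n · x)
    P-· zero    Px = P-0 Px
    P-· (suc n) Px = P-+ Px (P-· n Px)

    XY-maps : ∀ i {j x} → P i j x → P i j (X (Y x))
    XY-maps zero    Px = P-resp (sym (trans (cong X-additive (Y-bottom Px)) (zero-homo X-additive))) (P-0 Px)
    XY-maps (suc i) Px = X-maps (Y-maps Px)

    X^-maps : ∀ k {i j x} → P i (k ℕ.+ j) x → P (k ℕ.+ i) j (iterate X k x)
    X^-maps zero            Px = Px
    X^-maps (suc k) {i} {j} {x} Px =
      X-maps (X^-maps k (≡.subst (λ s → P i s x) (≡.sym (ℕ.+-suc k j)) Px))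

    commutator-≤ : ∀ {i j x} → i ≤ j → P i j x → Y (X x) ≈ X (Y x) + (j ∸ i) · x
    commutator-≤ {i} {j} {x} i≤j Px = ∙-cancelʳ (i · x) _ _ (begin
      Y (X x) + i · x                   ≈⟨ commutator Px ⟩
      X (Y x) + j · x                   ≈⟨ +-congˡ (×-congˡ (ℕ.m∸n+n≡m i≤j)) ⟨
      X (Y x) + (j ∸ i ℕ.+ i) · x       ≈⟨ +-congˡ (×-homo-+ x (j ∸ i) i) ⟩
      X (Y x) + ((j ∸ i) · x + i · x)   ≈⟨ +-assoc _ _ _ ⟨
      X (Y x) + (j ∸ i) · x + i · x     ∎)

    -- XY + c is invertible on P (suc i) j when YX + c is invertible on
    -- P i (suc j), as 1 + AB is invertible when 1 + BA is; and there
    -- YX + c = XY + c′ with c′ ≥ c.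
    XY+c-bijective : ∀ i {j} c → i ≤ suc j →
                     Bijective (P i j) (P i j) (λ x → X (Y x) + suc c · x)
    XY+c-bijective zero c _ = record
      { maps       = λ Px → P-+ (XY-maps zero Px) (P-· (suc c) Px)
      ; kernel     = λ Px fx≈0 → torsionFree c (trans (sym (onBottom Px)) fx≈0)
      ; surjective = λ Py → let x , Px , eq = divide c Py in x , Px , trans (onBottom Px) eq
      }
      where
      onBottom : ∀ {j x} → P zero j x → X (Y x) + suc c · x ≈ suc c · x
      onBottom Px = trans (+-congʳ (trans (cong X-additive (Y-bottom Px)) (zero-homo X-additive)))
                          (+-identityˡ _)
    XY+c-bijective (suc i) {j} c (s≤s i≤j) = record
      { maps       = λ Px → P-+ (XY-maps (suc i) Px) (P-· (suc c) Px)
      ; kernel     = kernel′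
      ; surjective = surjective′
      }
      where
      i≤sj : i ≤ suc j
      i≤sj = ℕ.m≤n⇒m≤1+n i≤j

      -- The value of h on P i (suc j), by which YX exceeds XY there.
      e : ℕ
      e = suc j ∸ i

      below : Bijective (P i (suc j)) (P i (suc j)) (λ z → X (Y z) + suc (e ℕ.+ c) · z)
      below = XY+c-bijective i (e ℕ.+ c) (ℕ.m≤n⇒m≤1+n i≤sj)

      YX+c : ∀ {z} → P i (suc j) z → Y (X z) + suc c · z ≈ X (Y z) + suc (e ℕ.+ c) · z
      YX+c {z} Pz = begin
        Y (X z) + suc c · z             ≈⟨ +-congʳ (commutator-≤ i≤sj Pz) ⟩
        X (Y z) + e · z + suc c · z     ≈⟨ +-assoc _ _ _ ⟩
        X (Y z) + (e · z + suc c · z)   ≈⟨ +-congˡ (×-homo-+ z e (suc c)) ⟨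
        X (Y z) + (e ℕ.+ suc c) · z     ≈⟨ +-congˡ (×-congˡ (ℕ.+-suc e c)) ⟩
        X (Y z) + suc (e ℕ.+ c) · z     ∎

      -- Applying Y to (XY + c) x = 0 gives (YX + c) (Y x) = 0 one level down. Hence Y x = 0, and
      -- only c x = 0 is left.
      kernel′ : ∀ {x} → P (suc i) j x → X (Y x) + suc c · x ≈ 0# → x ≈ 0#
      kernel′ {x} Px eq = torsionFree c (begin
        suc c · x             ≈⟨ +-identityˡ _ ⟨
        0# + suc c · x        ≈⟨ +-congʳ (trans (cong X-additive Yx≈0) (zero-homo X-additive)) ⟨
        X (Y x) + suc c · x   ≈⟨ eq ⟩
        0#                    ∎)
        where
        Yx≈0 : Y x ≈ 0#
        Yx≈0 = kernel below (Y-maps Px) (begin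
          X (Y (Y x)) + suc (e ℕ.+ c) · Y x ≈⟨ YX+c (Y-maps Px) ⟨
          Y (X (Y x)) + suc c · Y x         ≈⟨ +-congˡ (·-homo Y-additive (suc c) x) ⟨
          Y (X (Y x)) + Y (suc c · x)       ≈⟨ homo Y-additive _ _ ⟨
          Y (X (Y x) + suc c · x)           ≈⟨ cong Y-additive eq ⟩
          Y 0#                              ≈⟨ zero-homo Y-additive ⟩
          0#                                ∎)

      -- The inverse is 1/c (1 - X (YX + c)⁻¹ Y): z solves (YX + c) z = Y y one level down, and x is
      -- (y - X z) / c. The equation for x is checked after multiplication by c.
      surjective′ : ∀ {y} → P (suc i) j y → ∃[ x ] (P (suc i) j x × X (Y x) + suc c · x ≈ y)
      surjective′ {y} Py with surjective below (Y-maps Py)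
      ... | z , Pz , eq with divide c (P-+ Py (P-neg (X-maps Pz)))
      ... | x , Px , cx≈y-Xz = x , Px
        , x∙y⁻¹≈ε⇒x≈y _ _ (torsionFree c (begin
            suc c · (f x + - y)         ≈⟨ homo (·-additive (suc c)) (f x) (- y) ⟩
            suc c · f x + suc c · - y   ≈⟨ +-cong c·fx≈c·y (neg-homo (·-additive (suc c)) y) ⟩
            suc c · y + - (suc c · y)   ≈⟨ -‿inverseʳ _ ⟩
            0#                          ∎))
        where
        f : A → A
        f x = X (Y x) + suc c · x

        f-additive : Additive f
        f-additive = +-additive (∘-additive X-additive Y-additive) (·-additive (suc c))

        fXz≈XYy : f (X z) ≈ X (Y y)
        fXz≈XYy = begin
          X (Y (X z)) + suc c · X z     ≈⟨ +-congˡ (·-homo X-additive (suc c) z) ⟨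
          X (Y (X z)) + X (suc c · z)   ≈⟨ homo X-additive _ _ ⟨
          X (Y (X z) + suc c · z)       ≈⟨ cong X-additive (trans (YX+c Pz) eq) ⟩
          X (Y y)                       ∎

        c·fx≈c·y : suc c · f x ≈ suc c · y
        c·fx≈c·y = begin
          suc c · f x                           ≈⟨ ·-homo f-additive (suc c) x ⟨
          f (suc c · x)                         ≈⟨ cong f-additive cx≈y-Xz ⟩
          f (y + - X z)                         ≈⟨ homo f-additive _ _ ⟩
          f y + f (- X z)                       ≈⟨ +-congˡ (trans (neg-homo f-additive _) (⁻¹-cong fXz≈XYy)) ⟩
          X (Y y) + suc c · y + - X (Y y)       ≈⟨ solve 3 (λ a b c → (a ⊕ b) ⊕ c ⊜ (a ⊕ c) ⊕ b) refl _ _ _ ⟩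
          X (Y y) + - X (Y y) + suc c · y       ≈⟨ +-congʳ (-‿inverseʳ _) ⟩
          0# + suc c · y                        ≈⟨ +-identityˡ _ ⟩
          suc c · y                             ∎

    -- The sl₂ identity Y X^(k+1) = X^(k+1) Y + (k+1) X^k (h - k), with X^k factored out on the
    -- left. Here h = k + q + 1, so h - k = q + 1 is positive.
    YX^[1+k] : ∀ k q {i x} → P i (i ℕ.+ (k ℕ.+ suc q)) x →
               Y (iterate X (suc k) x) ≈ iterate X k (X (Y x) + (suc k ℕ.* suc q) · x)
    YX^[1+k] zero    q {i} {x} Px = begin
      Y (X x)                                 ≈⟨ commutator-≤ (ℕ.m≤m+n i (suc q)) Px ⟩
      X (Y x) + (i ℕ.+ suc q ∸ i) · x         ≈⟨ +-congˡ (×-congˡ (≡.trans (ℕ.m+n∸m≡n i (suc q)) (≡.sym (ℕ.*-identityˡ (suc q))))) ⟩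
      X (Y x) + (1 ℕ.* suc q) · x             ∎
    -- The vector u may lie above the middle, where h is negative, so the commutator is used with
    -- `(suc k ℕ.+ i) · u` added to both sides.
    YX^[1+k] (suc k) q {i} {x} Px = ∙-cancelʳ ((suc k ℕ.+ i) · u) _ _ (begin
      Y (X u) + (suc k ℕ.+ i) · u                       ≈⟨ commutator Pu ⟩
      X (Y u) + (i ℕ.+ suc q) · u                       ≈⟨ +-congʳ (cong X-additive (YX^[1+k] k (suc q) (≡.subst (λ s → P i s x) (lem₁ i k q) Px))) ⟩
      X (iterate X k (X (Y x) + c · x)) + (i ℕ.+ suc q) · u ≈⟨ +-congʳ (homo X^ _ _) ⟩
      v + iterate X (suc k) (c · x) + (i ℕ.+ suc q) · u ≈⟨ +-congʳ (+-congˡ (·-homo X^ c x)) ⟩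
      v + c · u + (i ℕ.+ suc q) · u                     ≈⟨ +-assoc _ _ _ ⟩
      v + (c · u + (i ℕ.+ suc q) · u)                   ≈⟨ +-congˡ (×-homo-+ u c (i ℕ.+ suc q)) ⟨
      v + (c ℕ.+ (i ℕ.+ suc q)) · u                     ≈⟨ +-congˡ (×-congˡ (lem₂ i k q)) ⟩
      v + (c′ ℕ.+ (suc k ℕ.+ i)) · u                    ≈⟨ +-congˡ (×-homo-+ u c′ (suc k ℕ.+ i)) ⟩
      v + (c′ · u + (suc k ℕ.+ i) · u)                  ≈⟨ +-assoc _ _ _ ⟨
      v + c′ · u + (suc k ℕ.+ i) · u                    ≈⟨ +-congʳ (+-congˡ (·-homo X^ c′ x)) ⟨
      v + iterate X (suc k) (c′ · x) + (suc k ℕ.+ i) · u ≈⟨ +-congʳ (homo X^ _ _) ⟨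
      iterate X (suc k) (X (Y x) + c′ · x) + (suc k ℕ.+ i) · u ∎)
      where
      open ℕ-Solver.+-*-Solver using (_:+_; _:*_; _:=_; con) renaming (solve to ℕ-solve)

      u v : A
      u = iterate X (suc k) x
      v = iterate X (suc k) (X (Y x))

      c c′ : ℕ
      c  = suc k ℕ.* suc (suc q)
      c′ = suc (suc k) ℕ.* suc q

      X^ : Additive (iterate X (suc k))
      X^ = iterate-additive X-additive (suc k)

      lem₁ : ∀ i k q → i ℕ.+ (suc k ℕ.+ suc q) ≡ i ℕ.+ (k ℕ.+ suc (suc q))
      lem₁ i k q = ≡.cong (i ℕ.+_) (≡.sym (ℕ.+-suc k (suc q)))

      lem₂ : ∀ i k q → suc k ℕ.* suc (suc q) ℕ.+ (i ℕ.+ suc q) ≡ suc (suc k) ℕ.* suc q ℕ.+ (suc k ℕ.+ i)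
      lem₂ = ℕ-solve 3 (λ i k q →
        (con 1 :+ k) :* (con 2 :+ q) :+ (i :+ (con 1 :+ q)) :=
        (con 2 :+ k) :* (con 1 :+ q) :+ ((con 1 :+ k) :+ i)) ≡.refl

      Pu : P (suc k ℕ.+ i) (i ℕ.+ suc q) u
      Pu = X^-maps (suc k) (≡.subst (λ s → P i s x)
        (ℕ-solve 3 (λ i k q → i :+ (con 1 :+ k :+ (con 1 :+ q)) := con 1 :+ k :+ (i :+ (con 1 :+ q))) ≡.refl i k q) Px)

    -- By `YX^[1+k]`, Y^(k+1) X^(k+1) is the composite of XY + (k+1)(q+1) and Y^k X^k, both
    -- bijective on the same space. The parameter q absorbs the decrease of k, so that the weight k
    -- + q stays fixed in the induction.
    Y^X^-bijective : ∀ k q {i} → let Q = P i (i ℕ.+ (k ℕ.+ q)) in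
                     Bijective Q Q (iterate Y k ∘ iterate X k)
    Y^X^-bijective zero    q = record
      { maps = λ Px → Px ; kernel = λ _ eq → eq ; surjective = λ {y} Py → y , Py , refl }
    Y^X^-bijective (suc k) q {i} = ≡.subst (λ s → Bijective (P i s) (P i s) (iterate Y (suc k) ∘ iterate X (suc k))) (lem i k q) (record
      { maps       = λ Px → P-resp (sym (factor Px)) (maps IH (maps B Px))
      ; kernel     = λ Px eq → kernel B Px (kernel IH (maps B Px) (trans (sym (factor Px)) eq))
      ; surjective = λ Py →
          let z , Pz , eq = surjective IH Py
              x , Px , eq′ = surjective B Pz
          in x , Px , trans (factor Px) (trans (cong Y^X^ eq′) eq)
      })
      where
      lem : ∀ i k q → i ℕ.+ (k ℕ.+ suc q) ≡ i ℕ.+ (suc k ℕ.+ q)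
      lem i k q = ≡.cong (i ℕ.+_) (ℕ.+-suc k q)

      b : A → A
      b x = X (Y x) + (suc k ℕ.* suc q) · x

      Q : A → Set p
      Q = P i (i ℕ.+ (k ℕ.+ suc q))

      IH : Bijective Q Q (iterate Y k ∘ iterate X k)
      IH = Y^X^-bijective k (suc q)

      B : Bijective Q Q b
      -- The constant passed on is the predecessor of (k+1)(q+1).
      B = XY+c-bijective i (q ℕ.+ k ℕ.* suc q) (ℕ.m≤n⇒m≤1+n (ℕ.m≤m+n i (k ℕ.+ suc q)))

      Y^X^ : Additive (iterate Y k ∘ iterate X k)
      Y^X^ = ∘-additive (iterate-additive Y-additive k) (iterate-additive X-additive k)

      factor : ∀ {x} → Q x → iterate Y (suc k) (iterate X (suc k) x) ≈ iterate Y k (iterate X k (b x))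
      factor {x} Px = begin
        Y (iterate Y k (iterate X (suc k) x))   ≡⟨ iterate-shift Y k _ ⟨
        iterate Y k (Y (iterate X (suc k) x))   ≈⟨ cong (iterate-additive Y-additive k) (YX^[1+k] k q Px) ⟩
        iterate Y k (iterate X k (b x))         ∎

    Y^ℓX^ℓ-bijective : ∀ ℓ {i} → Bijective (P i (i ℕ.+ ℓ)) (P i (i ℕ.+ ℓ)) (iterate Y ℓ ∘ iterate X ℓ)
    Y^ℓX^ℓ-bijective ℓ {i} =
      ≡.subst (λ s → Bijective (P i (i ℕ.+ s)) (P i (i ℕ.+ s)) (iterate Y ℓ ∘ iterate X ℓ))
        (ℕ.+-identityʳ ℓ) (Y^X^-bijective ℓ 0)

  -- Bijectivity of Y^ℓ X^ℓ on the lower space gives injectivity of X^ℓ. In the reversed ladder it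
  -- says that X^ℓ Y^ℓ is bijective on the upper space, which supplies preimages of the form Y^ℓ z.
  lefschetz : ∀ {p} {P : ℕ → ℕ → A → Set p} {X Y} → Ladder P X Y → ∀ i ℓ →
              Bijective (P i (i ℕ.+ ℓ)) (P (i ℕ.+ ℓ) i) (iterate X ℓ)
  lefschetz {P = P} {X} {Y} L i ℓ = record
    { maps       = λ {x} Px →
        ≡.subst (λ s → P s i (iterate X ℓ x)) (ℕ.+-comm ℓ i)
          (X^-maps ℓ (≡.subst (λ s → P i s x) (ℕ.+-comm i ℓ) Px))
    ; kernel     = λ Px eq → kernel (Y^ℓX^ℓ-bijective ℓ) Px
        (trans (cong Y^ eq) (zero-homo Y^))
    ; surjective = λ Py →
        let z , Pz , eq = surjective (Flipped.Y^ℓX^ℓ-bijective ℓ) Py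
        in iterate Y ℓ z
         , ≡.subst (λ s → P i s (iterate Y ℓ z)) (ℕ.+-comm ℓ i)
             (Flipped.X^-maps ℓ (≡.subst (λ s → P s i z) (ℕ.+-comm i ℓ) Pz))
         , eq
    }
    where
    open Ladder L using (Y-additive)
    open Lefschetz L
    module Flipped = Lefschetz (flip L)
    open Bijective
    Y^ : Additive (iterate Y ℓ)
    Y^ = iterate-additive Y-additive ℓ

-- Sums over the words of length d in two letters

Word : ℕ → Set
Word = Vec (Fin 2)

complement : ∀ {d} → Word d → Word d
complement = Vec.map opposite

complement-involutive : ∀ {d} (J : Word d) → complement (complement J) ≡ J
complement-involutive []             = ≡.refl
complement-involutive (zero     ∷ J) = ≡.cong (zero ∷_) (complement-involutive J)
complement-involutive (suc zero ∷ J) = ≡.cong (suc zero ∷_) (complement-involutive J)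

module WordSum {a ℓ} (M : CommutativeMonoid a ℓ) where

  open CommutativeMonoid M
  open import Algebra.Properties.CommutativeSemigroup commutativeSemigroup using (interchange)
  open import Algebra.Properties.CommutativeMonoid.Mult M using (×-homo-+; ×-congˡ)
    renaming (_×_ to _·_)
  open import Relation.Binary.Reasoning.Setoid setoid

  Σʷ : ∀ {d} → (Word d → Carrier) → Carrier
  Σʷ {zero}  f = f []
  Σʷ {suc d} f = Σʷ (f ∘ (zero ∷_)) ∙ Σʷ (f ∘ (suc zero ∷_))

  Σʷ-cong : ∀ {d} {f g : Word d → Carrier} → (∀ J → f J ≈ g J) → Σʷ f ≈ Σʷ g
  Σʷ-cong {zero}  p = p []
  Σʷ-cong {suc d} p = ∙-cong (Σʷ-cong (p ∘ (zero ∷_))) (Σʷ-cong (p ∘ (suc zero ∷_)))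

  Σʷ-∙ : ∀ {d} (f g : Word d → Carrier) → Σʷ (λ J → f J ∙ g J) ≈ Σʷ f ∙ Σʷ g
  Σʷ-∙ {zero}  f g = refl
  Σʷ-∙ {suc d} f g = trans (∙-cong (Σʷ-∙ {d} _ _) (Σʷ-∙ {d} _ _)) (interchange _ _ _ _)

  Σʷ-swap : ∀ {d d′} (f : Word d → Word d′ → Carrier) →
            Σʷ (λ I → Σʷ (f I)) ≈ Σʷ (λ J → Σʷ (λ I → f I J))
  Σʷ-swap {zero}  f = refl
  Σʷ-swap {suc d} f = trans (∙-cong (Σʷ-swap (f ∘ (zero ∷_))) (Σʷ-swap (f ∘ (suc zero ∷_))))
    (sym (Σʷ-∙ (λ J → Σʷ (λ I → f (zero ∷ I) J)) (λ J → Σʷ (λ I → f (suc zero ∷ I) J))))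

  Σʷ-complement : ∀ {d} (f : Word d → Carrier) → Σʷ (f ∘ complement) ≈ Σʷ f
  Σʷ-complement {zero}  f = refl
  Σʷ-complement {suc d} f = trans
    (∙-cong (Σʷ-complement (f ∘ (suc zero ∷_))) (Σʷ-complement (f ∘ (zero ∷_)))) (comm _ _)

  Σʷ-const : ∀ d x → Σʷ {d} (λ _ → x) ≈ (2 ℕ.^ d) · x
  Σʷ-const zero    x = sym (identityʳ x)
  Σʷ-const (suc d) x = begin
    Σʷ {d} (λ _ → x) ∙ Σʷ {d} (λ _ → x)        ≈⟨ ∙-cong (Σʷ-const d x) (Σʷ-const d x) ⟩
    (2 ℕ.^ d) · x ∙ (2 ℕ.^ d) · x              ≈⟨ ×-homo-+ x (2 ℕ.^ d) (2 ℕ.^ d) ⟨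
    (2 ℕ.^ d ℕ.+ 2 ℕ.^ d) · x                  ≈⟨ ×-congˡ (≡.cong (2 ℕ.^ d ℕ.+_) (≡.sym (ℕ.+-identityʳ _))) ⟩
    (2 ℕ.^ suc d) · x                          ∎

  foldr-++ : ∀ xs ys → List.foldr _∙_ ε (xs ++ ys) ≈ List.foldr _∙_ ε xs ∙ List.foldr _∙_ ε ys
  foldr-++ []       ys = sym (identityˡ _)
  foldr-++ (x ∷ xs) ys = trans (∙-congˡ (foldr-++ xs ys)) (sym (assoc _ _ _))

  -- The link to the list sums that define ω and the group action; τ lets the letters be
  -- permutations as well as indices.
  foldr-words : ∀ {b} {B : Set b} (τ : Fin 2 → B) d (f : Vec B d → Carrier) →
                List.foldr _∙_ ε (List.map f (words (τ zero ∷ τ (suc zero) ∷ []) d)) ≈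
                Σʷ (f ∘ Vec.map τ)
  foldr-words τ zero    f = identityʳ _
  foldr-words τ (suc d) f = begin
    sum (List.map f (List.map x ws ++ List.map y ws ++ []))                 ≡⟨ ≡.cong sum (List.map-++ f (List.map x ws) _) ⟩
    sum (List.map f (List.map x ws) ++ List.map f (List.map y ws ++ []))    ≈⟨ foldr-++ (List.map f (List.map x ws)) _ ⟩
    sum (List.map f (List.map x ws)) ∙ sum (List.map f (List.map y ws ++ [])) ≡⟨ ≡.cong₂ (λ p q → sum p ∙ sum q)
         (≡.sym (List.map-∘ ws))
         (≡.trans (≡.cong (List.map f) (List.++-identityʳ (List.map y ws))) (≡.sym (List.map-∘ ws))) ⟩
    sum (List.map (f ∘ x) ws) ∙ sum (List.map (f ∘ y) ws)                   ≈⟨ ∙-cong (foldr-words τ d (f ∘ x)) (foldr-words τ d (f ∘ y)) ⟩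
    Σʷ (f ∘ Vec.map τ ∘ (zero ∷_)) ∙ Σʷ (f ∘ Vec.map τ ∘ (suc zero ∷_))     ∎
    where
    ws = words (τ zero ∷ τ (suc zero) ∷ []) d
    x = τ zero ∷_
    y = τ (suc zero) ∷_
    sum = List.foldr _∙_ ε

-- Preservation of the binary operation is enough, because a sum over words is never empty.
Σʷ-homo : ∀ {a ℓ a′ ℓ′} (M : CommutativeMonoid a ℓ) (N : CommutativeMonoid a′ ℓ′) →
          let module M = CommutativeMonoid M ; module N = CommutativeMonoid N in
          (h : M.Carrier → N.Carrier) → (∀ x y → h (x M.∙ y) N.≈ h x N.∙ h y) →
          ∀ {d} (f : Word d → M.Carrier) →
          h (WordSum.Σʷ M f) N.≈ WordSum.Σʷ N (h ∘ f)
Σʷ-homo M N h homo {zero}  f = CommutativeMonoid.refl N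
Σʷ-homo M N h homo {suc d} f = CommutativeMonoid.trans N (homo _ _)
  (CommutativeMonoid.∙-cong N (Σʷ-homo M N h homo (f ∘ (zero ∷_)))
                              (Σʷ-homo M N h homo (f ∘ (suc zero ∷_))))

-- The exterior algebra as a ring and a module; signs of words

module ExteriorAlgebra {c ℓ} (K : CommutativeRing c ℓ) where

  open MultilinearAlgebra K
  open CommutativeRing K hiding (zero) renaming (Carrier to 𝕂)
  open import Algebra.Properties.Ring ring using (-‿distribˡ-*; -‿involutive)

  module Σᴷ = WordSum +-commutativeMonoid

  -- The Kronecker delta of words; as a function of its second argument it is the basis tensor e_I.
  δ : ∀ {d} → Word d → Word d → 𝕂
  δ I = ⨂ (Vec.map e I)

  δ-diagonal : ∀ {d} (J : Word d) → δ J J ≈ 1#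
  δ-diagonal []             = refl
  δ-diagonal (zero     ∷ J) = trans (*-identityˡ _) (δ-diagonal J)
  δ-diagonal (suc zero ∷ J) = trans (*-identityˡ _) (δ-diagonal J)

  δ-sym : ∀ {d} (I J : Word d) → δ I J ≈ δ J I
  δ-sym []             []             = refl
  δ-sym (zero     ∷ I) (zero     ∷ J) = *-congˡ (δ-sym I J)
  δ-sym (zero     ∷ I) (suc zero ∷ J) = trans (zeroˡ _) (sym (zeroˡ _))
  δ-sym (suc zero ∷ I) (zero     ∷ J) = trans (zeroˡ _) (sym (zeroˡ _))
  δ-sym (suc zero ∷ I) (suc zero ∷ J) = *-congˡ (δ-sym I J)

  δ-complement : ∀ {d} (I J : Word d) → δ (complement I) J ≈ δ I (complement J)
  δ-complement []             []             = refl
  δ-complement (zero     ∷ I) (zero     ∷ J) = *-congˡ (δ-complement I J)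
  δ-complement (zero     ∷ I) (suc zero ∷ J) = *-congˡ (δ-complement I J)
  δ-complement (suc zero ∷ I) (zero     ∷ J) = *-congˡ (δ-complement I J)
  δ-complement (suc zero ∷ I) (suc zero ∷ J) = *-congˡ (δ-complement I J)

  module _ {m ℓm} (M : LeftModule ring m ℓm) where

    open LeftModule M
    open WordSum +ᴹ-commutativeMonoid
    open import Relation.Binary.Reasoning.Setoid ≈ᴹ-setoid

    -- Stated over an arbitrary module because it collapses sums of scalars as well as sums in ⋀ V.
    -- The first letter of J decides which half of the sum survives.
    Σʷ-δ : ∀ {d} (J : Word d) (f : Word d → Carrierᴹ) → Σʷ (λ I → δ I J *ₗ f I) ≈ᴹ f J
    Σʷ-0 : ∀ {d} (J : Word d) (f : Word d → Carrierᴹ) → Σʷ (λ I → (0# * δ I J) *ₗ f I) ≈ᴹ 0ᴹ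
    Σʷ-1 : ∀ {d} (J : Word d) (f : Word d → Carrierᴹ) → Σʷ (λ I → (1# * δ I J) *ₗ f I) ≈ᴹ f J

    Σʷ-δ []             f = *ₗ-identityˡ (f [])
    Σʷ-δ (zero     ∷ J) f = ≈ᴹ-trans (+ᴹ-cong (Σʷ-1 J _) (Σʷ-0 J _)) (+ᴹ-identityʳ _)
    Σʷ-δ (suc zero ∷ J) f = ≈ᴹ-trans (+ᴹ-cong (Σʷ-0 J _) (Σʷ-1 J _)) (+ᴹ-identityˡ _)

    Σʷ-1 {d} J f = ≈ᴹ-trans (Σʷ-cong {d} (λ I → *ₗ-congʳ (*-identityˡ _))) (Σʷ-δ J f)

    Σʷ-0 {d} J f = begin
      Σʷ (λ I → (0# * δ I J) *ₗ f I)  ≈⟨ Σʷ-cong (λ I → ≈ᴹ-trans (*ₗ-congʳ (zeroˡ _)) (*ₗ-zeroˡ (f I))) ⟩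
      Σʷ (λ (_ : Word d) → 0ᴹ)        ≈⟨ Σʷ-0ᴹ d ⟩
      0ᴹ                              ∎
      where
      Σʷ-0ᴹ : ∀ d → Σʷ (λ (_ : Word d) → 0ᴹ) ≈ᴹ 0ᴹ
      Σʷ-0ᴹ zero    = ≈ᴹ-refl
      Σʷ-0ᴹ (suc d) = ≈ᴹ-trans (+ᴹ-cong (Σʷ-0ᴹ d) (Σʷ-0ᴹ d)) (+ᴹ-identityˡ _)

  -- The sign of the tuple in S₂^d that has a transposition at each letter `suc zero`.
  sign : ∀ {d} → Word d → 𝕂
  sign []             = 1#
  sign (zero     ∷ J) = sign J
  sign (suc zero ∷ J) = - sign J

  sign² : ∀ {d} (J : Word d) → sign J * sign J ≈ 1#
  sign² []             = *-identityˡ 1#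
  sign² (zero     ∷ J) = sign² J
  sign² (suc zero ∷ J) = begin
    - sign J * - sign J     ≈⟨ -‿distribˡ-* _ _ ⟨
    - (sign J * - sign J)   ≈⟨ -‿cong (*-comm _ _) ⟩
    - (- sign J * sign J)   ≈⟨ -‿cong (-‿distribˡ-* _ _) ⟨
    - - (sign J * sign J)   ≈⟨ -‿involutive _ ⟩
    sign J * sign J         ≈⟨ sign² J ⟩
    1#                      ∎
    where open import Relation.Binary.Reasoning.Setoid setoid

  -- A word and its complement together contain d letters `suc zero`, so their signs differ by
  -- (-1)^d. This is how the oddness of d enters: the terms of ω at J and at its complement agree
  -- instead of cancelling.
  sign-complement : ∀ {d} → ¬ (2 ∣ d) → (J : Word d) → sign (complement J) ≈ - sign J
  sign-complement {d} 2∤d J with parity d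
    where
    -- Lengthening the word exchanges the two parities, so the induction carries both cases.
    parity : ∀ d → (2 ∣ d × (∀ (J : Word d) → sign (complement J) ≈ sign J)) ⊎
                   (2 ∣ suc d × (∀ (J : Word d) → sign (complement J) ≈ - sign J))
    parity zero    = inj₁ (divides 0 ≡.refl , λ { [] → refl })
    parity (suc d) with parity d
    ... | inj₁ (2∣d , p) = inj₂ (∣m∣n⇒∣m+n ∣-refl 2∣d , λ
      { (zero     ∷ J) → -‿cong (p J)
      ; (suc zero ∷ J) → trans (p J) (sym (-‿involutive _)) })
    ... | inj₂ (2∣1+d , p) = inj₁ (2∣1+d , λ
      { (zero     ∷ J) → trans (-‿cong (p J)) (-‿involutive _)
      ; (suc zero ∷ J) → p J })
  ... | inj₁ (2∣d , _) = contradiction 2∣d 2∤d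
  ... | inj₂ (_ , p)   = p J

  module _ {d : ℕ} where

    -- The presentation has no negation; multiplication by the scalar -1 takes its place.
    ⋀-ring : Ring c (c ⊔ ℓ)
    ⋀-ring = record
      { Carrier = ⋀ d
      ; _≈_ = _≋_
      ; _+_ = _⊕_
      ; _*_ = _∧_
      ; -_  = η (- 1#) ∧_
      ; 0#  = η 0#
      ; 1#  = η 1#
      ; isRing = record
        { +-isAbelianGroup = record
          { isGroup = record
            { isMonoid = record
              { isSemigroup = record
                { isMagma = record
                  { isEquivalence = record { refl = ≋-refl ; sym = ≋-sym ; trans = ≋-trans }
                  ; ∙-cong = ⊕-cong
                  }
                ; assoc = ⊕-assoc
                }
              ; identity = ⊕-identityˡ , λ x → ≋-trans (⊕-comm _ _) (⊕-identityˡ x)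
              }
            ; inverse = ⊖-inverseˡ , λ x → ≋-trans (⊕-comm _ _) (⊖-inverseˡ x)
            ; ⁻¹-cong = ∧-cong ≋-refl
            }
          ; comm = ⊕-comm
          }
        ; *-cong = ∧-cong
        ; *-assoc = ∧-assoc
        ; *-identity = ∧-identityˡ , λ x → ≋-trans (≋-sym (η-central 1# x)) (∧-identityˡ x)
        ; distrib = ∧-distribˡ , ∧-distribʳ
        }
      }
      where
      ⊖-inverseˡ : ∀ (x : ⋀ d) → (η (- 1#) ∧ x) ⊕ x ≋ η 0#
      ⊖-inverseˡ x = ≋-trans (⊕-cong ≋-refl (≋-sym (∧-identityˡ x)))
        (≋-trans (≋-sym (∧-distribʳ x (η (- 1#)) (η 1#)))
        (≋-trans (∧-cong (≋-trans (≋-sym (η-+ _ _)) (η-cong (-‿inverseˡ 1#))) ≋-refl) (∧-zeroˡ x)))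

    ⋀-leftModule : LeftModule ring c (c ⊔ ℓ)
    ⋀-leftModule = record
      { Carrierᴹ = ⋀ d
      ; _≈ᴹ_ = _≋_
      ; _+ᴹ_ = _⊕_
      ; _*ₗ_ = λ k x → η k ∧ x
      ; 0ᴹ   = η 0#
      ; -ᴹ_  = Ring.-_ ⋀-ring
      ; isLeftModule = record
        { isLeftSemimodule = record
          { +ᴹ-isCommutativeMonoid = Ring.+-isCommutativeMonoid ⋀-ring
          ; isPreleftSemimodule = record
            { *ₗ-cong = λ p q → ∧-cong (η-cong p) q
            ; *ₗ-zeroˡ = ∧-zeroˡ
            ; *ₗ-distribʳ = λ x k l → ≋-trans (∧-cong (η-+ k l) ≋-refl) (∧-distribʳ x (η k) (η l))
            ; *ₗ-identityˡ = ∧-identityˡ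
            ; *ₗ-assoc = λ k l x → ≋-trans (∧-cong (η-* k l) ≋-refl) (∧-assoc _ _ _)
            ; *ₗ-zeroʳ = λ k → Ring.zeroʳ ⋀-ring (η k)
            ; *ₗ-distribˡ = λ k → ∧-distribˡ (η k)
            }
          }
        ; -ᴹ‿cong = ∧-cong ≋-refl
        ; -ᴹ‿inverse = Ring.-‿inverse ⋀-ring
        }
      }

-- Contractions and the degree operator

module Contraction {c ℓ} (K : CommutativeRing c ℓ) (d : ℕ) where

  open MultilinearAlgebra K
  open CommutativeRing K hiding (zero) renaming (Carrier to 𝕂)
  open ExteriorAlgebra K

  module R where
    open Ring (⋀-ring {d}) public
    open import Algebra.Properties.Ring (⋀-ring {d}) public
      using (-‿distribˡ-*; -‿involutive; +-inverseʳ-unique)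
    open import Algebra.Properties.CommutativeMonoid.Mult (Ring.+-commutativeMonoid (⋀-ring {d})) public
      using (_×_; ×-congʳ; ×-congˡ; ×-homo-+; ×-distrib-+; ×-assocˡ)

  module Σ = WordSum R.+-commutativeMonoid
  open Sl₂ R.+-abelianGroup using (Additive; ∘-additive; ·-additive)
  open import Algebra.Solver.CommutativeMonoid R.+-commutativeMonoid using (solve; _⊜_) renaming (_⊕_ to _:⊕_)
  open import Relation.Binary.Reasoning.Setoid R.setoid

  infix 8 ⊖_
  ⊖_ : ⋀ d → ⋀ d
  ⊖_ = R.-_

  ∧-scale : ∀ k (x y : ⋀ d) → x ∧ η k ∧ y ≋ η k ∧ x ∧ y
  ∧-scale k x y = ≋-trans (≋-sym (∧-assoc _ _ _))
    (≋-trans (∧-cong (≋-sym (η-central k x)) ≋-refl) (∧-assoc _ _ _))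

  scale-scale : ∀ k l (x : ⋀ d) → η k ∧ η l ∧ x ≋ η (k * l) ∧ x
  scale-scale k l x = ≋-trans (≋-sym (∧-assoc _ _ _)) (∧-cong (≋-sym (η-* k l)) ≋-refl)

  scale-neg : ∀ k (x : ⋀ d) → η (- k) ∧ x ≋ ⊖ (η k ∧ x)
  scale-neg k x = R.+-inverseʳ-unique _ _ (begin
    η k ∧ x ⊕ η (- k) ∧ x   ≈⟨ ∧-distribʳ _ _ _ ⟨
    (η k ⊕ η (- k)) ∧ x     ≈⟨ ∧-cong (η-+ _ _) ≋-refl ⟨
    η (k - k) ∧ x           ≈⟨ ∧-cong (η-cong (-‿inverseʳ k)) ≋-refl ⟩
    η 0# ∧ x                ≈⟨ ∧-zeroˡ x ⟩
    η 0#                    ∎)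

  -- Polarisation of the alternating relation at v + u.
  anticommute : ∀ u v (x : ⋀ d) → ι u ∧ ι v ∧ x ≋ ⊖ (ι v ∧ ι u ∧ x)
  anticommute u v x = R.+-inverseʳ-unique _ _ (begin
    ι v ∧ ι u ∧ x ⊕ ι u ∧ ι v ∧ x                                 ≈⟨ ⊕-cong (∧-assoc _ _ _) (∧-assoc _ _ _) ⟨
    (ι v ∧ ι u) ∧ x ⊕ (ι u ∧ ι v) ∧ x                             ≈⟨ ∧-distribʳ _ _ _ ⟨
    (ι v ∧ ι u ⊕ ι u ∧ ι v) ∧ x                                   ≈⟨ ∧-cong expand ≋-refl ⟨
    (ι v+u ∧ ι v+u) ∧ x                                           ≈⟨ ∧-cong (alternating v+u) ≋-refl ⟩
    η 0# ∧ x                                                      ≈⟨ ∧-zeroˡ x ⟩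
    η 0#                                                          ∎)
    where
    v+u : V d
    v+u I = v I + u I
    expand : ι v+u ∧ ι v+u ≋ ι v ∧ ι u ⊕ ι u ∧ ι v
    expand = begin
      ι v+u ∧ ι v+u                                               ≈⟨ ∧-cong (ι-+ v u) (ι-+ v u) ⟩
      (ι v ⊕ ι u) ∧ (ι v ⊕ ι u)                                   ≈⟨ ∧-distribʳ _ _ _ ⟩
      ι v ∧ (ι v ⊕ ι u) ⊕ ι u ∧ (ι v ⊕ ι u)                       ≈⟨ ⊕-cong (∧-distribˡ _ _ _) (∧-distribˡ _ _ _) ⟩
      (ι v ∧ ι v ⊕ ι v ∧ ι u) ⊕ (ι u ∧ ι v ⊕ ι u ∧ ι u)           ≈⟨ ⊕-cong (⊕-cong (alternating v) ≋-refl) (⊕-cong ≋-refl (alternating u)) ⟩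
      (η 0# ⊕ ι v ∧ ι u) ⊕ (ι u ∧ ι v ⊕ η 0#)                     ≈⟨ ⊕-cong (⊕-identityˡ _) (R.+-identityʳ _) ⟩
      ι v ∧ ι u ⊕ ι u ∧ ι v                                       ∎

  ∧-additive : ∀ x → Additive (x ∧_)
  ∧-additive x = record { cong = ∧-cong ≋-refl ; homo = ∧-distribˡ x }

  -- Contraction with the coordinate functionals: the antiderivations of ⋀ V
  -- with v ↦ v J, defined through the grade involution.

  gradeInvolution : ⋀ d → ⋀ d
  gradeInvolution (η k)   = η k
  gradeInvolution (ι v)   = ⊖ ι v
  gradeInvolution (x ⊕ y) = gradeInvolution x ⊕ gradeInvolution y
  gradeInvolution (x ∧ y) = gradeInvolution x ∧ gradeInvolution y

  -- A map defined on expressions descends to ⋀ V once it respects every defining relation. The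
  -- alternating one survives because the two signs cancel.
  gradeInvolution-cong : ∀ {x y} → x ≋ y → gradeInvolution x ≋ gradeInvolution y
  gradeInvolution-cong ≋-refl             = ≋-refl
  gradeInvolution-cong (≋-sym p)          = ≋-sym (gradeInvolution-cong p)
  gradeInvolution-cong (≋-trans p q)      = ≋-trans (gradeInvolution-cong p) (gradeInvolution-cong q)
  gradeInvolution-cong (η-cong p)         = η-cong p
  gradeInvolution-cong (ι-cong p)         = ∧-cong ≋-refl (ι-cong p)
  gradeInvolution-cong (⊕-cong p q)       = ⊕-cong (gradeInvolution-cong p) (gradeInvolution-cong q)
  gradeInvolution-cong (∧-cong p q)       = ∧-cong (gradeInvolution-cong p) (gradeInvolution-cong q)
  gradeInvolution-cong (⊕-assoc x y z)    = ⊕-assoc _ _ _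
  gradeInvolution-cong (⊕-comm x y)       = ⊕-comm _ _
  gradeInvolution-cong (⊕-identityˡ x)    = ⊕-identityˡ _
  gradeInvolution-cong (∧-assoc x y z)    = ∧-assoc _ _ _
  gradeInvolution-cong (∧-identityˡ x)    = ∧-identityˡ _
  gradeInvolution-cong (∧-zeroˡ x)        = ∧-zeroˡ _
  gradeInvolution-cong (∧-distribˡ x y z) = ∧-distribˡ _ _ _
  gradeInvolution-cong (∧-distribʳ x y z) = ∧-distribʳ _ _ _
  gradeInvolution-cong (η-+ k l)          = η-+ k l
  gradeInvolution-cong (η-* k l)          = η-* k l
  gradeInvolution-cong (η-central k x)    = η-central k _
  gradeInvolution-cong (ι-+ u v)          = ≋-trans (∧-cong ≋-refl (ι-+ u v)) (∧-distribˡ _ _ _)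
  gradeInvolution-cong (ι-* k v)          = ≋-trans (∧-cong ≋-refl (ι-* k v)) (∧-scale k _ _)
  gradeInvolution-cong (alternating v)    = begin
    ⊖ ι v ∧ ⊖ ι v       ≈⟨ ∧-scale _ _ _ ⟩
    ⊖ (⊖ ι v ∧ ι v)     ≈⟨ ∧-cong ≋-refl (∧-assoc _ _ _) ⟩
    ⊖ ⊖ (ι v ∧ ι v)     ≈⟨ R.-‿involutive _ ⟩
    ι v ∧ ι v           ≈⟨ alternating v ⟩
    η 0#                ∎

  ∂ : Word d → ⋀ d → ⋀ d
  ∂ J (η k)   = η 0#
  ∂ J (ι v)   = η (v J)
  ∂ J (x ⊕ y) = ∂ J x ⊕ ∂ J y
  ∂ J (x ∧ y) = ∂ J x ∧ y ⊕ gradeInvolution x ∧ ∂ J y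

  ∂-scale : ∀ J k x → ∂ J (η k ∧ x) ≋ η k ∧ ∂ J x
  ∂-scale J k x = ≋-trans (⊕-cong (∧-zeroˡ x) ≋-refl) (⊕-identityˡ _)

  -- Associativity is respected because the grade involution is multiplicative, and the alternating
  -- relation because the involution gives the two terms opposite signs.
  ∂-cong : ∀ J {x y} → x ≋ y → ∂ J x ≋ ∂ J y
  ∂-cong J ≋-refl             = ≋-refl
  ∂-cong J (≋-sym p)          = ≋-sym (∂-cong J p)
  ∂-cong J (≋-trans p q)      = ≋-trans (∂-cong J p) (∂-cong J q)
  ∂-cong J (η-cong p)         = ≋-refl
  ∂-cong J (ι-cong p)         = η-cong (p J)
  ∂-cong J (⊕-cong p q)       = ⊕-cong (∂-cong J p) (∂-cong J q)
  ∂-cong J (∧-cong p q)       = ⊕-cong (∧-cong (∂-cong J p) q) (∧-cong (gradeInvolution-cong p) (∂-cong J q))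
  ∂-cong J (⊕-assoc x y z)    = ⊕-assoc _ _ _
  ∂-cong J (⊕-comm x y)       = ⊕-comm _ _
  ∂-cong J (⊕-identityˡ x)    = ⊕-identityˡ _
  ∂-cong J (∧-assoc x y z)    = begin
    (∂ J x ∧ y ⊕ gradeInvolution x ∧ ∂ J y) ∧ z ⊕ (gradeInvolution x ∧ gradeInvolution y) ∧ ∂ J z
      ≈⟨ ⊕-cong (∧-distribʳ _ _ _) (∧-assoc _ _ _) ⟩
    ((∂ J x ∧ y) ∧ z ⊕ (gradeInvolution x ∧ ∂ J y) ∧ z) ⊕ gradeInvolution x ∧ gradeInvolution y ∧ ∂ J z
      ≈⟨ ⊕-cong (⊕-cong (∧-assoc _ _ _) (∧-assoc _ _ _)) ≋-refl ⟩
    (∂ J x ∧ y ∧ z ⊕ gradeInvolution x ∧ ∂ J y ∧ z) ⊕ gradeInvolution x ∧ gradeInvolution y ∧ ∂ J z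
      ≈⟨ ⊕-assoc _ _ _ ⟩
    ∂ J x ∧ y ∧ z ⊕ (gradeInvolution x ∧ ∂ J y ∧ z ⊕ gradeInvolution x ∧ gradeInvolution y ∧ ∂ J z)
      ≈⟨ ⊕-cong ≋-refl (∧-distribˡ _ _ _) ⟨
    ∂ J x ∧ y ∧ z ⊕ gradeInvolution x ∧ (∂ J y ∧ z ⊕ gradeInvolution y ∧ ∂ J z) ∎
  ∂-cong J (∧-identityˡ x)    = ≋-trans (∂-scale J 1# x) (∧-identityˡ _)
  ∂-cong J (∧-zeroˡ x)        = ≋-trans (∂-scale J 0# x) (∧-zeroˡ _)
  ∂-cong J (∧-distribˡ x y z) = begin
    ∂ J x ∧ (y ⊕ z) ⊕ gradeInvolution x ∧ (∂ J y ⊕ ∂ J z)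
      ≈⟨ ⊕-cong (∧-distribˡ _ _ _) (∧-distribˡ _ _ _) ⟩
    (∂ J x ∧ y ⊕ ∂ J x ∧ z) ⊕ (gradeInvolution x ∧ ∂ J y ⊕ gradeInvolution x ∧ ∂ J z)
      ≈⟨ solve 4 (λ a b c d → (a :⊕ b) :⊕ (c :⊕ d) ⊜ (a :⊕ c) :⊕ (b :⊕ d)) ≋-refl _ _ _ _ ⟩
    (∂ J x ∧ y ⊕ gradeInvolution x ∧ ∂ J y) ⊕ (∂ J x ∧ z ⊕ gradeInvolution x ∧ ∂ J z) ∎
  ∂-cong J (∧-distribʳ x y z) = begin
    (∂ J y ⊕ ∂ J z) ∧ x ⊕ (gradeInvolution y ⊕ gradeInvolution z) ∧ ∂ J x
      ≈⟨ ⊕-cong (∧-distribʳ _ _ _) (∧-distribʳ _ _ _) ⟩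
    (∂ J y ∧ x ⊕ ∂ J z ∧ x) ⊕ (gradeInvolution y ∧ ∂ J x ⊕ gradeInvolution z ∧ ∂ J x)
      ≈⟨ solve 4 (λ a b c d → (a :⊕ b) :⊕ (c :⊕ d) ⊜ (a :⊕ c) :⊕ (b :⊕ d)) ≋-refl _ _ _ _ ⟩
    (∂ J y ∧ x ⊕ gradeInvolution y ∧ ∂ J x) ⊕ (∂ J z ∧ x ⊕ gradeInvolution z ∧ ∂ J x) ∎
  ∂-cong J (η-+ k l)          = ≋-sym (⊕-identityˡ _)
  ∂-cong J (η-* k l)          = ≋-sym (≋-trans (∂-scale J k (η l)) (R.zeroʳ _))
  ∂-cong J (η-central k x)    = begin
    ∂ J (η k ∧ x)                                 ≈⟨ ∂-scale J k x ⟩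
    η k ∧ ∂ J x                                   ≈⟨ η-central k _ ⟩
    ∂ J x ∧ η k                                   ≈⟨ R.+-identityʳ _ ⟨
    ∂ J x ∧ η k ⊕ η 0#                            ≈⟨ ⊕-cong ≋-refl (R.zeroʳ _) ⟨
    ∂ J x ∧ η k ⊕ gradeInvolution x ∧ η 0#        ∎
  ∂-cong J (ι-+ u v)          = η-+ _ _
  ∂-cong J (ι-* k v)          = ≋-trans (η-* k (v J)) (≋-sym (∂-scale J k (ι v)))
  ∂-cong J (alternating v)    = begin
    η (v J) ∧ ι v ⊕ ⊖ ι v ∧ η (v J)     ≈⟨ ⊕-cong (η-central _ _) (≋-sym (R.-‿distribˡ-* _ _)) ⟩
    ι v ∧ η (v J) ⊕ ⊖ (ι v ∧ η (v J))   ≈⟨ R.-‿inverseʳ _ ⟩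
    η 0#                                ∎

  ∂-additive : ∀ J → Additive (∂ J)
  ∂-additive J = record { cong = ∂-cong J ; homo = λ _ _ → ≋-refl }

  ∂-ι∧ : ∀ J v x → ∂ J (ι v ∧ x) ≋ η (v J) ∧ x ⊕ ⊖ (ι v ∧ ∂ J x)
  ∂-ι∧ J v x = ⊕-cong ≋-refl (≋-sym (R.-‿distribˡ-* _ _))

  ι∧-degree : ∀ v {r x} → x ∈⋀^ r → (ι v ∧ x) ∈⋀^ suc r
  ι∧-degree v (∈-resp p x∈)  = ∈-resp (∧-cong ≋-refl p) (ι∧-degree v x∈)
  ι∧-degree v (∈-product vs) = ∈-product (v ∷ vs)
  ι∧-degree v ∈-zero         = ∈-resp (≋-sym (R.zeroʳ _)) ∈-zero
  ι∧-degree v (∈-sum x∈ y∈)  = ∈-resp (≋-sym (∧-distribˡ _ _ _)) (∈-sum (ι∧-degree v x∈) (ι∧-degree v y∈))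
  ι∧-degree v (∈-scale k x∈) = ∈-resp (≋-sym (∧-scale k _ _)) (∈-scale k (ι∧-degree v x∈))

  ∂-degree-0 : ∀ J {x} → x ∈⋀^ 0 → ∂ J x ≋ η 0#
  ∂-degree-0 J (∈-resp p x∈)  = ≋-trans (∂-cong J (≋-sym p)) (∂-degree-0 J x∈)
  ∂-degree-0 J (∈-product []) = ≋-refl
  ∂-degree-0 J ∈-zero         = ≋-refl
  ∂-degree-0 J (∈-sum x∈ y∈)  = ≋-trans (⊕-cong (∂-degree-0 J x∈) (∂-degree-0 J y∈)) (⊕-identityˡ _)
  ∂-degree-0 J (∈-scale {x = x} k x∈) =
    ≋-trans (∂-scale J k x) (≋-trans (∧-cong ≋-refl (∂-degree-0 J x∈)) (R.zeroʳ _))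

  ∂-degree : ∀ J {r x} → x ∈⋀^ suc r → ∂ J x ∈⋀^ r
  ∂-degree J (∈-resp p x∈) = ∈-resp (∂-cong J p) (∂-degree J x∈)
  ∂-degree J {zero}  (∈-product (v ∷ [])) =
    ∈-resp (≋-sym (≋-trans (⊕-cong ≋-refl (R.zeroʳ _)) (R.+-identityʳ _))) (∈-scale (v J) (∈-product []))
  ∂-degree J {suc r} (∈-product (v ∷ vs)) = ∈-resp (≋-sym (∂-ι∧ J v (⋀-product vs)))
    (∈-sum (∈-scale (v J) (∈-product vs)) (∈-scale (- 1#) (ι∧-degree v (∂-degree J (∈-product vs)))))
  ∂-degree J ∈-zero        = ∈-zero
  ∂-degree J (∈-sum x∈ y∈) = ∈-sum (∂-degree J x∈) (∂-degree J y∈)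
  ∂-degree J (∈-scale {x = x} k x∈) = ∈-resp (≋-sym (∂-scale J k x)) (∈-scale k (∂-degree J x∈))

  basis : Word d → ⋀ d
  basis J = ι (⨂ (Vec.map e J))

  Σʷ-additive : ∀ {F : Word d → ⋀ d → ⋀ d} → (∀ J → Additive (F J)) → Additive (λ x → Σ.Σʷ (λ J → F J x))
  Σʷ-additive A = record
    { cong = λ p → Σ.Σʷ-cong {d} (λ J → Additive.cong (A J) p)
    ; homo = λ x y → ≋-trans (Σ.Σʷ-cong {d} (λ J → Additive.homo (A J) x y)) (Σ.Σʷ-∙ {d} _ _)
    }

  additive-Σʷ : ∀ {f} → Additive f → ∀ {n} (g : Word n → ⋀ d) → f (Σ.Σʷ g) ≋ Σ.Σʷ (λ J → f (g J))
  additive-Σʷ {f} F g = Σʷ-homo R.+-commutativeMonoid R.+-commutativeMonoid f (Additive.homo F) g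

  -- The expansion of v in coordinates holds pointwise in V, and ι is linear.
  ι-expand : ∀ v → ι v ≋ Σ.Σʷ (λ J → η (v J) ∧ basis J)
  ι-expand v = begin
    ι v                                                   ≈⟨ ι-cong expand ⟩
    ι (WordSum.Σʷ pointwise (λ J I → v J * δ J I))        ≈⟨ Σʷ-homo pointwise R.+-commutativeMonoid ι ι-+ {d} _ ⟩
    Σ.Σʷ (λ J → ι (λ I → v J * δ J I))                    ≈⟨ Σ.Σʷ-cong {d} (λ J → ι-* (v J) _) ⟩
    Σ.Σʷ (λ J → η (v J) ∧ basis J)                        ∎
    where
    pointwise : CommutativeMonoid _ _
    pointwise = Pointwise.commutativeMonoid (Word d) +-commutativeMonoid

    expand : ∀ I → v I ≈ WordSum.Σʷ pointwise (λ J I → v J * δ J I) I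
    expand I = sym (trans (Σʷ-homo pointwise +-commutativeMonoid (_$ I) (λ _ _ → refl) {d} _)
      (trans (Σᴷ.Σʷ-cong {d} (λ J → *-comm (v J) (δ J I))) (Σʷ-δ TensorUnit.leftModule I v)))

  Σʷ-zero : Σ.Σʷ {d} (λ _ → η 0#) ≋ η 0#
  Σʷ-zero = Additive.zero-homo (Σʷ-additive {λ _ x → x} (λ _ → record { cong = λ p → p ; homo = λ _ _ → ≋-refl }))

  -- The operator Σ e_J ∧ ∂_J acts on ⋀^r V as multiplication by r; through it the degree appears in
  -- the commutator of X with the contraction.
  euler : ⋀ d → ⋀ d
  euler x = Σ.Σʷ (λ J → basis J ∧ ∂ J x)

  euler-additive : Additive euler
  euler-additive = Σʷ-additive (λ J → ∘-additive (∧-additive (basis J)) (∂-additive J))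

  euler-scale : ∀ k x → euler (η k ∧ x) ≋ η k ∧ euler x
  euler-scale k x = begin
    Σ.Σʷ (λ J → basis J ∧ ∂ J (η k ∧ x))    ≈⟨ Σ.Σʷ-cong {d} (λ J → ≋-trans (∧-cong ≋-refl (∂-scale J k x)) (∧-scale k _ _)) ⟩
    Σ.Σʷ (λ J → η k ∧ basis J ∧ ∂ J x)      ≈⟨ additive-Σʷ (∧-additive (η k)) {d} _ ⟨
    η k ∧ euler x                           ∎

  -- Moving ∂_J past v and then e_J past v costs two signs, which cancel. The terms in which ∂_J
  -- hits v reassemble v.
  euler-ι∧ : ∀ v x → euler (ι v ∧ x) ≋ ι v ∧ x ⊕ ι v ∧ euler x
  euler-ι∧ v x = begin
    Σ.Σʷ (λ J → basis J ∧ ∂ J (ι v ∧ x))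
      ≈⟨ Σ.Σʷ-cong {d} term ⟩
    Σ.Σʷ (λ J → (η (v J) ∧ basis J) ∧ x ⊕ ι v ∧ basis J ∧ ∂ J x)
      ≈⟨ Σ.Σʷ-∙ {d} _ _ ⟩
    Σ.Σʷ (λ J → (η (v J) ∧ basis J) ∧ x) ⊕ Σ.Σʷ (λ J → ι v ∧ basis J ∧ ∂ J x)
      ≈⟨ ⊕-cong (additive-Σʷ ∧x-additive {d} _) (additive-Σʷ (∧-additive (ι v)) {d} _) ⟨
    Σ.Σʷ (λ J → η (v J) ∧ basis J) ∧ x ⊕ ι v ∧ euler x
      ≈⟨ ⊕-cong (∧-cong (ι-expand v) ≋-refl) ≋-refl ⟨
    ι v ∧ x ⊕ ι v ∧ euler x ∎
    where
    ∧x-additive : Additive (_∧ x)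
    ∧x-additive = record { cong = λ p → ∧-cong p ≋-refl ; homo = ∧-distribʳ x }

    term : ∀ J → basis J ∧ ∂ J (ι v ∧ x) ≋ (η (v J) ∧ basis J) ∧ x ⊕ ι v ∧ basis J ∧ ∂ J x
    term J = begin
      basis J ∧ ∂ J (ι v ∧ x)                                       ≈⟨ ∧-cong ≋-refl (∂-ι∧ J v x) ⟩
      basis J ∧ (η (v J) ∧ x ⊕ ⊖ (ι v ∧ ∂ J x))                     ≈⟨ ∧-distribˡ _ _ _ ⟩
      basis J ∧ η (v J) ∧ x ⊕ basis J ∧ ⊖ (ι v ∧ ∂ J x)             ≈⟨ ⊕-cong (∧-scale _ _ _) (∧-scale _ _ _) ⟩
      η (v J) ∧ basis J ∧ x ⊕ ⊖ (basis J ∧ ι v ∧ ∂ J x)             ≈⟨ ⊕-cong (≋-sym (∧-assoc _ _ _)) (∧-cong ≋-refl (anticommute _ _ _)) ⟩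
      (η (v J) ∧ basis J) ∧ x ⊕ ⊖ ⊖ (ι v ∧ basis J ∧ ∂ J x)         ≈⟨ ⊕-cong ≋-refl (R.-‿involutive _) ⟩
      (η (v J) ∧ basis J) ∧ x ⊕ ι v ∧ basis J ∧ ∂ J x               ∎

  euler-degree : ∀ {r x} → x ∈⋀^ r → euler x ≋ r R.× x
  euler-degree {r} (∈-resp p x∈)  = ≋-trans (Additive.cong euler-additive (≋-sym p))
    (≋-trans (euler-degree x∈) (R.×-congʳ r p))
  euler-degree (∈-product []) = ≋-trans (Σ.Σʷ-cong {d} (λ J → R.zeroʳ _)) Σʷ-zero
  euler-degree {suc r} (∈-product (v ∷ vs)) = ≋-trans (euler-ι∧ v _)
    (⊕-cong ≋-refl (≋-trans (∧-cong ≋-refl (euler-degree (∈-product vs))) (Additive.·-homo (∧-additive (ι v)) r _)))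
  euler-degree {r} ∈-zero = ≋-trans (Additive.zero-homo euler-additive)
    (≋-sym (Additive.zero-homo (·-additive r)))
  euler-degree {r} (∈-sum x∈ y∈)  = ≋-trans (Additive.homo euler-additive _ _)
    (≋-trans (⊕-cong (euler-degree x∈) (euler-degree y∈)) (≋-sym (R.×-distrib-+ _ _ r)))
  euler-degree {r} (∈-scale k x∈) = ≋-trans (euler-scale k _)
    (≋-trans (∧-cong ≋-refl (euler-degree x∈)) (Additive.·-homo (∧-additive (η k)) r _))

-- The Cayley form in coordinates and its commutator with the dual contraction

module CayleyForm {c ℓ} (K : CommutativeRing c ℓ) (d : ℕ) where

  open MultilinearAlgebra K
  open CommutativeRing K hiding (zero) renaming (Carrier to 𝕂)
  open import Algebra.Properties.Ring ring using (-‿involutive)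
  open ExteriorAlgebra K
  open Contraction K d
  open Sl₂ R.+-abelianGroup using (Additive; ∘-additive; ·-additive)
  open import Algebra.Solver.CommutativeMonoid (Ring.+-commutativeMonoid (⋀-ring {d}))
    using (solve; _⊜_) renaming (_⊕_ to _:⊕_)
  open import Relation.Binary.Reasoning.Setoid (Ring.setoid (⋀-ring {d}))

  private
    τ : Fin 2 → Permutation′ 2
    τ zero       = idₚ
    τ (suc zero) = transpose zero (suc zero)

    composite : ∀ {n} → Vec (Permutation′ 2) n → Permutation′ 2
    composite = Vec.foldr (λ _ → Permutation′ 2) _∘ₚ_ idₚ

    -- `sgn` reads only the image of 0, but a transposition put in front of the composite exchanges
    -- the images of 0 and 1, so the induction follows both.
    sgn-τ : ∀ {n} (J : Word n) → let ρ = composite (Vec.map τ J) in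
            (ρ ⟨$⟩ʳ zero ≡ zero × ρ ⟨$⟩ʳ suc zero ≡ suc zero × 1# ≈ sign J) ⊎
            (ρ ⟨$⟩ʳ zero ≡ suc zero × ρ ⟨$⟩ʳ suc zero ≡ zero × - 1# ≈ sign J)
    sgn-τ []             = inj₁ (≡.refl , ≡.refl , refl)
    sgn-τ (zero     ∷ J) = sgn-τ J
    sgn-τ (suc zero ∷ J) with sgn-τ J
    ... | inj₁ (p , q , r) = inj₂ (q , p , -‿cong r)
    ... | inj₂ (p , q , r) = inj₁ (q , p , trans (sym (-‿involutive 1#)) (-‿cong r))

  -- A tuple of elements of S₂ is a word J: its images of 0 spell J and its images of 1 the
  -- complement.
  ω-expand : ω d ≋ Σ.Σʷ (λ J → η (sign J) ∧ basis J ∧ basis (complement J))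
  ω-expand = ≋-trans (Σ.foldr-words τ d _) (Σ.Σʷ-cong {d} (λ J →
    ∧-cong (η-cong (sgn≈sign J)) (∧-cong (R.reflexive (factor₀ J)) (R.reflexive (factor₁ J)))))
    where
    sgn≈sign : ∀ J → sgn (composite (Vec.map τ J)) ≈ sign J
    sgn≈sign J with sgn-τ J
    ... | inj₁ (p , q , r) rewrite p = r
    ... | inj₂ (p , q , r) rewrite p = r

    factor₀ : ∀ J → ι (⨂ (Vec.map (λ π → e (π ⟨$⟩ʳ zero)) (Vec.map τ J))) ≡ basis J
    factor₀ J = ≡.cong (ι ∘ ⨂) (≡.trans (≡.sym (Vec.map-∘ _ τ J))
      (Vec.map-cong (λ { zero → ≡.refl ; (suc zero) → ≡.refl }) J))

    factor₁ : ∀ J → ι (⨂ (Vec.map (λ π → e (π ⟨$⟩ʳ suc zero)) (Vec.map τ J))) ≡ basis (complement J)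
    factor₁ J = ≡.cong (ι ∘ ⨂) (≡.trans (≡.sym (Vec.map-∘ _ τ J)) (≡.trans
      (Vec.map-cong (λ { zero → ≡.refl ; (suc zero) → ≡.refl }) J) (Vec.map-∘ e opposite J)))

  X-additive : Additive X
  X-additive = ∧-additive (ω d)

  X-scale : ∀ k (x : ⋀ d) → X (η k ∧ x) ≋ η k ∧ X x
  X-scale k x = ∧-scale k (ω d) x

  X-expand : ∀ x → X x ≋ Σ.Σʷ (λ J → η (sign J) ∧ basis J ∧ basis (complement J) ∧ x)
  X-expand x = begin
    ω d ∧ x
      ≈⟨ ∧-cong ω-expand ≋-refl ⟩
    Σ.Σʷ (λ J → η (sign J) ∧ basis J ∧ basis (complement J)) ∧ x
      ≈⟨ Σʷ-homo R.+-commutativeMonoid R.+-commutativeMonoid (_∧ x) (∧-distribʳ x) {d} _ ⟩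
    Σ.Σʷ (λ J → (η (sign J) ∧ basis J ∧ basis (complement J)) ∧ x)
      ≈⟨ Σ.Σʷ-cong {d} (λ J → ≋-trans (∧-assoc _ _ _) (∧-cong ≋-refl (∧-assoc _ _ _))) ⟩
    Σ.Σʷ (λ J → η (sign J) ∧ basis J ∧ basis (complement J) ∧ x) ∎

  Σʷ-degree : ∀ {n r} {f : Word n → ⋀ d} → (∀ J → f J ∈⋀^ r) → Σ.Σʷ f ∈⋀^ r
  Σʷ-degree {zero}  p = p []
  Σʷ-degree {suc n} p = ∈-sum (Σʷ-degree (p ∘ (zero ∷_))) (Σʷ-degree (p ∘ (suc zero ∷_)))

  X-degree : ∀ {r x} → x ∈⋀^ r → X x ∈⋀^ (2 ℕ.+ r)
  X-degree x∈ = ∈-resp (≋-sym (X-expand _))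
    (Σʷ-degree {d} (λ J → ∈-scale (sign J) (ι∧-degree _ (ι∧-degree _ x∈))))

  -- Y₀ is, up to a scalar, the contraction with the form dual to ω
  Y₀ : ⋀ d → ⋀ d
  Y₀ x = Σ.Σʷ (λ J → η (sign J) ∧ ∂ (complement J) (∂ J x))

  Y₀-additive : Additive Y₀
  Y₀-additive = Σʷ-additive (λ J → ∘-additive (∧-additive (η (sign J)))
    (∘-additive (∂-additive (complement J)) (∂-additive J)))

  Y₀-degree : ∀ {r x} → x ∈⋀^ (2 ℕ.+ r) → Y₀ x ∈⋀^ r
  Y₀-degree x∈ = Σʷ-degree {d} (λ J → ∈-scale (sign J) (∂-degree (complement J) (∂-degree J x∈)))

  Y₀-bottom : ∀ {r x} → r ≤ 1 → x ∈⋀^ r → Y₀ x ≋ η 0#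
  Y₀-bottom r≤1 x∈ = ≋-trans (Σ.Σʷ-cong {d} (λ J → ≋-trans (∧-cong ≋-refl (∂∂≋0 r≤1 x∈)) (R.zeroʳ _))) Σʷ-zero
    where
    ∂∂≋0 : ∀ {r x I J} → r ≤ 1 → x ∈⋀^ r → ∂ I (∂ J x) ≋ η 0#
    ∂∂≋0 {I = I} {J} z≤n       x∈ = ∂-cong I (∂-degree-0 J x∈)
    ∂∂≋0 {I = I} {J} (s≤s z≤n) x∈ = ∂-degree-0 I (∂-degree J x∈)

  module _ (2∤d : ¬ (2 ∣ d)) where

    -- The vector e_J is met by ∂_J in two terms of ω: as first factor at J, and as second factor at
    -- the complement. Since d is odd the two contributions are equal, hence u twice.
    ∂-X : ∀ J x → let u = η (sign J) ∧ basis (complement J) ∧ x in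
          ∂ J (X x) ≋ (u ⊕ u) ⊕ X (∂ J x)
    ∂-X J x = begin
      ∂ J (X x)
        ≈⟨ ∂-cong J (X-expand x) ⟩
      ∂ J (Σ.Σʷ (λ I → η (sign I) ∧ basis I ∧ basis (complement I) ∧ x))
        ≈⟨ additive-Σʷ (∂-additive J) {d} _ ⟩
      Σ.Σʷ (λ I → ∂ J (η (sign I) ∧ basis I ∧ basis (complement I) ∧ x))
        ≈⟨ Σ.Σʷ-cong {d} term ⟩
      Σ.Σʷ (λ I → (η (δ I J) ∧ f I ⊕ η (δ I (complement J)) ∧ g I) ⊕ h I)
        ≈⟨ Σ.Σʷ-∙ {d} _ _ ⟩
      Σ.Σʷ (λ I → η (δ I J) ∧ f I ⊕ η (δ I (complement J)) ∧ g I) ⊕ Σ.Σʷ h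
        ≈⟨ ⊕-cong (Σ.Σʷ-∙ {d} _ _) (≋-sym (X-expand (∂ J x))) ⟩
      (Σ.Σʷ (λ I → η (δ I J) ∧ f I) ⊕ Σ.Σʷ (λ I → η (δ I (complement J)) ∧ g I)) ⊕ X (∂ J x)
        ≈⟨ ⊕-cong (⊕-cong (Σʷ-δ ⋀-leftModule J f) (Σʷ-δ ⋀-leftModule (complement J) g)) ≋-refl ⟩
      (f J ⊕ g (complement J)) ⊕ X (∂ J x)
        ≈⟨ ⊕-cong (⊕-cong ≋-refl g[J′]≋f[J]) ≋-refl ⟩
      (f J ⊕ f J) ⊕ X (∂ J x) ∎
      where
      f g h : Word d → ⋀ d
      f I = η (sign I) ∧ basis (complement I) ∧ x
      g I = η (- sign I) ∧ basis I ∧ x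
      h I = η (sign I) ∧ basis I ∧ basis (complement I) ∧ ∂ J x

      g[J′]≋f[J] : g (complement J) ≋ f J
      g[J′]≋f[J] = ∧-cong (η-cong (trans (-‿cong (sign-complement 2∤d J)) (-‿involutive _))) ≋-refl

      term : ∀ I → ∂ J (η (sign I) ∧ basis I ∧ basis (complement I) ∧ x) ≋
                   (η (δ I J) ∧ f I ⊕ η (δ I (complement J)) ∧ g I) ⊕ h I
      term I = begin
        ∂ J (η s ∧ a ∧ a′ ∧ x)
          ≈⟨ ∂-scale J s _ ⟩
        η s ∧ ∂ J (a ∧ a′ ∧ x)
          ≈⟨ ∧-cong ≋-refl (∂-ι∧ J _ _) ⟩
        η s ∧ (η (δ I J) ∧ a′ ∧ x ⊕ ⊖ (a ∧ ∂ J (a′ ∧ x)))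
          ≈⟨ ∧-cong ≋-refl (⊕-cong ≋-refl (∧-cong ≋-refl inner)) ⟩
        η s ∧ (η (δ I J) ∧ a′ ∧ x ⊕ ⊖ (η k ∧ a ∧ x ⊕ ⊖ (a ∧ a′ ∧ ∂ J x)))
          ≈⟨ ∧-cong ≋-refl (⊕-cong ≋-refl (≋-trans (∧-distribˡ _ _ _) (⊕-cong ≋-refl (R.-‿involutive _)))) ⟩
        η s ∧ (η (δ I J) ∧ a′ ∧ x ⊕ (⊖ (η k ∧ a ∧ x) ⊕ a ∧ a′ ∧ ∂ J x))
          ≈⟨ ≋-trans (∧-distribˡ _ _ _) (⊕-cong ≋-refl (∧-distribˡ _ _ _)) ⟩
        η s ∧ η (δ I J) ∧ a′ ∧ x ⊕ (η s ∧ ⊖ (η k ∧ a ∧ x) ⊕ h I)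
          ≈⟨ ⊕-cong (∧-scale _ _ _) (⊕-cong signs ≋-refl) ⟩
        η (δ I J) ∧ f I ⊕ (η k ∧ g I ⊕ h I)
          ≈⟨ ⊕-assoc _ _ _ ⟨
        (η (δ I J) ∧ f I ⊕ η k ∧ g I) ⊕ h I ∎
        where
        s k : 𝕂
        s = sign I
        k = δ I (complement J)

        a a′ : ⋀ d
        a  = basis I
        a′ = basis (complement I)

        inner : a ∧ ∂ J (a′ ∧ x) ≋ η k ∧ a ∧ x ⊕ ⊖ (a ∧ a′ ∧ ∂ J x)
        inner = begin
          a ∧ ∂ J (a′ ∧ x)                                          ≈⟨ ∧-cong ≋-refl (∂-ι∧ J _ _) ⟩
          a ∧ (η (δ (complement I) J) ∧ x ⊕ ⊖ (a′ ∧ ∂ J x))         ≈⟨ ∧-distribˡ _ _ _ ⟩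
          a ∧ η (δ (complement I) J) ∧ x ⊕ a ∧ ⊖ (a′ ∧ ∂ J x)       ≈⟨ ⊕-cong (∧-scale _ _ _) (∧-scale _ _ _) ⟩
          η (δ (complement I) J) ∧ a ∧ x ⊕ ⊖ (a ∧ a′ ∧ ∂ J x)       ≈⟨ ⊕-cong (∧-cong (η-cong (δ-complement I J)) ≋-refl) ≋-refl ⟩
          η k ∧ a ∧ x ⊕ ⊖ (a ∧ a′ ∧ ∂ J x)                          ∎

        signs : η s ∧ ⊖ (η k ∧ a ∧ x) ≋ η k ∧ g I
        signs = begin
          η s ∧ ⊖ (η k ∧ a ∧ x)       ≈⟨ ∧-scale _ _ _ ⟩
          ⊖ (η s ∧ η k ∧ a ∧ x)       ≈⟨ scale-neg _ _ ⟨
          η (- s) ∧ η k ∧ a ∧ x       ≈⟨ ∧-scale _ _ _ ⟩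
          η k ∧ g I                   ∎

    -- Let J′ be the complement of J. Up to the factor `sign J`, ∂_J′ turns the doubled term of
    -- `∂-X` into twice x - e_J′ ∧ ∂_J′ x, and commuting ∂_J′ past X adds -2 e_J ∧ ∂_J x. Summing
    -- over J yields 2 · 2^d - 4 euler.
    Y₀-X : ∀ x → let a = (2 ℕ.^ d) R.× x in
           Y₀ (X x) ≋ ((a ⊕ ⊖ euler x) ⊕ (a ⊕ ⊖ euler x)) ⊕ ((⊖ euler x ⊕ ⊖ euler x) ⊕ X (Y₀ x))
    Y₀-X x = begin
      Y₀ (X x)
        ≈⟨ Σ.Σʷ-cong {d} term ⟩
      Σ.Σʷ (λ J → (P (complement J) ⊕ P (complement J)) ⊕ ((Q J ⊕ Q J) ⊕ Z J))
        ≈⟨ ≋-trans (Σ.Σʷ-∙ {d} _ _) (⊕-cong (Σ.Σʷ-∙ {d} _ _) (≋-trans (Σ.Σʷ-∙ {d} _ _) (⊕-cong (Σ.Σʷ-∙ {d} _ _) ≋-refl))) ⟩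
      (Σ.Σʷ (P ∘ complement) ⊕ Σ.Σʷ (P ∘ complement)) ⊕ ((Σ.Σʷ Q ⊕ Σ.Σʷ Q) ⊕ Σ.Σʷ Z)
        ≈⟨ ⊕-cong (⊕-cong ΣP ΣP) (⊕-cong (⊕-cong ΣQ ΣQ) ΣZ) ⟩
      ((a ⊕ ⊖ euler x) ⊕ (a ⊕ ⊖ euler x)) ⊕ ((⊖ euler x ⊕ ⊖ euler x) ⊕ X (Y₀ x)) ∎
      where
      a : ⋀ d
      a = (2 ℕ.^ d) R.× x

      P Q Z : Word d → ⋀ d
      P J = x ⊕ ⊖ (basis J ∧ ∂ J x)
      Q J = ⊖ (basis J ∧ ∂ J x)
      Z J = η (sign J) ∧ X (∂ (complement J) (∂ J x))

      ΣQ : Σ.Σʷ Q ≋ ⊖ euler x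
      ΣQ = ≋-sym (additive-Σʷ (∧-additive (η (- 1#))) {d} _)

      ΣP : Σ.Σʷ (P ∘ complement) ≋ a ⊕ ⊖ euler x
      ΣP = ≋-trans (Σ.Σʷ-complement {d} P) (≋-trans (Σ.Σʷ-∙ {d} _ _) (⊕-cong (Σ.Σʷ-const d x) ΣQ))

      ΣZ : Σ.Σʷ Z ≋ X (Y₀ x)
      ΣZ = ≋-trans (Σ.Σʷ-cong {d} (λ J → ≋-sym (X-scale _ _))) (≋-sym (additive-Σʷ X-additive {d} _))

      unsign : ∀ J (y : ⋀ d) → η (sign J) ∧ η (sign J) ∧ y ≋ y
      unsign J y = ≋-trans (scale-scale _ _ _) (≋-trans (∧-cong (η-cong (sign² J)) ≋-refl) (∧-identityˡ _))

      ∂-basis : ∀ J y → ∂ J (basis J ∧ y) ≋ y ⊕ ⊖ (basis J ∧ ∂ J y)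
      ∂-basis J y = ≋-trans (∂-ι∧ J _ y)
        (⊕-cong (≋-trans (∧-cong (η-cong (δ-diagonal J)) ≋-refl) (∧-identityˡ _)) ≋-refl)

      term : ∀ J → η (sign J) ∧ ∂ (complement J) (∂ J (X x)) ≋
                   (P (complement J) ⊕ P (complement J)) ⊕ ((Q J ⊕ Q J) ⊕ Z J)
      term J = begin
        η s ∧ ∂ J′ (∂ J (X x))
          ≈⟨ ∧-cong ≋-refl (∂-cong J′ (∂-X J x)) ⟩
        η s ∧ ((∂ J′ u ⊕ ∂ J′ u) ⊕ ∂ J′ (X (∂ J x)))
          ≈⟨ ≋-trans (∧-distribˡ _ _ _) (⊕-cong (∧-distribˡ _ _ _) ≋-refl) ⟩
        (η s ∧ ∂ J′ u ⊕ η s ∧ ∂ J′ u) ⊕ η s ∧ ∂ J′ (X (∂ J x))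
          ≈⟨ ⊕-cong (⊕-cong left left) right ⟩
        (P J′ ⊕ P J′) ⊕ ((Q J ⊕ Q J) ⊕ Z J) ∎
        where
        s : 𝕂
        s = sign J

        J′ : Word d
        J′ = complement J

        u w : ⋀ d
        u = η s ∧ basis J′ ∧ x
        w = η (sign J′) ∧ basis (complement J′) ∧ ∂ J x

        left : η s ∧ ∂ J′ u ≋ P J′
        left = begin
          η s ∧ ∂ J′ u                        ≈⟨ ∧-cong ≋-refl (∂-scale J′ s _) ⟩
          η s ∧ η s ∧ ∂ J′ (basis J′ ∧ x)     ≈⟨ unsign J _ ⟩
          ∂ J′ (basis J′ ∧ x)                 ≈⟨ ∂-basis J′ x ⟩
          P J′                                ∎

        s·w : η s ∧ w ≋ Q J
        s·w = begin
          η s ∧ η (sign J′) ∧ basis (complement J′) ∧ ∂ J x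
            ≈⟨ ∧-cong ≋-refl (∧-cong (η-cong (sign-complement 2∤d J)) (∧-cong (R.reflexive (≡.cong basis (complement-involutive J))) ≋-refl)) ⟩
          η s ∧ η (- s) ∧ basis J ∧ ∂ J x     ≈⟨ ∧-cong ≋-refl (scale-neg s _) ⟩
          η s ∧ ⊖ (η s ∧ basis J ∧ ∂ J x)     ≈⟨ ∧-scale _ _ _ ⟩
          ⊖ (η s ∧ η s ∧ basis J ∧ ∂ J x)     ≈⟨ ∧-cong ≋-refl (unsign J _) ⟩
          ⊖ (basis J ∧ ∂ J x)                 ∎

        right : η s ∧ ∂ J′ (X (∂ J x)) ≋ (Q J ⊕ Q J) ⊕ Z J
        right = begin
          η s ∧ ∂ J′ (X (∂ J x))                        ≈⟨ ∧-cong ≋-refl (∂-X J′ (∂ J x)) ⟩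
          η s ∧ ((w ⊕ w) ⊕ X (∂ J′ (∂ J x)))            ≈⟨ ≋-trans (∧-distribˡ _ _ _) (⊕-cong (∧-distribˡ _ _ _) ≋-refl) ⟩
          (η s ∧ w ⊕ η s ∧ w) ⊕ Z J                     ≈⟨ ⊕-cong (⊕-cong s·w s·w) ≋-refl ⟩
          (Q J ⊕ Q J) ⊕ Z J                             ∎

    Y₀-commutator : ∀ {r x} → x ∈⋀^ r →
                    Y₀ (X x) ⊕ 4 R.× r R.× x ≋ X (Y₀ x) ⊕ 2 R.× (2 ℕ.^ d) R.× x
    Y₀-commutator {r} {x} x∈ = begin
      Y₀ (X x) ⊕ 4 R.× r R.× x
        ≈⟨ ⊕-cong (Y₀-X x) (R.×-congʳ 4 (≋-sym (euler-degree x∈))) ⟩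
      (((a ⊕ n) ⊕ (a ⊕ n)) ⊕ ((n ⊕ n) ⊕ z)) ⊕ (b ⊕ (b ⊕ (b ⊕ (b ⊕ η 0#))))
        -- Each of the four copies of -euler x is paired with one of the four copies of euler x.
        ≈⟨ solve 5 (λ a b n z o →
             (((a :⊕ n) :⊕ (a :⊕ n)) :⊕ ((n :⊕ n) :⊕ z)) :⊕ (b :⊕ (b :⊕ (b :⊕ (b :⊕ o)))) ⊜
             (((b :⊕ n) :⊕ (b :⊕ n)) :⊕ ((b :⊕ n) :⊕ (b :⊕ n))) :⊕ (z :⊕ (a :⊕ (a :⊕ o)))) ≋-refl a b n z (η 0#) ⟩
      (((b ⊕ n) ⊕ (b ⊕ n)) ⊕ ((b ⊕ n) ⊕ (b ⊕ n))) ⊕ (z ⊕ (a ⊕ (a ⊕ η 0#)))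
        ≈⟨ ⊕-cong (⊕-cong (⊕-cong b-b b-b) (⊕-cong b-b b-b)) ≋-refl ⟩
      ((η 0# ⊕ η 0#) ⊕ (η 0# ⊕ η 0#)) ⊕ (z ⊕ (a ⊕ (a ⊕ η 0#)))
        ≈⟨ ⊕-cong (≋-trans (⊕-cong (⊕-identityˡ _) (⊕-identityˡ _)) (⊕-identityˡ _)) ≋-refl ⟩
      η 0# ⊕ (z ⊕ (a ⊕ (a ⊕ η 0#)))
        ≈⟨ ⊕-identityˡ _ ⟩
      z ⊕ (a ⊕ (a ⊕ η 0#)) ∎
      where
      a b n z : ⋀ d
      a = (2 ℕ.^ d) R.× x
      b = euler x
      n = ⊖ euler x
      z = X (Y₀ x)

      b-b : b ⊕ n ≋ η 0#
      b-b = R.-‿inverseʳ b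

-- Vanishing above the top degree, and the sl₂-ladders in ⋀ V

module HardLefschetz {c ℓ} (K : CommutativeRing c ℓ) (d : ℕ) where

  open MultilinearAlgebra K
  open CommutativeRing K hiding (zero) renaming (Carrier to 𝕂)
  open import Algebra.Properties.Monoid.Mult +-monoid using () renaming (_×_ to _×ᴷ_)
  open ExteriorAlgebra K
  open Contraction K d
  open CayleyForm K d
  open Sl₂ R.+-abelianGroup
  open import Algebra.Properties.Group (Ring.+-group (⋀-ring {d})) using (∙-cancelʳ)
  open import Relation.Binary.Reasoning.Setoid (Ring.setoid (⋀-ring {d}))

  -- ⋀^r V = 0 for r > dim V

  Span : List (V d) → V d → Set (c ⊔ ℓ)
  Span []      v = Level.Lift (c ⊔ ℓ) (∀ I → v I ≈ 0#)
  Span (u ∷ G) v = ∃[ k ] ∃[ w ] (Span G w × (∀ I → v I ≈ k * u I + w I))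

  -- The span of the products of distinct members of G with at least r factors
  Products : List (V d) → ℕ → ⋀ d → Set (c ⊔ ℓ)
  Products []      zero    x = ∃[ k ] x ≋ η k
  Products []      (suc r) x = x ≋ η 0#
  Products (u ∷ G) r       x = ∃[ a ] ∃[ b ] (Products G r a × Products G (ℕ.pred r) b × x ≋ a ⊕ ι u ∧ b)

  Products-resp : ∀ G {r x y} → x ≋ y → Products G r x → Products G r y
  Products-resp []      {zero}  p (k , q) = k , ≋-trans (≋-sym p) q
  Products-resp []      {suc r} p q       = ≋-trans (≋-sym p) q
  Products-resp (u ∷ G) p (a , b , a∈ , b∈ , q) = a , b , a∈ , b∈ , ≋-trans (≋-sym p) q

  Products-⊕ : ∀ G {r x y} → Products G r x → Products G r y → Products G r (x ⊕ y)
  Products-⊕ []      {zero}  (k , p) (l , q) = k + l , ≋-trans (⊕-cong p q) (≋-sym (η-+ k l))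
  Products-⊕ []      {suc r} p q = ≋-trans (⊕-cong p q) (⊕-identityˡ _)
  Products-⊕ (u ∷ G) (a , b , a∈ , b∈ , p) (a′ , b′ , a′∈ , b′∈ , q) =
    a ⊕ a′ , b ⊕ b′ , Products-⊕ G a∈ a′∈ , Products-⊕ G b∈ b′∈ , (begin
      _                                 ≈⟨ ⊕-cong p q ⟩
      (a ⊕ ι u ∧ b) ⊕ (a′ ⊕ ι u ∧ b′)   ≈⟨ interchange _ _ _ _ ⟩
      (a ⊕ a′) ⊕ (ι u ∧ b ⊕ ι u ∧ b′)   ≈⟨ ⊕-cong ≋-refl (∧-distribˡ _ _ _) ⟨
      (a ⊕ a′) ⊕ ι u ∧ (b ⊕ b′)         ∎)
    where open import Algebra.Properties.CommutativeSemigroup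
                 (CommutativeMonoid.commutativeSemigroup (Ring.+-commutativeMonoid (⋀-ring {d}))) using (interchange)

  Products-scale : ∀ G k {r x} → Products G r x → Products G r (η k ∧ x)
  Products-scale []      k {zero}  (l , p) = k * l , ≋-trans (∧-cong ≋-refl p) (≋-sym (η-* k l))
  Products-scale []      k {suc r} p = ≋-trans (∧-cong ≋-refl p) (R.zeroʳ _)
  Products-scale (u ∷ G) k (a , b , a∈ , b∈ , p) =
    η k ∧ a , η k ∧ b , Products-scale G k a∈ , Products-scale G k b∈ ,
    ≋-trans (∧-cong ≋-refl p) (≋-trans (∧-distribˡ _ _ _) (⊕-cong ≋-refl (≋-sym (∧-scale k _ _))))

  Products-pred : ∀ G r {x} → Products G (suc r) x → Products G r x
  Products-pred []      zero    p = 0# , p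
  Products-pred []      (suc r) p = p
  Products-pred (u ∷ G) zero    (a , b , a∈ , b∈ , p) = a , b , Products-pred G 0 a∈ , b∈ , p
  Products-pred (u ∷ G) (suc r) (a , b , a∈ , b∈ , p) = a , b , Products-pred G (suc r) a∈ , Products-pred G r b∈ , p

  -- Split v as k u + w with w in the span of the remaining vectors. The term containing u twice
  -- vanishes and w moves past u with a sign; the rest is sorted by whether u occurs.
  Products-ι∧ : ∀ G r {v x} → Span G v → Products G r x → Products G (suc r) (ι v ∧ x)
  Products-ι∧ []      r {v} {x} (Level.lift p) _ = begin
    ι v ∧ x             ≈⟨ ∧-cong (ι-cong λ I → trans (p I) (sym (zeroˡ (v I)))) ≋-refl ⟩
    ι (λ I → 0# * v I) ∧ x ≈⟨ ∧-cong (≋-trans (ι-* 0# v) (∧-zeroˡ _)) ≋-refl ⟩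
    η 0# ∧ x            ≈⟨ ∧-zeroˡ x ⟩
    η 0#                ∎
  Products-ι∧ (u ∷ G) r {v} {x} (k , w , w∈ , p) (a , b , a∈ , b∈ , q) =
    ι w ∧ a , η k ∧ a ⊕ ⊖ (ι w ∧ b)
    , Products-ι∧ G r w∈ a∈
    , Products-⊕ G (Products-scale G k a∈) (Products-scale G (- 1#) (w∧b∈ r b∈))
    , (begin
      ι v ∧ x
        ≈⟨ ∧-cong (≋-trans (ι-cong p) (≋-trans (ι-+ _ _) (⊕-cong (ι-* k u) ≋-refl))) q ⟩
      (η k ∧ ι u ⊕ ι w) ∧ (a ⊕ ι u ∧ b)
        ≈⟨ ≋-trans (∧-distribʳ _ _ _) (⊕-cong (∧-distribˡ _ _ _) (∧-distribˡ _ _ _)) ⟩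
      ((η k ∧ ι u) ∧ a ⊕ (η k ∧ ι u) ∧ ι u ∧ b) ⊕ (ι w ∧ a ⊕ ι w ∧ ι u ∧ b)
        ≈⟨ ⊕-cong (⊕-cong (≋-trans (∧-assoc _ _ _) (≋-sym (∧-scale _ _ _))) u∧u≋0)
             (⊕-cong ≋-refl (≋-trans (anticommute _ _ _) (≋-sym (∧-scale _ _ _)))) ⟩
      (ι u ∧ η k ∧ a ⊕ η 0#) ⊕ (ι w ∧ a ⊕ ι u ∧ ⊖ (ι w ∧ b))
        ≈⟨ solve 4 (λ α o β γ → (α :⊕ o) :⊕ (β :⊕ γ) ⊜ o :⊕ (β :⊕ (α :⊕ γ))) ≋-refl _ _ _ _ ⟩
      η 0# ⊕ (ι w ∧ a ⊕ (ι u ∧ η k ∧ a ⊕ ι u ∧ ⊖ (ι w ∧ b)))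
        ≈⟨ ≋-trans (⊕-identityˡ _) (⊕-cong ≋-refl (≋-sym (∧-distribˡ _ _ _))) ⟩
      ι w ∧ a ⊕ ι u ∧ (η k ∧ a ⊕ ⊖ (ι w ∧ b)) ∎)
    where
    open import Algebra.Solver.CommutativeMonoid (Ring.+-commutativeMonoid (⋀-ring {d}))
      using (solve; _⊜_) renaming (_⊕_ to _:⊕_)

    -- For r = 0, `ℕ.pred` leaves the bound on b at 0, and the bound 1 obtained for the product is
    -- weakened to 0.
    w∧b∈ : ∀ r → Products G (ℕ.pred r) b → Products G r (ι w ∧ b)
    w∧b∈ zero    b∈ = Products-pred G 0 (Products-ι∧ G 0 w∈ b∈)
    w∧b∈ (suc r) b∈ = Products-ι∧ G r w∈ b∈

    u∧u≋0 : (η k ∧ ι u) ∧ ι u ∧ b ≋ η 0#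
    u∧u≋0 = begin
      (η k ∧ ι u) ∧ ι u ∧ b     ≈⟨ ∧-assoc _ _ _ ⟩
      η k ∧ ι u ∧ ι u ∧ b       ≈⟨ ∧-cong ≋-refl (∧-assoc _ _ _) ⟨
      η k ∧ (ι u ∧ ι u) ∧ b     ≈⟨ ∧-cong ≋-refl (≋-trans (∧-cong (alternating u) ≋-refl) (∧-zeroˡ _)) ⟩
      η k ∧ η 0#                ≈⟨ R.zeroʳ _ ⟩
      η 0#                      ∎

  -- Each member of G contributes at most one factor, so a factor is still required when G is
  -- exhausted, and there the predicate forces zero.
  Products-large : ∀ G {r x} → List.length G ℕ.< r → Products G r x → x ≋ η 0#
  Products-large []      {suc r} _       p = p
  Products-large (u ∷ G) {suc r} (s≤s h) (a , b , a∈ , b∈ , p) = ≋-trans p (≋-trans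
    (⊕-cong (Products-large G (ℕ.m≤n⇒m≤1+n h) a∈) (≋-trans (∧-cong ≋-refl (Products-large G h b∈)) (R.zeroʳ _)))
    (⊕-identityˡ _))

  private
    standard : List (V d)
    standard = List.map (λ J → δ J) (words (List.allFin 2) d)

    length-words : ∀ n → List.length (words (List.allFin 2) n) ≡ 2 ℕ.^ n
    length-words zero    = ≡.refl
    length-words (suc n) = ≡.trans (List.length-++ (List.map _ (words _ n)))
      (≡.cong₂ ℕ._+_ (≡.trans (List.length-map _ (words _ n)) (length-words n))
        (≡.trans (List.length-++ (List.map _ (words _ n)))
          (≡.cong (ℕ._+ 0) (≡.trans (List.length-map _ (words _ n)) (length-words n)))))

    standard-spans : ∀ v → Span standard v
    standard-spans v = Span-resp standard (λ I → trans (foldr-eval (words _ d) I) (expand I)) (Span-foldr (words _ d))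
      where
      sum : List (Word d) → V d
      sum []       I = 0#
      sum (J ∷ Js) I = v J * δ J I + sum Js I

      Span-resp : ∀ G {v w} → (∀ I → v I ≈ w I) → Span G v → Span G w
      Span-resp []      p (Level.lift q)  = Level.lift (λ I → trans (sym (p I)) (q I))
      Span-resp (u ∷ G) p (k , w , w∈ , q) = k , w , w∈ , λ I → trans (sym (p I)) (q I)

      Span-foldr : ∀ Js → Span (List.map (λ J → δ J) Js) (sum Js)
      Span-foldr []       = Level.lift (λ I → refl)
      Span-foldr (J ∷ Js) = v J , sum Js , Span-foldr Js , λ I → refl

      foldr-eval : ∀ Js I → sum Js I ≈ List.foldr _+_ 0# (List.map (λ J → v J * δ J I) Js)
      foldr-eval []       I = refl
      foldr-eval (J ∷ Js) I = +-congˡ (foldr-eval Js I)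

      expand : ∀ I → List.foldr _+_ 0# (List.map (λ J → v J * δ J I) (words (List.allFin 2) d)) ≈ v I
      expand I = trans (Σᴷ.foldr-words (λ i → i) d _) (trans
        (Σᴷ.Σʷ-cong {d} (λ J → trans (reflexive (≡.cong (λ J → v J * δ J I) (Vec.map-id J))) (*-comm _ _)))
        (Σʷ-δ TensorUnit.leftModule I v))

    ∈⋀⇒Products : ∀ {r} (vs : Vec (V d) r) → Products standard r (⋀-product vs)
    ∈⋀⇒Products []       = one standard
      where
      one : ∀ G → Products G 0 (η 1#)
      one []      = 1# , ≋-refl
      one (u ∷ G) = η 1# , η 0# , one G , Products-resp G (∧-zeroˡ _) (Products-scale G 0# (one G)) ,
        ≋-sym (≋-trans (⊕-cong ≋-refl (R.zeroʳ _)) (R.+-identityʳ _))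
    ∈⋀⇒Products (v ∷ vs) = Products-ι∧ standard _ (standard-spans v) (∈⋀⇒Products vs)

  -- A product of r vectors is rewritten in products of at least r distinct vectors among the 2^d
  -- coordinate ones.
  ⋀-top : ∀ {r x} → 2 ℕ.^ d ℕ.< r → x ∈⋀^ r → x ≋ η 0#
  ⋀-top h (∈-resp p x∈)  = ≋-trans (≋-sym p) (⋀-top h x∈)
  ⋀-top h (∈-product vs) = Products-large standard
    (≡.subst (ℕ._< _) (≡.sym (≡.trans (List.length-map _ (words _ d)) (length-words d))) h) (∈⋀⇒Products vs)
  ⋀-top h ∈-zero         = ≋-refl
  ⋀-top h (∈-sum x∈ y∈)  = ≋-trans (⊕-cong (⋀-top h x∈) (⋀-top h y∈)) (⊕-identityˡ _)
  ⋀-top h (∈-scale k x∈) = ≋-trans (∧-cong ≋-refl (⋀-top h x∈)) (R.zeroʳ _)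

  module _ (2∤d : ¬ (2 ∣ d)) (invert : ∀ n → ∃[ k ] (suc n ×ᴷ 1#) * k ≈ 1#) where

    ×-scale : ∀ n x → n R.× x ≋ η (n ×ᴷ 1#) ∧ x
    ×-scale zero    x = ≋-sym (∧-zeroˡ x)
    ×-scale (suc n) x = begin
      x ⊕ n R.× x                   ≈⟨ ⊕-cong (≋-sym (∧-identityˡ x)) (×-scale n x) ⟩
      η 1# ∧ x ⊕ η (n ×ᴷ 1#) ∧ x    ≈⟨ ∧-distribʳ _ _ _ ⟨
      (η 1# ⊕ η (n ×ᴷ 1#)) ∧ x      ≈⟨ ∧-cong (η-+ _ _) ≋-refl ⟨
      η (suc n ×ᴷ 1#) ∧ x           ∎

    [1/1+_] : ℕ → 𝕂
    [1/1+ n ] = proj₁ (invert n)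

    ×-inverse : ∀ n x → suc n R.× (η [1/1+ n ] ∧ x) ≋ x
    ×-inverse n x = begin
      suc n R.× (η [1/1+ n ] ∧ x)             ≈⟨ ×-scale (suc n) _ ⟩
      η (suc n ×ᴷ 1#) ∧ η [1/1+ n ] ∧ x       ≈⟨ scale-scale _ _ _ ⟩
      η ((suc n ×ᴷ 1#) * [1/1+ n ]) ∧ x       ≈⟨ ∧-cong (η-cong (proj₂ (invert n))) ≋-refl ⟩
      η 1# ∧ x                              ≈⟨ ∧-identityˡ x ⟩
      x                                     ∎

    inverse-× : ∀ n x → η [1/1+ n ] ∧ (suc n R.× x) ≋ x
    inverse-× n x = ≋-trans (·-homo (∧-additive (η [1/1+ n ])) (suc n) x) (×-inverse n x)

    -- `[1/1+ 3 ]` is 1/4. Both ω and Y₀ run over each complementary pair of words twice, so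
    -- [Y₀ , X] = 4 (N - r) on ⋀^r V.
    Y : ⋀ d → ⋀ d
    Y x = η [1/1+ 3 ] ∧ Y₀ x

    -- Each parity p of the degree has its own ladder; i counts the steps of size two from degree p,
    -- and L is its length.
    Level-⋀ : ℕ → ℕ → ℕ → ℕ → ⋀ d → Set (c ⊔ ℓ)
    Level-⋀ p L i j x = (i ℕ.+ j ≡ L) × x ∈⋀^ (p ℕ.+ 2 ℕ.* i)

    -- The second hypothesis says N = p + L. The ladder then runs from degree p to 2^d - p, and N -
    -- r = j - i in degree r = p + 2i.
    ladder : ∀ {p L} → p ≤ 1 → 2 ℕ.^ d ≡ 2 ℕ.* (p ℕ.+ L) → Ladder (Level-⋀ p L) X Y
    ladder {p} {L} p≤1 dim = record
      { P-resp      = λ eq (s , x∈) → s , ∈-resp eq x∈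
      ; P-0         = λ (s , _) → s , ∈-zero
      ; P-+         = λ (s , x∈) (_ , y∈) → s , ∈-sum x∈ y∈
      ; P-neg       = λ (s , x∈) → s , ∈-scale (- 1#) x∈
      ; divide      = λ n {x = x} (s , x∈) → η [1/1+ n ] ∧ x , (s , ∈-scale _ x∈) , ×-inverse n x
      ; torsionFree = λ n {x} eq → ≋-trans (≋-sym (inverse-× n x)) (≋-trans (∧-cong ≋-refl eq) (R.zeroʳ _))
      ; X-additive  = X-additive
      ; Y-additive  = ∘-additive (∧-additive _) Y₀-additive
      ; X-maps      = λ {i} {j} {x} (s , x∈) → ≡.trans (≡.sym (ℕ.+-suc i j)) s
                    , ≡.subst (X x ∈⋀^_) (≡.sym (step p i)) (X-degree x∈)
      ; Y-maps      = λ {i} {j} {x} (s , x∈) → ≡.trans (ℕ.+-suc i j) s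
                    , ∈-scale _ (Y₀-degree (≡.subst (x ∈⋀^_) (step p i) x∈))
      ; X-top       = λ {i} (s , x∈) → ⋀-top (top i s) (X-degree x∈)
      ; Y-bottom    = λ (s , x∈) → ≋-trans
          (∧-cong ≋-refl (Y₀-bottom (≡.subst (_≤ 1) (≡.sym (ℕ.+-identityʳ p)) p≤1) x∈)) (R.zeroʳ _)
      ; commutator  = λ {i} {j} {x} (s , x∈) → commute i j x s x∈
      }
      where
      open ℕ-Solver.+-*-Solver using (_:+_; _:*_; _:=_; con) renaming (solve to ℕ-solve)

      step : ∀ p i → p ℕ.+ 2 ℕ.* suc i ≡ 2 ℕ.+ (p ℕ.+ 2 ℕ.* i)
      step = ℕ-solve 2 (λ p i → p :+ con 2 :* (con 1 :+ i) := con 2 :+ (p :+ con 2 :* i)) ≡.refl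

      -- At the top the degree is 2^d - p, and p is at most 1, so a further step of two exceeds 2^d.
      top : ∀ i → i ℕ.+ 0 ≡ L → 2 ℕ.^ d ℕ.< 2 ℕ.+ (p ℕ.+ 2 ℕ.* i)
      top i i+0≡L = ≡.subst (ℕ._< 2 ℕ.+ (p ℕ.+ 2 ℕ.* i))
        (≡.sym (≡.trans dim (≡.trans (≡.cong (λ L → 2 ℕ.* (p ℕ.+ L)) (≡.trans (≡.sym i+0≡L) (ℕ.+-identityʳ i)))
          (ℕ-solve 2 (λ p i → con 2 :* (p :+ i) := p :+ (p :+ con 2 :* i)) ≡.refl p i))))
        (ℕ.+-monoˡ-≤ (p ℕ.+ 2 ℕ.* i) (s≤s p≤1))

      commute : ∀ i j x → i ℕ.+ j ≡ L → x ∈⋀^ (p ℕ.+ 2 ℕ.* i) → Y (X x) ⊕ i R.× x ≋ X (Y x) ⊕ j R.× x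
      commute i j x ≡.refl x∈ = begin
        Y (X x) ⊕ i R.× x                         ≈⟨ quarter (Y₀ (X x)) i ⟨
        η [1/1+ 3 ] ∧ (Y₀ (X x) ⊕ 4 R.× i R.× x)    ≈⟨ ∧-cong ≋-refl commute₀ ⟩
        η [1/1+ 3 ] ∧ (X (Y₀ x) ⊕ 4 R.× j R.× x)    ≈⟨ quarter (X (Y₀ x)) j ⟩
        η [1/1+ 3 ] ∧ X (Y₀ x) ⊕ j R.× x            ≈⟨ ⊕-cong (X-scale _ _) ≋-refl ⟨
        X (Y x) ⊕ j R.× x                         ∎
        where
        quarter : ∀ y i → η [1/1+ 3 ] ∧ (y ⊕ 4 R.× i R.× x) ≋ η [1/1+ 3 ] ∧ y ⊕ i R.× x
        quarter y i = ≋-trans (∧-distribˡ _ _ _) (⊕-cong ≋-refl (inverse-× 3 (i R.× x)))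

        shift : ∀ y i k n → k ≡ 4 ℕ.* i ℕ.+ n → y ⊕ k R.× x ≋ (y ⊕ 4 R.× i R.× x) ⊕ n R.× x
        shift y i k n k≡ = begin
          y ⊕ k R.× x                           ≈⟨ ⊕-cong ≋-refl (≋-trans (R.×-congˡ k≡) (R.×-homo-+ x (4 ℕ.* i) n)) ⟩
          y ⊕ ((4 ℕ.* i) R.× x ⊕ n R.× x)       ≈⟨ ⊕-cong ≋-refl (⊕-cong (R.×-assocˡ x 4 i) ≋-refl) ⟨
          y ⊕ (4 R.× i R.× x ⊕ n R.× x)         ≈⟨ ⊕-assoc _ _ _ ⟨
          (y ⊕ 4 R.× i R.× x) ⊕ n R.× x         ∎

        commute₀ : Y₀ (X x) ⊕ 4 R.× i R.× x ≋ X (Y₀ x) ⊕ 4 R.× j R.× x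
        -- Both coefficients contain 4(p + i), since 4r = 4i + 4(p + i) and 2 · 2^d = 4j + 4(p + i);
        -- it is added here and cancelled.
        commute₀ = ∙-cancelʳ ((4 ℕ.* (p ℕ.+ i)) R.× x) _ _ (begin
          (Y₀ (X x) ⊕ 4 R.× i R.× x) ⊕ (4 ℕ.* (p ℕ.+ i)) R.× x
            ≈⟨ shift (Y₀ (X x)) i (4 ℕ.* (p ℕ.+ 2 ℕ.* i)) (4 ℕ.* (p ℕ.+ i))
                 (ℕ-solve 2 (λ p i → con 4 :* (p :+ con 2 :* i) := con 4 :* i :+ con 4 :* (p :+ i)) ≡.refl p i) ⟨
          Y₀ (X x) ⊕ (4 ℕ.* (p ℕ.+ 2 ℕ.* i)) R.× x
            ≈⟨ ⊕-cong ≋-refl (R.×-assocˡ x 4 (p ℕ.+ 2 ℕ.* i)) ⟨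
          Y₀ (X x) ⊕ 4 R.× (p ℕ.+ 2 ℕ.* i) R.× x
            ≈⟨ Y₀-commutator 2∤d x∈ ⟩
          X (Y₀ x) ⊕ 2 R.× (2 ℕ.^ d) R.× x
            ≈⟨ ⊕-cong ≋-refl (R.×-assocˡ x 2 (2 ℕ.^ d)) ⟩
          X (Y₀ x) ⊕ (2 ℕ.* 2 ℕ.^ d) R.× x
            ≈⟨ shift (X (Y₀ x)) j _ (4 ℕ.* (p ℕ.+ i)) (≡.trans (≡.cong (2 ℕ.*_) dim)
                 (ℕ-solve 3 (λ p i j → con 2 :* (con 2 :* (p :+ (i :+ j))) := con 4 :* j :+ con 4 :* (p :+ i)) ≡.refl p i j)) ⟩
          (X (Y₀ x) ⊕ 4 R.× j R.× x) ⊕ (4 ℕ.* (p ℕ.+ i)) R.× x ∎)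

    -- Write r = p + 2i with p the parity of r. In the ladder of length 2i + ℓ, degrees r and r + 2ℓ
    -- sit at the mirror positions (i , i + ℓ) and (i + ℓ , i).
    hardLefschetz : ∀ r ℓ → 2 ℕ.^ d ≡ 2 ℕ.* (r ℕ.+ ℓ) →
                    Bijective (_∈⋀^ r) (_∈⋀^ (r ℕ.+ 2 ℕ.* ℓ)) (iterate X ℓ)
    hardLefschetz r l dim = record
      { maps       = λ {x} x∈ → ≡.subst (iterate X l x ∈⋀^_) upper (proj₂ (maps B (lift x∈)))
      ; kernel     = λ x∈ → kernel B (lift x∈)
      ; surjective = λ {y} y∈ →
          let x , (_ , x∈) , eq = surjective B (ℕ.+-comm (i ℕ.+ l) i , ≡.subst (y ∈⋀^_) (≡.sym upper) y∈)
          in x , ≡.subst (x ∈⋀^_) (≡.sym lower) x∈ , eq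
      }
      where
      open ℕ-Solver.+-*-Solver using (_:+_; _:*_; _:=_; con) renaming (solve to ℕ-solve)
      open Bijective
      p i : ℕ
      p = r % 2
      i = r / 2

      lower : r ≡ p ℕ.+ 2 ℕ.* i
      lower = ≡.trans (m≡m%n+[m/n]*n r 2) (≡.cong (p ℕ.+_) (ℕ.*-comm i 2))

      upper : p ℕ.+ 2 ℕ.* (i ℕ.+ l) ≡ r ℕ.+ 2 ℕ.* l
      upper = ≡.trans (ℕ-solve 3 (λ p i l → p :+ con 2 :* (i :+ l) := p :+ con 2 :* i :+ con 2 :* l) ≡.refl p i l)
        (≡.cong (ℕ._+ 2 ℕ.* l) (≡.sym lower))

      B : Bijective (Level-⋀ p (i ℕ.+ (i ℕ.+ l)) i (i ℕ.+ l)) (Level-⋀ p (i ℕ.+ (i ℕ.+ l)) (i ℕ.+ l) i) (iterate X l)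
      B = lefschetz (ladder (ℕ.s≤s⁻¹ (m%n<n r 2)) (≡.trans dim (≡.cong (2 ℕ.*_) (≡.trans (≡.cong (ℕ._+ l) lower)
            (ℕ-solve 3 (λ p i l → p :+ con 2 :* i :+ l := p :+ (i :+ (i :+ l))) ≡.refl p i l))))) i l

      lift : ∀ {x} → x ∈⋀^ r → Level-⋀ p (i ℕ.+ (i ℕ.+ l)) i (i ℕ.+ l) x
      lift {x} x∈ = ≡.refl , ≡.subst (x ∈⋀^_) lower x∈

-- Equivariance of the Cayley form and transport of weights

module Equivariance {c ℓ} (K : CommutativeRing c ℓ) (d : ℕ) where

  open MultilinearAlgebra K
  open CommutativeRing K hiding (zero) renaming (Carrier to 𝕂)
  open import Algebra.Properties.Ring ring using (-‿distribˡ-*; -‿distribʳ-*; -0#≈0#; ⁻¹-anti-homo‿-)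
  open import Algebra.Definitions.RawSemiring (Semiring.rawSemiring semiring) using (_^_)
  open import Algebra.Properties.CommutativeSemigroup *-commutativeSemigroup using (x∙yz≈y∙xz)
  open import Algebra.Solver.CommutativeMonoid *-commutativeMonoid using (solve; _⊜_) renaming (_⊕_ to _:*_)
  open ExteriorAlgebra K
  open Contraction K d
  open CayleyForm K d
  open Sl₂ R.+-abelianGroup using (Additive; iterate-additive)

  entry : ∀ {n} → Vec Matrix n → Word n → Word n → 𝕂
  entry gs I = ⨂ (Vec.zipWith _$_ gs I)

  ▹-expand : ∀ {n} (gs : Vec Matrix n) t I → (gs ▹ t) I ≈ Σᴷ.Σʷ (λ J → entry gs I J * t J)
  ▹-expand {n} gs t I = trans (Σᴷ.foldr-words (λ i → i) n _)
    (Σᴷ.Σʷ-cong {n} (λ J → reflexive (≡.cong (λ J → entry gs I J * t J) (Vec.map-id J))))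

  ▹-cong : ∀ {n} (gs : Vec Matrix n) {u v} → (∀ I → u I ≈ v I) → ∀ I → (gs ▹ u) I ≈ (gs ▹ v) I
  ▹-cong {n} gs p I = trans (▹-expand gs _ I)
    (trans (Σᴷ.Σʷ-cong {n} (λ J → *-congˡ (p J))) (sym (▹-expand gs _ I)))

  ▹-+ : ∀ {n} (gs : Vec Matrix n) u v I → (gs ▹ (λ J → u J + v J)) I ≈ (gs ▹ u) I + (gs ▹ v) I
  ▹-+ {n} gs u v I = trans (▹-expand gs _ I)
    (trans (Σᴷ.Σʷ-cong {n} (λ J → distribˡ _ _ _))
    (trans (Σᴷ.Σʷ-∙ {n} _ _) (sym (+-cong (▹-expand gs u I) (▹-expand gs v I)))))

  Σᴷ-*ˡ : ∀ {n} k (f : Word n → 𝕂) → Σᴷ.Σʷ (λ J → k * f J) ≈ k * Σᴷ.Σʷ f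
  Σᴷ-*ˡ k f = sym (Σʷ-homo +-commutativeMonoid +-commutativeMonoid (k *_) (distribˡ k) f)

  ▹-* : ∀ {n} (gs : Vec Matrix n) k v I → (gs ▹ (λ J → k * v J)) I ≈ k * (gs ▹ v) I
  ▹-* {n} gs k v I = trans (▹-expand gs _ I)
    (trans (Σᴷ.Σʷ-cong {n} (λ J → x∙yz≈y∙xz _ _ _))
    (trans (Σᴷ-*ˡ {n} k _) (*-congˡ (sym (▹-expand gs v I)))))

  act-cong : ∀ (gs : Vec Matrix d) {x y} → x ≋ y → act gs x ≋ act gs y
  act-cong gs ≋-refl             = ≋-refl
  act-cong gs (≋-sym p)          = ≋-sym (act-cong gs p)
  act-cong gs (≋-trans p q)      = ≋-trans (act-cong gs p) (act-cong gs q)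
  act-cong gs (η-cong p)         = η-cong p
  act-cong gs (ι-cong p)         = ι-cong (▹-cong gs p)
  act-cong gs (⊕-cong p q)       = ⊕-cong (act-cong gs p) (act-cong gs q)
  act-cong gs (∧-cong p q)       = ∧-cong (act-cong gs p) (act-cong gs q)
  act-cong gs (⊕-assoc x y z)    = ⊕-assoc _ _ _
  act-cong gs (⊕-comm x y)       = ⊕-comm _ _
  act-cong gs (⊕-identityˡ x)    = ⊕-identityˡ _
  act-cong gs (∧-assoc x y z)    = ∧-assoc _ _ _
  act-cong gs (∧-identityˡ x)    = ∧-identityˡ _
  act-cong gs (∧-zeroˡ x)        = ∧-zeroˡ _
  act-cong gs (∧-distribˡ x y z) = ∧-distribˡ _ _ _
  act-cong gs (∧-distribʳ x y z) = ∧-distribʳ _ _ _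
  act-cong gs (η-+ k l)          = η-+ k l
  act-cong gs (η-* k l)          = η-* k l
  act-cong gs (η-central k x)    = η-central k _
  act-cong gs (ι-+ u v)          = ≋-trans (ι-cong (▹-+ gs u v)) (ι-+ _ _)
  act-cong gs (ι-* k v)          = ≋-trans (ι-cong (▹-* gs k v)) (ι-* k _)
  act-cong gs (alternating v)    = alternating (gs ▹ v)

  act-degree : ∀ (gs : Vec Matrix d) {r x} → x ∈⋀^ r → act gs x ∈⋀^ r
  act-degree gs (∈-resp p x∈)        = ∈-resp (act-cong gs p) (act-degree gs x∈)
  act-degree gs (∈-product [])       = ∈-product []
  act-degree gs (∈-product (v ∷ vs)) = ι∧-degree (gs ▹ v) (act-degree gs (∈-product vs))
  act-degree gs ∈-zero               = ∈-zero
  act-degree gs (∈-sum x∈ y∈)        = ∈-sum (act-degree gs x∈) (act-degree gs y∈)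
  act-degree gs (∈-scale k x∈)       = ∈-scale k (act-degree gs x∈)

  act-basis : ∀ (gs : Vec Matrix d) J → act gs (basis J) ≋ Σ.Σʷ (λ I → η (entry gs I J) ∧ basis I)
  act-basis gs J = ≋-trans (ι-expand (gs ▹ δ J)) (Σ.Σʷ-cong {d} (λ I → ∧-cong (η-cong (column I)) ≋-refl))
    where
    column : ∀ I → (gs ▹ δ J) I ≈ entry gs I J
    column I = trans (▹-expand gs (δ J) I)
      (trans (Σᴷ.Σʷ-cong {d} (λ L → trans (*-comm _ _) (*-congʳ (δ-sym J L))))
      (Σʷ-δ TensorUnit.leftModule J (entry gs I)))

  -- The determinant formed by rows i and k of g, in this order.
  minor : Matrix → Fin 2 → Fin 2 → 𝕂
  minor g i k = g i zero * g k (suc zero) - g i (suc zero) * g k zero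

  det : ∀ {n} → Vec Matrix n → 𝕂
  det []       = 1#
  det (g ∷ gs) = minor g zero (suc zero) * det gs

  -- The form ω is the tensor product of d determinants, so its coefficient
  -- matrix sign I · δ I′ L is multiplied by det gs.
  form-invariant : ∀ {n} (gs : Vec Matrix n) (I L : Word n) →
    Σᴷ.Σʷ (λ J → sign J * (entry gs I J * entry gs L (complement J))) ≈
    det gs * (sign I * δ (complement I) L)
  form-invariant []       []      []      = refl
  form-invariant {suc n} (g ∷ gs) (i ∷ I) (k ∷ L) = begin
    Σᴷ.Σʷ (λ J → sign J * ((g i zero * G J) * (g k (suc zero) * G′ J))) +
    Σᴷ.Σʷ (λ J → - sign J * ((g i (suc zero) * G J) * (g k zero * G′ J)))
      ≈⟨ +-cong (Σᴷ.Σʷ-cong {n} (λ J → factor _ _ _ _ _))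
                (Σᴷ.Σʷ-cong {n} (λ J → trans (sym (-‿distribˡ-* _ _))
                  (trans (-‿cong (factor _ _ _ _ _)) (-‿distribˡ-* _ _)))) ⟩
    Σᴷ.Σʷ (λ J → (g i zero * g k (suc zero)) * (sign J * (G J * G′ J))) +
    Σᴷ.Σʷ (λ J → (- (g i (suc zero) * g k zero)) * (sign J * (G J * G′ J)))
      ≈⟨ +-cong (Σᴷ-*ˡ {n} _ _) (Σᴷ-*ˡ {n} _ _) ⟩
    (g i zero * g k (suc zero)) * Σᴷ.Σʷ (λ J → sign J * (G J * G′ J)) +
    (- (g i (suc zero) * g k zero)) * Σᴷ.Σʷ (λ J → sign J * (G J * G′ J))
      ≈⟨ distribʳ _ _ _ ⟨
    minor g i k * Σᴷ.Σʷ (λ J → sign J * (G J * G′ J))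
      ≈⟨ *-congˡ (form-invariant gs I L) ⟩
    minor g i k * (det gs * (sign I * δ (complement I) L))
      ≈⟨ letters i k ⟩
    det (g ∷ gs) * (sign (i ∷ I) * δ (complement (i ∷ I)) (k ∷ L)) ∎
    where
    open import Relation.Binary.Reasoning.Setoid setoid

    G G′ : Word n → 𝕂
    G  J = entry gs I J
    G′ J = entry gs L (complement J)

    factor : ∀ s a x b y → s * ((a * x) * (b * y)) ≈ (a * b) * (s * (x * y))
    factor = solve 5 (λ s a x b y → s :* ((a :* x) :* (b :* y)) ⊜ (a :* b) :* (s :* (x :* y))) refl

    minor-diagonal : ∀ i → minor g i i ≈ 0#
    minor-diagonal i = trans (+-congˡ (-‿cong (*-comm _ _))) (-‿inverseʳ _)

    minor-antisym : minor g (suc zero) zero ≈ - minor g zero (suc zero)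
    minor-antisym = trans (+-cong (*-comm _ _) (-‿cong (*-comm _ _))) (sym (⁻¹-anti-homo‿- _ _))

    vanish : ∀ {a b x y z} → a ≈ 0# → a * x ≈ b * (y * (0# * z))
    vanish a≈0 = trans (trans (*-congʳ a≈0) (zeroˡ _))
      (sym (trans (*-congˡ (trans (*-congˡ (zeroˡ _)) (zeroʳ _))) (zeroʳ _)))

    -- Equal rows give zero on both sides; exchanged rows give the sign contributed by the letter
    -- `suc zero`.
    letters : ∀ i k → minor g i k * (det gs * (sign I * δ (complement I) L)) ≈
                      det (g ∷ gs) * (sign (i ∷ I) * δ (complement (i ∷ I)) (k ∷ L))
    letters zero       zero       = vanish (minor-diagonal zero)
    letters zero       (suc zero) = trans (sym (*-assoc _ _ _)) (*-congˡ (*-congˡ (sym (*-identityˡ _))))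
    letters (suc zero) zero       = begin
      minor g (suc zero) zero * (det gs * (sign I * δ (complement I) L))    ≈⟨ *-congʳ minor-antisym ⟩
      - m * (det gs * (sign I * δ (complement I) L))                        ≈⟨ *-assoc _ _ _ ⟨
      (- m * det gs) * (sign I * δ (complement I) L)                        ≈⟨ *-congʳ (-‿distribˡ-* _ _) ⟨
      - (m * det gs) * (sign I * δ (complement I) L)                        ≈⟨ -‿distribˡ-* _ _ ⟨
      - (m * det gs * (sign I * δ (complement I) L))                        ≈⟨ -‿distribʳ-* _ _ ⟩
      m * det gs * - (sign I * δ (complement I) L)                          ≈⟨ *-congˡ (-‿distribˡ-* _ _) ⟩
      m * det gs * (- sign I * δ (complement I) L)                          ≈⟨ *-congˡ (*-congˡ (*-identityˡ _)) ⟨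
      m * det gs * (- sign I * (1# * δ (complement I) L))                   ∎
      where
      m : 𝕂
      m = minor g zero (suc zero)
    letters (suc zero) (suc zero) = vanish (minor-diagonal (suc zero))

  open import Relation.Binary.Reasoning.Setoid (Ring.setoid (⋀-ring {d}))

  -- Expanding both factors of each term gives a triple sum over J, I and L. Summing over J first
  -- leaves, by `form-invariant`, det gs times the coefficient matrix of ω, whose δ removes the sum
  -- over L.
  act-ω : ∀ (gs : Vec Matrix d) → act gs (ω d) ≋ η (det gs) ∧ ω d
  act-ω gs = begin
    act gs (ω d)
      ≈⟨ act-cong gs ω-expand ⟩
    act gs (Σ.Σʷ (λ J → η (sign J) ∧ basis J ∧ basis (complement J)))
      ≈⟨ additive-Σʷ act-additive {d} _ ⟩
    Σ.Σʷ (λ J → η (sign J) ∧ act gs (basis J) ∧ act gs (basis (complement J)))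
      ≈⟨ Σ.Σʷ-cong {d} term ⟩
    Σ.Σʷ (λ J → Σ.Σʷ (λ I → Σ.Σʷ (λ L → η (C I L J) ∧ B I L)))
      ≈⟨ ≋-trans (Σ.Σʷ-swap {d} {d} _) (Σ.Σʷ-cong {d} (λ I → Σ.Σʷ-swap {d} {d} _)) ⟩
    Σ.Σʷ (λ I → Σ.Σʷ (λ L → Σ.Σʷ (λ J → η (C I L J) ∧ B I L)))
      ≈⟨ Σ.Σʷ-cong {d} (λ I → Σ.Σʷ-cong {d} (λ L → coefficient I L)) ⟩
    Σ.Σʷ (λ I → Σ.Σʷ (λ L → η (δ L (complement I)) ∧ η (det gs) ∧ η (sign I) ∧ B I L))
      ≈⟨ Σ.Σʷ-cong {d} (λ I → Σʷ-δ ⋀-leftModule (complement I) (λ L → η (det gs) ∧ η (sign I) ∧ B I L)) ⟩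
    Σ.Σʷ (λ I → η (det gs) ∧ η (sign I) ∧ basis I ∧ basis (complement I))
      ≈⟨ additive-Σʷ (∧-additive (η (det gs))) {d} _ ⟨
    η (det gs) ∧ Σ.Σʷ (λ I → η (sign I) ∧ basis I ∧ basis (complement I))
      ≈⟨ ∧-cong ≋-refl ω-expand ⟨
    η (det gs) ∧ ω d ∎
    where
    act-additive : Additive (act gs)
    act-additive = record { cong = act-cong gs ; homo = λ _ _ → ≋-refl }

    B : Word d → Word d → ⋀ d
    B I L = basis I ∧ basis L

    C : Word d → Word d → Word d → 𝕂
    C I L J = sign J * (entry gs I J * entry gs L (complement J))

    scale-pair : ∀ s k l (x y : ⋀ d) → η s ∧ (η k ∧ x) ∧ η l ∧ y ≋ η (s * (k * l)) ∧ x ∧ y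
    scale-pair s k l x y = begin
      η s ∧ (η k ∧ x) ∧ η l ∧ y     ≈⟨ ∧-cong ≋-refl (≋-trans (∧-assoc _ _ _) (∧-cong ≋-refl (∧-scale _ _ _))) ⟩
      η s ∧ η k ∧ η l ∧ x ∧ y       ≈⟨ ∧-cong ≋-refl (scale-scale _ _ _) ⟩
      η s ∧ η (k * l) ∧ x ∧ y       ≈⟨ scale-scale _ _ _ ⟩
      η (s * (k * l)) ∧ x ∧ y       ∎

    term : ∀ J → η (sign J) ∧ act gs (basis J) ∧ act gs (basis (complement J)) ≋
                 Σ.Σʷ (λ I → Σ.Σʷ (λ L → η (C I L J) ∧ B I L))
    term J = begin
      η (sign J) ∧ act gs (basis J) ∧ act gs (basis (complement J))
        ≈⟨ ∧-cong ≋-refl (∧-cong (act-basis gs J) (act-basis gs (complement J))) ⟩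
      η (sign J) ∧ Σ.Σʷ f ∧ Σ.Σʷ g
        ≈⟨ ∧-cong ≋-refl (Σʷ-homo R.+-commutativeMonoid R.+-commutativeMonoid (_∧ Σ.Σʷ g) (∧-distribʳ (Σ.Σʷ g)) {d} f) ⟩
      η (sign J) ∧ Σ.Σʷ (λ I → f I ∧ Σ.Σʷ g)
        ≈⟨ additive-Σʷ (∧-additive (η (sign J))) {d} _ ⟩
      Σ.Σʷ (λ I → η (sign J) ∧ f I ∧ Σ.Σʷ g)
        ≈⟨ Σ.Σʷ-cong {d} (λ I → ≋-trans (∧-cong ≋-refl (additive-Σʷ (∧-additive (f I)) {d} g)) (additive-Σʷ (∧-additive (η (sign J))) {d} _)) ⟩
      Σ.Σʷ (λ I → Σ.Σʷ (λ L → η (sign J) ∧ f I ∧ g L))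
        ≈⟨ Σ.Σʷ-cong {d} (λ I → Σ.Σʷ-cong {d} (λ L → scale-pair _ _ _ _ _)) ⟩
      Σ.Σʷ (λ I → Σ.Σʷ (λ L → η (C I L J) ∧ B I L)) ∎
      where
      f g : Word d → ⋀ d
      f I = η (entry gs I J) ∧ basis I
      g L = η (entry gs L (complement J)) ∧ basis L

    coefficient : ∀ I L → Σ.Σʷ (λ J → η (C I L J) ∧ B I L) ≋
                          η (δ L (complement I)) ∧ η (det gs) ∧ η (sign I) ∧ B I L
    coefficient I L = begin
      Σ.Σʷ (λ J → η (C I L J) ∧ B I L)
        ≈⟨ Σʷ-homo +-commutativeMonoid R.+-commutativeMonoid (λ k → η k ∧ B I L)
             (λ k l → ≋-trans (∧-cong (η-+ k l) ≋-refl) (∧-distribʳ _ _ _)) {d} (C I L) ⟨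
      η (Σᴷ.Σʷ (C I L)) ∧ B I L
        ≈⟨ ∧-cong (η-cong (form-invariant gs I L)) ≋-refl ⟩
      η (det gs * (sign I * δ (complement I) L)) ∧ B I L
        ≈⟨ ∧-cong (η-cong (trans (*-congˡ (*-congˡ (δ-sym (complement I) L)))
             (solve 3 (λ a b c → a :* (b :* c) ⊜ c :* (a :* b)) refl _ _ _))) ≋-refl ⟩
      η (δ L (complement I) * (det gs * sign I)) ∧ B I L
        ≈⟨ ≋-trans (∧-cong ≋-refl (scale-scale _ _ _)) (scale-scale _ _ _) ⟨
      η (δ L (complement I)) ∧ η (det gs) ∧ η (sign I) ∧ B I L ∎

  act-X^ : ∀ (gs : Vec Matrix d) n x → act gs (iterate X n x) ≋ η (det gs ^ n) ∧ iterate X n (act gs x)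
  act-X^ gs zero    x = ≋-sym (∧-identityˡ _)
  act-X^ gs (suc n) x = begin
    act gs (ω d) ∧ act gs (iterate X n x)                           ≈⟨ ∧-cong (act-ω gs) (act-X^ gs n x) ⟩
    (η D ∧ ω d) ∧ η (D ^ n) ∧ iterate X n (act gs x)                ≈⟨ ∧-assoc _ _ _ ⟩
    η D ∧ ω d ∧ η (D ^ n) ∧ iterate X n (act gs x)                  ≈⟨ ∧-cong ≋-refl (∧-scale _ _ _) ⟩
    η D ∧ η (D ^ n) ∧ iterate X (suc n) (act gs x)                  ≈⟨ scale-scale _ _ _ ⟩
    η (D ^ suc n) ∧ iterate X (suc n) (act gs x)                    ∎
    where
    D : 𝕂
    D = det gs

  X^-scale : ∀ n k (x : ⋀ d) → iterate X n (η k ∧ x) ≋ η k ∧ iterate X n x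
  X^-scale zero    k x = ≋-refl
  X^-scale (suc n) k x = ≋-trans (∧-cong ≋-refl (X^-scale n k x)) (X-scale k _)

  minor-diag : ∀ a → minor (diag a) zero (suc zero) ≈ val (a zero) * val (a (suc zero))
  minor-diag a = trans (+-congˡ (trans (-‿cong (zeroˡ _)) -0#≈0#)) (+-identityʳ _)

  det-diag-invertible : ∀ {n} (a : Vec (Fin 2 → Unit) n) → ∃[ k ] k * det (Vec.map diag a) ≈ 1#
  det-diag-invertible []       = 1# , *-identityˡ 1#
  det-diag-invertible (a ∷ as) with det-diag-invertible as
  ... | k , kD≈1 = (i₀ * i₁) * k , trans (*-congˡ (*-congʳ (minor-diag a)))
    (trans (solve 6 (λ i j k u v D → ((i :* j) :* k) :* ((u :* v) :* D) ⊜ (u :* i) :* ((v :* j) :* (k :* D))) refl i₀ i₁ k _ _ _)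
    (trans (*-cong (inverse (a zero)) (trans (*-cong (inverse (a (suc zero))) kD≈1) (*-identityˡ 1#))) (*-identityˡ 1#)))
    where
    i₀ i₁ : 𝕂
    i₀ = inv (a zero)
    i₁ = inv (a (suc zero))

  det-unitriangular : ∀ {n} (t : Vec 𝕂 n) → det (Vec.map unitriangular t) ≈ 1#
  det-unitriangular []       = refl
  det-unitriangular (t ∷ ts) = trans (*-cong
    (trans (+-cong (*-identityˡ 1#) (trans (-‿cong (zeroʳ t)) -0#≈0#)) (+-identityʳ 1#))
    (det-unitriangular ts)) (*-identityˡ 1#)

  ^-inverse : ∀ {k D} → k * D ≈ 1# → ∀ n → k ^ n * D ^ n ≈ 1#
  ^-inverse kD≈1 zero    = *-identityˡ 1#
  ^-inverse kD≈1 (suc n) = trans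
    (solve 4 (λ a b c d → (a :* b) :* (c :* d) ⊜ (a :* c) :* (b :* d)) refl _ _ _ _)
    (trans (*-cong kD≈1 (^-inverse kD≈1 n)) (*-identityˡ 1#))

  1^ : ∀ {D} → D ≈ 1# → ∀ n → D ^ n ≈ 1#
  1^ D≈1 zero    = refl
  1^ D≈1 (suc n) = trans (*-cong D≈1 (1^ D≈1 n)) (*-identityˡ 1#)

  -- Raising both entries of every component by one multiplies the character by each product a₁a₂,
  -- the determinant of the diagonal matrix in that component.
  character-suc : ∀ {m n} (λs : Vec (Partition m) n) s (a : Vec (Fin 2 → Unit) n) →
    character (shiftedConjugate λs (suc s)) a ≈ det (Vec.map diag a) * character (shiftedConjugate λs s) a
  character-suc []       s []       = sym (*-identityˡ 1#)
  character-suc (p ∷ λs) s (a ∷ as) = trans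
    (*-cong (*-cong (power l zero (a zero)) (power l (suc zero) (a (suc zero)))) (character-suc λs s as))
    (trans (solve 6 (λ u v x y D c → ((u :* x) :* (v :* y)) :* (D :* c) ⊜ ((u :* v) :* D) :* ((x :* y) :* c)) refl _ _ _ _ _ _)
    (*-congʳ (*-congʳ (sym (minor-diag a)))))
    where
    l : List ℕ
    l = conjugate (parts p)

    -- Exponents are therefore natural numbers, so only the first clause of `_^ℤ_` occurs.
    toℤ²-nonNegative : ∀ l i → ∃[ k ] toℤ² l i ≡ ℤ.+ k
    toℤ²-nonNegative []          i          = 0 , ≡.refl
    toℤ²-nonNegative (a ∷ _)     zero       = a , ≡.refl
    toℤ²-nonNegative (_ ∷ [])    (suc zero) = 0 , ≡.refl
    toℤ²-nonNegative (_ ∷ b ∷ _) (suc zero) = b , ≡.refl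

    power : ∀ l i u → (u ^ℤ (toℤ² l i ℤ.+ toℤ² (suc s ∷ suc s ∷ []) i)) ≈
                      val u * (u ^ℤ (toℤ² l i ℤ.+ toℤ² (s ∷ s ∷ []) i))
    power l i u with toℤ² l i | toℤ²-nonNegative l i
    power l zero       u | _ | k , ≡.refl = reflexive (≡.cong (val u ^_) (ℕ.+-suc k s))
    power l (suc zero) u | _ | k , ≡.refl = reflexive (≡.cong (val u ^_) (ℕ.+-suc k s))

  character-+ : ∀ {m} (λs : Vec (Partition m) d) n s (a : Vec (Fin 2 → Unit) d) →
    character (shiftedConjugate λs (n ℕ.+ s)) a ≈ det (Vec.map diag a) ^ n * character (shiftedConjugate λs s) a
  character-+ λs zero    s a = sym (*-identityˡ _)
  character-+ λs (suc n) s a = trans (character-suc λs (n ℕ.+ s) a)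
    (trans (*-congˡ (character-+ λs n s a)) (sym (*-assoc _ _ _)))

  HWV-resp : ∀ {r μ} {x y : ⋀ d} → x ≋ y → HWV r μ x → HWV r μ y
  HWV-resp p h = record
    { degree    = ∈-resp p (HWV.degree h)
    ; weight    = λ a → ≋-trans (act-cong _ (≋-sym p)) (≋-trans (HWV.weight h a) (∧-cong ≋-refl p))
    ; invariant = λ t → ≋-trans (act-cong _ (≋-sym p)) (≋-trans (HWV.invariant h t) p)
    }

  module _ {m : ℕ} (λs : Vec (Partition m) d) where

    HWV-X^ : ∀ {r r′ s x} n → iterate X n x ∈⋀^ r′ →
             HWV r (shiftedConjugate λs s) x → HWV r′ (shiftedConjugate λs (n ℕ.+ s)) (iterate X n x)
    HWV-X^ {s = s} {x} n X^x∈ h = record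
      { degree    = X^x∈
      ; weight    = λ a → let D = det (Vec.map diag a) ; χ = character (shiftedConjugate λs s) a in begin
          act (Vec.map diag a) (iterate X n x)                      ≈⟨ act-X^ (Vec.map diag a) n x ⟩
          η (D ^ n) ∧ iterate X n (act (Vec.map diag a) x)          ≈⟨ ∧-cong ≋-refl (Additive.cong X^-additive (HWV.weight h a)) ⟩
          η (D ^ n) ∧ iterate X n (η χ ∧ x)                         ≈⟨ ∧-cong ≋-refl (X^-scale n χ x) ⟩
          η (D ^ n) ∧ η χ ∧ iterate X n x                           ≈⟨ scale-scale _ _ _ ⟩
          η (D ^ n * χ) ∧ iterate X n x                             ≈⟨ ∧-cong (η-cong (character-+ λs n s a)) ≋-refl ⟨
          η (character (shiftedConjugate λs (n ℕ.+ s)) a) ∧ iterate X n x ∎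
      ; invariant = λ t → begin
          act (Vec.map unitriangular t) (iterate X n x)             ≈⟨ act-X^ (Vec.map unitriangular t) n x ⟩
          η (det (Vec.map unitriangular t) ^ n) ∧ iterate X n (act (Vec.map unitriangular t) x)
            ≈⟨ ∧-cong (η-cong (1^ (det-unitriangular t) n)) (Additive.cong X^-additive (HWV.invariant h t)) ⟩
          η 1# ∧ iterate X n x                                      ≈⟨ ∧-identityˡ _ ⟩
          iterate X n x                                             ∎
      }
      where
      X^-additive : Additive (iterate X n)
      X^-additive = iterate-additive X-additive n

    -- For g diagonal or unitriangular, X^n (g x) and X^n (χ x) agree after multiplication by the
    -- invertible (det g)^n. Both g x and χ x have degree r, where X^n is injective.
    HWV-X^⁻¹ : ∀ {r r′ s x} n →
      (∀ {y z} → y ∈⋀^ r → z ∈⋀^ r → iterate X n y ≋ iterate X n z → y ≋ z) → x ∈⋀^ r →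
      HWV r′ (shiftedConjugate λs (n ℕ.+ s)) (iterate X n x) → HWV r (shiftedConjugate λs s) x
    HWV-X^⁻¹ {r} {s = s} {x} n injective x∈ h = record
      { degree    = x∈
      ; weight    = λ a → descend (Vec.map diag a) _ (det-diag-invertible a)
          (≋-trans (HWV.weight h a) (∧-cong (η-cong (character-+ λs n s a)) ≋-refl))
      ; invariant = λ t → ≋-trans
          -- Invariance is the case of the trivial character and determinant 1.
          (descend (Vec.map unitriangular t) 1# (1# , trans (*-identityˡ _) (det-unitriangular t))
            (≋-trans (HWV.invariant h t) (≋-sym (≋-trans
              (∧-cong (η-cong (trans (*-identityʳ _) (1^ (det-unitriangular t) n))) ≋-refl) (∧-identityˡ _)))))
          (∧-identityˡ x)
      }
      where
      descend : ∀ gs χ → ∃[ k ] k * det gs ≈ 1# →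
                act gs (iterate X n x) ≋ η (det gs ^ n * χ) ∧ iterate X n x → act gs x ≋ η χ ∧ x
      descend gs χ (k , kD≈1) eq = injective (act-degree gs x∈) (∈-scale χ x∈) (begin
        iterate X n (act gs x)                                    ≈⟨ unscale _ ⟨
        η (k ^ n) ∧ η (D ^ n) ∧ iterate X n (act gs x)            ≈⟨ ∧-cong ≋-refl (act-X^ gs n x) ⟨
        η (k ^ n) ∧ act gs (iterate X n x)                        ≈⟨ ∧-cong ≋-refl eq ⟩
        η (k ^ n) ∧ η (D ^ n * χ) ∧ iterate X n x                 ≈⟨ ∧-cong ≋-refl (scale-scale _ _ _) ⟨
        η (k ^ n) ∧ η (D ^ n) ∧ η χ ∧ iterate X n x               ≈⟨ unscale _ ⟩
        η χ ∧ iterate X n x                                       ≈⟨ X^-scale n χ x ⟨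
        iterate X n (η χ ∧ x)                                     ∎)
        where
        D : 𝕂
        D = det gs

        unscale : ∀ y → η (k ^ n) ∧ η (D ^ n) ∧ y ≋ y
        unscale y = ≋-trans (scale-scale _ _ _)
          (≋-trans (∧-cong (η-cong (^-inverse kD≈1 n)) ≋-refl) (∧-identityˡ y))

-- Arithmetic of the index ranges

module _ {m N ℓ n : ℕ} (m≤N : m ≤ N) where

  open ℕ-Solver.+-*-Solver using (solve; _:+_; _:*_; _:=_; con)

  -- Here N - m = ℓ + 2n, which bounds ℓ + n. Together with `range-down` it shows that N - ℓ and N +
  -- ℓ are admissible indices simultaneously, so the two spaces are read as zero together.
  range-up : ℓ ≤ N → N ∸ ℓ ≡ m ℕ.+ 2 ℕ.* n → ℓ ℕ.+ n ≤ N ∸ m × N ℕ.+ ℓ ≡ m ℕ.+ 2 ℕ.* (ℓ ℕ.+ n)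
  range-up ℓ≤N eq = ≡.subst (ℓ ℕ.+ n ≤_) (≡.sym N∸m) (ℕ.m≤m+n (ℓ ℕ.+ n) n)
    , ≡.trans (≡.cong (ℕ._+ ℓ) N≡)
        (solve 3 (λ m l n → m :+ (l :+ n :+ n) :+ l := m :+ con 2 :* (l :+ n)) ≡.refl m ℓ n)
    where
    N≡ : N ≡ m ℕ.+ (ℓ ℕ.+ n ℕ.+ n)
    N≡ = ≡.trans (≡.sym (ℕ.m∸n+n≡m ℓ≤N)) (≡.trans (≡.cong (ℕ._+ ℓ) eq)
      (solve 3 (λ m l n → m :+ con 2 :* n :+ l := m :+ (l :+ n :+ n)) ≡.refl m ℓ n))

    N∸m : N ∸ m ≡ ℓ ℕ.+ n ℕ.+ n
    N∸m = ≡.trans (≡.cong (_∸ m) N≡) (ℕ.m+n∸m≡n m _)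

  -- With t = N - m the equation reads t + ℓ = 2n. As n ≤ t this forces ℓ ≤ n, so the truncated
  -- difference k = n ∸ ℓ is exact.
  range-down : n ≤ N ∸ m → N ℕ.+ ℓ ≡ m ℕ.+ 2 ℕ.* n →
               ∃[ k ] (k ≤ N ∸ m × n ≡ ℓ ℕ.+ k × N ∸ ℓ ≡ m ℕ.+ 2 ℕ.* k)
  range-down n≤t eq = k , ℕ.≤-trans (ℕ.m∸n≤m n ℓ) n≤t , n≡ , N∸ℓ
    where
    t k : ℕ
    t = N ∸ m
    k = n ∸ ℓ

    N≡ : m ℕ.+ t ≡ N
    N≡ = ℕ.m+[n∸m]≡n m≤N

    t+ℓ : t ℕ.+ ℓ ≡ n ℕ.+ n
    t+ℓ = ℕ.+-cancelˡ-≡ m _ _ (≡.trans (≡.sym (ℕ.+-assoc m t ℓ)) (≡.trans (≡.cong (ℕ._+ ℓ) N≡)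
      (≡.trans eq (solve 2 (λ m n → m :+ con 2 :* n := m :+ (n :+ n)) ≡.refl m n))))

    ℓ≤n : ℓ ≤ n
    ℓ≤n = ℕ.+-cancelˡ-≤ n ℓ n (≡.subst (n ℕ.+ ℓ ≤_) t+ℓ (ℕ.+-monoˡ-≤ ℓ n≤t))

    n≡ : n ≡ ℓ ℕ.+ k
    n≡ = ≡.sym (ℕ.m+[n∸m]≡n ℓ≤n)

    N∸ℓ : N ∸ ℓ ≡ m ℕ.+ 2 ℕ.* k
    N∸ℓ = ≡.trans (≡.cong (_∸ ℓ) (≡.sym N≡)) (≡.trans (≡.cong (λ t → m ℕ.+ t ∸ ℓ) t≡)
      (≡.trans (≡.cong (_∸ ℓ) (≡.sym (ℕ.+-assoc m _ ℓ))) (ℕ.m+n∸n≡m _ ℓ)))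
      where
      t≡ : t ≡ 2 ℕ.* k ℕ.+ ℓ
      t≡ = ℕ.+-cancelʳ-≡ ℓ _ _ (≡.trans t+ℓ (≡.trans (≡.cong₂ ℕ._+_ n≡ n≡)
        (solve 2 (λ l k → l :+ k :+ (l :+ k) := con 2 :* k :+ l :+ l) ≡.refl ℓ k)))

-- The isomorphism between highest weight spaces

module HighestWeight {c ℓ} (K : CommutativeRing c ℓ) (d : ℕ) where

  open MultilinearAlgebra K
  open CommutativeRing K using (_≈_; _*_; 1#; +-monoid)
  open import Algebra.Properties.Monoid.Mult +-monoid using () renaming (_×_ to _×ᴷ_)
  open Contraction K d
  open CayleyForm K d
  open HardLefschetz K d
  open Equivariance K d
  open import Algebra.Properties.Group (Ring.+-group (ExteriorAlgebra.⋀-ring K {d}))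
    using (x∙y⁻¹≈ε⇒x≈y; x≈y⇒x∙y⁻¹≈ε)
  open Sl₂ R.+-abelianGroup using (Additive; homo; neg-homo; zero-homo; cong; iterate-additive; module Bijective)

  U-degree : ∀ {m r x} {λs : Vec (Partition m) d} → U λs r x → x ∈⋀^ r
  U-degree (inRange n _ _ h)  = HWV.degree h
  U-degree (outOfRange _ x≋0) = ∈-resp (≋-sym x≋0) ∈-zero

  X^≡iterate : ∀ n → X^ {d} n ≡ iterate X n
  X^≡iterate zero    = ≡.refl
  X^≡iterate (suc n) = ≡.cong (X ∘_) (X^≡iterate n)

  U-isomorphism : ¬ (2 ∣ d) → 2 ℕ.^ d ≡ 2 ℕ.* 2 ℕ.^ (d ∸ 1) →
    (∀ n → ∃[ k ] (suc n ×ᴷ 1#) * k ≈ 1#) →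
    ∀ {m} (λs : Vec (Partition m) d) → m ≤ 2 ℕ.^ (d ∸ 1) → ∀ l → l ≤ 2 ℕ.^ (d ∸ 1) →
    IsIsomorphism (U λs (2 ℕ.^ (d ∸ 1) ∸ l)) (U λs (2 ℕ.^ (d ∸ 1) ℕ.+ l)) (X^ l)
  U-isomorphism 2∤d dim invert {m} λs m≤N l l≤N = ≡.subst (IsIsomorphism _ _) (≡.sym (X^≡iterate l)) (record
    { maps        = maps′
    ; congruent   = λ _ _ → cong X^l
    ; additive    = λ _ _ → homo X^l _ _
    ; homogeneous = λ k _ → X^-scale l k _
    ; injective   = λ Ux Uy → injective (U-degree Ux) (U-degree Uy)
    ; surjective  = surjective′
    })
    where
    N : ℕ
    N = 2 ℕ.^ (d ∸ 1)

    X^l : Additive (iterate X l)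
    X^l = iterate-additive X-additive l

    degrees : N ∸ l ℕ.+ 2 ℕ.* l ≡ N ℕ.+ l
    degrees = ≡.trans (≡.sym (ℕ.+-assoc (N ∸ l) l (l ℕ.+ 0)))
      (≡.cong₂ ℕ._+_ (ℕ.m∸n+n≡m l≤N) (ℕ.+-identityʳ l))

    open Bijective (≡.subst (λ s → Sl₂.Bijective R.+-abelianGroup (_∈⋀^ (N ∸ l)) (_∈⋀^ s) (iterate X l)) degrees
      (hardLefschetz 2∤d invert (N ∸ l) l (≡.trans dim (≡.cong (2 ℕ.*_) (≡.sym (ℕ.m∸n+n≡m l≤N))))))

    injective : ∀ {x y} → x ∈⋀^ (N ∸ l) → y ∈⋀^ (N ∸ l) → iterate X l x ≋ iterate X l y → x ≋ y
    injective x∈ y∈ eq = x∙y⁻¹≈ε⇒x≈y _ _ (kernel (∈-sum x∈ (∈-scale _ y∈))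
      (≋-trans (homo X^l _ _) (≋-trans (⊕-cong ≋-refl (neg-homo X^l _)) (x≈y⇒x∙y⁻¹≈ε eq))))

    maps′ : ∀ {x} → U λs (N ∸ l) x → U λs (N ℕ.+ l) (iterate X l x)
    maps′ (inRange n _ eq h) =
      let n′≤ , eq′ = range-up {n = n} m≤N l≤N eq
      in inRange (l ℕ.+ n) n′≤ eq′ (HWV-X^ λs l (maps (HWV.degree h)) h)
    -- If N + l were an admissible index, then so would N - l be.
    maps′ (outOfRange ∄n x≋0) = outOfRange
      (λ (n , n≤ , eq) → let k , k≤ , _ , eq′ = range-down {n = n} m≤N n≤ eq in ∄n (k , k≤ , eq′))
      (≋-trans (cong X^l x≋0) (zero-homo X^l))

    surjective′ : ∀ {y} → U λs (N ℕ.+ l) y → ∃[ x ] (U λs (N ∸ l) x × iterate X l x ≋ y)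
    surjective′ {y} (inRange n n≤ eq h) with range-down {n = n} m≤N n≤ eq | surjective (HWV.degree h)
    ... | k , k≤ , ≡.refl , eq′ | x , x∈ , X^x≋y =
      x , inRange k k≤ eq′ (HWV-X^⁻¹ λs l injective x∈ (HWV-resp (≋-sym X^x≋y) h)) , X^x≋y
    surjective′ (outOfRange ∄n y≋0) = η _
      , outOfRange
          (λ (n , n≤ , eq) → let n′≤ , eq′ = range-up {n = n} m≤N l≤N eq in ∄n (l ℕ.+ n , n′≤ , eq′))
          ≋-refl
      , ≋-trans (zero-homo X^l) (≋-sym y≋0)

-- Inverses of positive integers in the complex numbers

module _ where

  open CommutativeRing Defs.ℂ
  open import Algebra.Properties.Monoid.Mult +-monoid using () renaming (_×_ to _·_)

  private
    fromℕ : ℕ → ℚ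
    fromℕ zero    = 0ℚ
    fromℕ (suc n) = 1ℚ ℚ.+ fromℕ n

    re-· : ∀ n t → seq (proj₁ (n · 1#)) t ≡ fromℕ n
    re-· zero    t = ≡.refl
    re-· (suc n) t = ≡.cong (1ℚ ℚ.+_) (re-· n t)

    im-· : ∀ n t → seq (proj₂ (n · 1#)) t ≡ 0ℚ
    im-· zero    t = ≡.refl
    im-· (suc n) t = ≡.cong (0ℚ ℚ.+_) (im-· n t)

    fromℕ-nonNegative : ∀ n → ℚ.NonNegative (fromℕ n)
    fromℕ-nonNegative zero    = _
    fromℕ-nonNegative (suc n) = ℚ.nonNeg+nonNeg⇒nonNeg 1ℚ (fromℕ n) {{fromℕ-nonNegative n}}

  -- The multiple (n + 1) · 1 is the constant sequence of the positive rational q = n + 1, with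
  -- imaginary part zero; the constant sequence 1/q inverts it term by term.
  ℂ-invert : ∀ n → ∃[ k ] (suc n · 1#) * k ≈ 1#
  ℂ-invert n = (Real.fromℚ (ℚ.1/ q) , Real.fromℚ 0ℚ)
    , Real.pointwise {proj₁ p} {Real.1#} (λ t → ≡.trans
        (≡.cong₂ (λ a b → a ℚ.* ℚ.1/ q ℚ.+ ℚ.- (b ℚ.* 0ℚ)) (re-· (suc n) t) (im-· (suc n) t))
        (≡.cong (ℚ._+ 0ℚ) (ℚ.*-inverseʳ q)))
    , Real.pointwise {proj₂ p} {Real.0#} (λ t → ≡.trans
        (≡.cong₂ (λ a b → a ℚ.* 0ℚ ℚ.+ b ℚ.* ℚ.1/ q) (re-· (suc n) t) (im-· (suc n) t))
        (≡.cong₂ ℚ._+_ (ℚ.*-zeroʳ q) (ℚ.*-zeroˡ (ℚ.1/ q))))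
    where
    q : ℚ
    q = fromℕ (suc n)
    instance
      q-nonZero : ℚ.NonZero q
      q-nonZero = ℚ.pos⇒nonZero q {{ℚ.pos+nonNeg⇒pos 1ℚ (fromℕ n) {{fromℕ-nonNegative n}}}}
    p : Carrier
    p = (suc n · 1#) * (Real.fromℚ (ℚ.1/ q) , Real.fromℚ 0ℚ)

open import Defs
open import Data.Nat.Base using (_+_; _^_; ⌊_/2⌋)

corollary5p8 : (d : ℕ) (3≤d : 3 ≤ d) → ¬ (2 ∣ d) →
    (m : ℕ) → m ≤ 2 ^ (d ∸ 1) →
    (λs : Vec (Partition m) d) →
    (∀ j → AtMostTwoColumns (lookup λs j)) →
    conjugate (parts (lookup λs (inject≤ {3} zero 3≤d))) ≡ oneRow m →
    (2 ∣ m → ∀ ℓ → ℓ ≤ ⌊ m /2⌋ →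
    IsIsomorphism (U λs (2 ^ (d ∸ 1) ∸ ℓ)) (U λs (2 ^ (d ∸ 1) + ℓ)) (X^ ℓ)) ×
    (¬ (2 ∣ m) → ∀ ℓ → 1 ≤ ℓ → ℓ ≤ ⌊ m /2⌋ →
    IsIsomorphism (U λs (2 ^ (d ∸ 1) ∸ ℓ)) (U λs (2 ^ (d ∸ 1) + ℓ)) (X^ ℓ))
corollary5p8 d@(suc _) 3≤d 2∤d m m≤N λs _ _ =
  (λ _ ℓ ℓ≤m/2 → isomorphism ℓ ℓ≤m/2) , (λ _ ℓ _ ℓ≤m/2 → isomorphism ℓ ℓ≤m/2)
  where
  isomorphism : ∀ ℓ → ℓ ≤ ⌊ m /2⌋ →
    IsIsomorphism (U λs (2 ^ (d ∸ 1) ∸ ℓ)) (U λs (2 ^ (d ∸ 1) + ℓ)) (X^ ℓ)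
  -- As d is a successor, 2^d = 2 · 2^(d-1) holds by computation. The last argument chains ℓ ≤ ⌊m/2⌋
  -- ≤ m ≤ 2^(d-1).
  isomorphism ℓ ℓ≤m/2 = HighestWeight.U-isomorphism ℂ d 2∤d ≡.refl ℂ-invert λs m≤N ℓ
    (ℕ.≤-trans ℓ≤m/2 (ℕ.≤-trans (ℕ.⌊n/2⌋≤n m) m≤N))
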